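{- There exists no elliptic curve $E$ over $\mathbb{Q}$ that has a $\mathbb{Q}$-rational point of order $12$ and whose conductor is $N_E=p^{\alpha}q^{\beta}$, where $p\neq q$ are primes and $\alpha,\beta>0$ are integers.
   Context: For an elliptic curve $E/\mathbb{Q}$, $N_E$ denotes its conductor. -}

module Defs where

open import Algebra.Bundles.Raw using (RawRing; RawMonoid)
import Algebra.Definitions.RawMonoid as RawMonoidDefinitions
open import Data.Bool.Base using (Bool; _∧_; not; if_then_else_)
open import Data.Integer.Base as ℤ using (ℤ; +_; ∣_∣) hiding (module ℤ)
open import Data.List.Base
  using (List; [_]; map; filter; findᵇ; upTo; cartesianProduct)
open import Data.Maybe.Base using (fromMaybe)
open import Data.Nat.Base as ℕ using (ℕ; zero; suc) hiding (module ℕ)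
open import Data.Nat.Divisibility using (_∣?_; quotient)
open import Data.Nat.ListAction using (product)
open import Data.Nat.Primality using (prime?)
open import Data.Product.Base using (_×_; _,_)
open import Data.Rational.Base as ℚ
  using (ℚ; 0ℚ; 1ℚ; ↥_; ↧ₙ_; _/_; ≢-nonZero) hiding (module ℚ)
import Data.Rational.Properties as ℚₚ
open import Data.Rational.Solver using (module +-*-Solver)
open import Function.Base using (id; _∘_)
open import Level using (0ℓ)
open import Relation.Binary.PropositionalEquality
  using (_≡_; _≢_; refl; sym; trans; cong; cong₂; subst; module ≡-Reasoning)
open import Relation.Nullary using (¬_; yes; no; does)

------------------------------------------------------------------------
-- Weierstrass equations  y² + a₁xy + a₃y = x³ + a₂x² + a₄x + a₆

record Weierstrass (A : Set) : Set where
  constructor weierstrass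
  field
    a₁ a₂ a₃ a₄ a₆ : A

-- ι supplies the integer constants of the formulas.
module Invariants (R : RawRing 0ℓ 0ℓ) (ι : ℤ → RawRing.Carrier R)
                  (W : Weierstrass (RawRing.Carrier R)) where

  open RawRing R
  open Weierstrass W

  private
    infixl 6 _-_
    _-_ : Carrier → Carrier → Carrier
    x - y = x + (- y)

  b₂ b₄ b₆ b₈ c₄ Δ : Carrier
  b₂ = a₁ * a₁ + ι (+ 4) * a₂
  b₄ = ι (+ 2) * a₄ + a₁ * a₃
  b₆ = a₃ * a₃ + ι (+ 4) * a₆
  b₈ = a₁ * a₁ * a₆ + ι (+ 4) * a₂ * a₆ - a₁ * a₃ * a₄ + a₂ * a₃ * a₃ - a₄ * a₄
  c₄ = b₂ * b₂ - ι (+ 24) * b₄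
  Δ  = ι (+ 9) * b₂ * b₄ * b₆ - b₂ * b₂ * b₈ - ι (+ 8) * b₄ * b₄ * b₄ - ι (+ 27) * b₆ * b₆

module Invariantsℤ = Invariants ℤ.+-*-rawRing id
module Invariantsℚ = Invariants ℚ.+-*-rawRing (_/ 1)

record EllipticCurve : Set where
  field
    equation : Weierstrass ℚ
    Δ≢0      : Invariantsℚ.Δ equation ≢ 0ℚ

------------------------------------------------------------------------
-- Rational points and the chord-and-tangent law

module GroupLaw (W : Weierstrass ℚ) where

  open Weierstrass W
  open ℚ using (_+_; _*_; -_; _-_; _÷_; 1/_)

  OnCurve : ℚ → ℚ → Set
  OnCurve x y =
    y * y + a₁ * x * y + a₃ * y ≡ x * x * x + a₂ * x * x + a₄ * x + a₆

  data Point : Set where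
    ∞      : Point
    affine : (x y : ℚ) → .(OnCurve x y) → Point

  -- (x₃ , y₃) is the negative of the third intersection point of the
  -- curve with the line of slope m through (x₁ , y₁) and (x₂ , _).
  module Line (m x₁ y₁ x₂ : ℚ) where
    x₃ y₃ : ℚ
    x₃ = m * m + a₁ * m - a₂ - x₁ - x₂
    y₃ = - (m * (x₃ - x₁) + y₁) - a₁ * x₃ - a₃

  -- The curve is F = 0.  If (x₁ , y₁) lies on it, α vanishes when the line
  -- of slope m through that point also meets the curve above x₂ (with
  -- multiplicity two if x₁ = x₂).
  private
    F : ℚ → ℚ → ℚ
    F x y = (y * y + a₁ * x * y + a₃ * y) - (x * x * x + a₂ * x * x + a₄ * x + a₆)

    α : (m x₁ y₁ x₂ : ℚ) → ℚ
    α m x₁ y₁ x₂ = m * (y₁ + y₁) + m * m * (x₂ - x₁) + a₁ * (y₁ + m * x₂) + a₃ * m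
                 - (x₂ * x₂ + x₂ * x₁ + x₁ * x₁) - a₂ * (x₂ + x₁) - a₄

    open ≡-Reasoning
    open import Algebra.Properties.Group ℚₚ.+-0-group
      using () renaming (x∙y⁻¹≈ε⇒x≈y to p-q≡0⇒p≡q; x≈y⇒x∙y⁻¹≈ε to p≡q⇒p-q≡0)

    ÷-cancel : ∀ p q → .{{_ : ℚ.NonZero q}} → (p ÷ q) * q ≡ p
    ÷-cancel p q = begin
      p * 1/ q * q    ≡⟨ ℚₚ.*-assoc p (1/ q) q ⟩
      p * (1/ q * q)  ≡⟨ cong (p *_) (ℚₚ.*-inverseˡ q) ⟩
      p * 1ℚ          ≡⟨ ℚₚ.*-identityʳ p ⟩
      p               ∎

    *-zero-cancelʳ : ∀ p q → q ≢ 0ℚ → p * q ≡ 0ℚ → p ≡ 0ℚ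
    *-zero-cancelʳ p q q≢0 eq = begin
      p               ≡⟨ sym (ℚₚ.*-identityʳ p) ⟩
      p * 1ℚ          ≡⟨ cong (p *_) (sym (ℚₚ.*-inverseʳ q)) ⟩
      p * (q * 1/ q)  ≡⟨ sym (ℚₚ.*-assoc p q (1/ q)) ⟩
      p * q * 1/ q    ≡⟨ cong (_* 1/ q) eq ⟩
      0ℚ * 1/ q       ≡⟨ ℚₚ.*-zeroˡ (1/ q) ⟩
      0ℚ              ∎
      where instance _ = ≢-nonZero q≢0

    line-onCurve : ∀ m x₁ y₁ x₂ → let open Line m x₁ y₁ x₂ in
                   OnCurve x₁ y₁ → α m x₁ y₁ x₂ ≡ 0ℚ → OnCurve x₃ y₃
    line-onCurve m x₁ y₁ x₂ on₁ α≡0 = p-q≡0⇒p≡q _ _ (begin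
      F x₃ y₃
        ≡⟨ identity x₃ ⟩
      F x₁ y₁ + (x₃ - x₁) * (α m x₁ y₁ x₂ + (x₃ - x₂) * (x₃ - x₃))
        ≡⟨ cong₂ (λ u v → u + (x₃ - x₁) * v) (p≡q⇒p-q≡0 on₁)
             (cong₂ (λ u v → u + (x₃ - x₂) * v) α≡0 (ℚₚ.+-inverseʳ x₃)) ⟩
      0ℚ + (x₃ - x₁) * (0ℚ + (x₃ - x₂) * 0ℚ)
        ≡⟨ solve 2 (λ u v → con 0ℚ :+ u :* (con 0ℚ :+ v :* con 0ℚ) := con 0ℚ)
             refl (x₃ - x₁) (x₃ - x₂) ⟩
      0ℚ ∎)
      where
      open Line m x₁ y₁ x₂
      open +-*-Solver
      identity : ∀ x → F x (- (m * (x - x₁) + y₁) - a₁ * x - a₃)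
               ≡ F x₁ y₁ + (x - x₁) * (α m x₁ y₁ x₂ + (x - x₂) * (x₃ - x))
      identity x = solve 10
        (λ a₁ a₂ a₃ a₄ a₆ m x₁ y₁ x₂ x →
          let F′ = λ x y → (y :* y :+ a₁ :* x :* y :+ a₃ :* y)
                        :- (x :* x :* x :+ a₂ :* x :* x :+ a₄ :* x :+ a₆)
          in F′ x (:- (m :* (x :- x₁) :+ y₁) :- a₁ :* x :- a₃)
          := F′ x₁ y₁ :+ (x :- x₁) :*
             ((m :* (y₁ :+ y₁) :+ m :* m :* (x₂ :- x₁) :+ a₁ :* (y₁ :+ m :* x₂) :+ a₃ :* m
                 :- (x₂ :* x₂ :+ x₂ :* x₁ :+ x₁ :* x₁) :- a₂ :* (x₂ :+ x₁) :- a₄)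
              :+ (x :- x₂) :* ((m :* m :+ a₁ :* m :- a₂ :- x₁ :- x₂) :- x)))
        refl a₁ a₂ a₃ a₄ a₆ m x₁ y₁ x₂ x

    chord-α : ∀ m x₁ y₁ x₂ y₂ → OnCurve x₁ y₁ → OnCurve x₂ y₂ →
              x₂ - x₁ ≢ 0ℚ → m * (x₂ - x₁) ≡ y₂ - y₁ → α m x₁ y₁ x₂ ≡ 0ℚ
    chord-α m x₁ y₁ x₂ y₂ on₁ on₂ x₂-x₁≢0 slope =
      *-zero-cancelʳ _ (x₂ - x₁) x₂-x₁≢0 (begin
        α m x₁ y₁ x₂ * (x₂ - x₁)
          ≡⟨ identity ⟩
        F x₂ (y₁ + m * (x₂ - x₁)) - F x₁ y₁
          ≡⟨ cong (λ u → F x₂ (y₁ + u) - F x₁ y₁) slope ⟩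
        F x₂ (y₁ + (y₂ - y₁)) - F x₁ y₁
          ≡⟨ cong (λ u → F x₂ u - F x₁ y₁)
               (solve 2 (λ y₁ y₂ → y₁ :+ (y₂ :- y₁) := y₂) refl y₁ y₂) ⟩
        F x₂ y₂ - F x₁ y₁
          ≡⟨ cong₂ _-_ (p≡q⇒p-q≡0 on₂) (p≡q⇒p-q≡0 on₁) ⟩
        0ℚ ∎)
      where
      open +-*-Solver
      identity : α m x₁ y₁ x₂ * (x₂ - x₁) ≡ F x₂ (y₁ + m * (x₂ - x₁)) - F x₁ y₁
      identity = solve 9
        (λ a₁ a₂ a₃ a₄ a₆ m x₁ y₁ x₂ →
          let F′ = λ x y → (y :* y :+ a₁ :* x :* y :+ a₃ :* y)
                        :- (x :* x :* x :+ a₂ :* x :* x :+ a₄ :* x :+ a₆)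
          in (m :* (y₁ :+ y₁) :+ m :* m :* (x₂ :- x₁) :+ a₁ :* (y₁ :+ m :* x₂) :+ a₃ :* m
                 :- (x₂ :* x₂ :+ x₂ :* x₁ :+ x₁ :* x₁) :- a₂ :* (x₂ :+ x₁) :- a₄) :* (x₂ :- x₁)
          := F′ x₂ (y₁ :+ m :* (x₂ :- x₁)) :- F′ x₁ y₁)
        refl a₁ a₂ a₃ a₄ a₆ m x₁ y₁ x₂

    same-y : ∀ x y₁ y₂ → OnCurve x y₁ → OnCurve x y₂ →
             y₁ + y₂ + a₁ * x + a₃ ≢ 0ℚ → y₁ ≡ y₂
    same-y x y₁ y₂ on₁ on₂ ≢0 = p-q≡0⇒p≡q y₁ y₂ (*-zero-cancelʳ _ _ ≢0 (begin
      (y₁ - y₂) * (y₁ + y₂ + a₁ * x + a₃)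
        ≡⟨ solve 5 (λ a₁ a₃ x y₁ y₂ →
             (y₁ :- y₂) :* (y₁ :+ y₂ :+ a₁ :* x :+ a₃) :=
             (y₁ :* y₁ :+ a₁ :* x :* y₁ :+ a₃ :* y₁) :-
             (y₂ :* y₂ :+ a₁ :* x :* y₂ :+ a₃ :* y₂)) refl a₁ a₃ x y₁ y₂ ⟩
      (y₁ * y₁ + a₁ * x * y₁ + a₃ * y₁) - (y₂ * y₂ + a₁ * x * y₂ + a₃ * y₂)
        ≡⟨ p≡q⇒p-q≡0 (trans on₁ (sym on₂)) ⟩
      0ℚ ∎))
      where open +-*-Solver

    tangent-α : ∀ m x y → m * (y + y + a₁ * x + a₃) ≡
                  (+ 3 / 1) * x * x + (+ 2 / 1) * a₂ * x + a₄ - a₁ * y →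
                α m x y x ≡ 0ℚ
    tangent-α m x y slope = trans
      (solve 7 (λ a₁ a₂ a₃ a₄ m x y →
          m :* (y :+ y) :+ m :* m :* (x :- x) :+ a₁ :* (y :+ m :* x) :+ a₃ :* m
            :- (x :* x :+ x :* x :+ x :* x) :- a₂ :* (x :+ x) :- a₄
          := m :* (y :+ y :+ a₁ :* x :+ a₃) :-
             (con (+ 3 / 1) :* x :* x :+ con (+ 2 / 1) :* a₂ :* x :+ a₄ :- a₁ :* y))
        refl a₁ a₂ a₃ a₄ m x y)
      (p≡q⇒p-q≡0 slope)
      where open +-*-Solver

  infixl 6 _⊕_

  _⊕_ : Point → Point → Point
  ∞                ⊕ Q                = Q
  P@(affine _ _ _) ⊕ ∞                = P
  affine x₁ y₁ on₁ ⊕ affine x₂ y₂ on₂ with x₁ ℚₚ.≟ x₂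
  ... | no x₁≢x₂ = affine x₃ y₃ (line-onCurve m x₁ y₁ x₂ on₁
                     (chord-α m x₁ y₁ x₂ y₂ on₁ on₂ x₂-x₁≢0 (÷-cancel _ _)))
    where
    x₂-x₁≢0 : x₂ - x₁ ≢ 0ℚ
    x₂-x₁≢0 = x₁≢x₂ ∘ sym ∘ p-q≡0⇒p≡q x₂ x₁
    instance _ = ≢-nonZero x₂-x₁≢0
    m : ℚ
    m = (y₂ - y₁) ÷ (x₂ - x₁)
    open Line m x₁ y₁ x₂
  ... | yes refl with y₁ + y₂ + a₁ * x₁ + a₃ ℚₚ.≟ 0ℚ
  ...   | yes _  = ∞
  -- On the curve, y₁ = y₂ here, so the denominator is 2y₁ + a₁x₁ + a₃.
  ...   | no  ≢0 = affine x₃ y₃ (line-onCurve m x₁ y₁ x₁ on₁ (tangent-α m x₁ y₁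
                     (subst (λ y → m * (y₁ + y + a₁ * x₁ + a₃) ≡ numerator)
                       (sym (same-y x₁ y₁ y₂ on₁ on₂ ≢0)) (÷-cancel _ _))))
    where
    instance _ = ≢-nonZero ≢0
    numerator m : ℚ
    numerator = (+ 3 / 1) * x₁ * x₁ + (+ 2 / 1) * a₂ * x₁ + a₄ - a₁ * y₁
    m = numerator ÷ (y₁ + y₂ + a₁ * x₁ + a₃)
    open Line m x₁ y₁ x₁

  rawMonoid : RawMonoid 0ℓ 0ℓ
  rawMonoid = record { Carrier = Point ; _≈_ = _≡_ ; _∙_ = _⊕_ ; ε = ∞ }

module _ (M : RawMonoid 0ℓ 0ℓ) where
  open RawMonoid M
  open RawMonoidDefinitions M using () renaming (_×_ to _·_)

  HasOrder : Carrier → ℕ → Set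
  HasOrder x n =
    0 ℕ.< n × n · x ≈ ε × (∀ k → 0 ℕ.< k → k ℕ.< n → ¬ (k · x ≈ ε))

open EllipticCurve using (equation)

RationalPoint : EllipticCurve → Set
RationalPoint E = GroupLaw.Point (equation E)

PointHasOrder : (E : EllipticCurve) → RationalPoint E → ℕ → Set
PointHasOrder E = HasOrder (GroupLaw.rawMonoid (equation E))

------------------------------------------------------------------------
-- The conductor
--
-- N_E is the product of p ^ f_p, where f_p is 0, 1 or 2 + δ_p according
-- as E has good, multiplicative or additive reduction at p.  The wild
-- part δ_p is given by the Ogg–Saito formula
--   δ_p = v_p(Δ_min) ∸ 1 ∸ m_p,
-- where m_p is the number of irreducible components over the algebraic
-- closure of 𝔽_p of the special fibre of the minimal regular model.
-- Both m_p and v_p(Δ_min) come from Tate's algorithm.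

-- The fuel n suffices, as p ^ k ∣ n implies k < n.  For n = 0 or p ≤ 1
-- the value is meaningless.
valuation : ℕ → ℕ → ℕ
valuation p n = go n n
  where
  go : ℕ → ℕ → ℕ
  go zero       n = 0
  go (suc fuel) n with p ∣? n
  ... | yes p∣n = suc (go fuel (quotient p∣n))
  ... | no  _   = 0

module _ where
  open ℤ using (_+_; _*_; _-_)
  open Weierstrass

  -- The substitution x = x′ + r, y = y′ + s x′ + t.
  translate : (r s t : ℤ) → Weierstrass ℤ → Weierstrass ℤ
  translate r s t (weierstrass a₁ a₂ a₃ a₄ a₆) = weierstrass
    (a₁ + + 2 * s)
    (a₂ - s * a₁ + + 3 * r - s * s)
    (a₃ + r * a₁ + + 2 * t)
    (a₄ - s * a₃ + + 2 * r * a₂ - (t + r * s) * a₁ + + 3 * r * r - + 2 * s * t)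
    (a₆ + r * a₄ + r * r * a₂ + r * r * r - t * a₃ - t * t - r * t * a₁)

  -- Used only for divisors n > 0 of a.
  divideBy : ℕ → ℤ → ℤ
  divideBy zero      a = a
  divideBy n@(suc _) a = a ℤ./ℕ n

  -- The substitution x = p²x′, y = p³y′.
  rescale : ℕ → Weierstrass ℤ → Weierstrass ℤ
  rescale p (weierstrass a₁ a₂ a₃ a₄ a₆) = weierstrass
    (divideBy (p ℕ.^ 1) a₁) (divideBy (p ℕ.^ 2) a₂) (divideBy (p ℕ.^ 3) a₃)
    (divideBy (p ℕ.^ 4) a₄) (divideBy (p ℕ.^ 6) a₆)

data Kodaira : Set where
  I I*                   : ℕ → Kodaira
  II III IV IV* III* II* : Kodaira

components : Kodaira → ℕ
components (I zero)    = 1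
components (I (suc n)) = suc n
components (I* n)      = 5 ℕ.+ n
components II          = 1
components III         = 2
components IV          = 3
components IV*         = 7
components III*        = 8
components II*         = 9

-- Tate's algorithm at a prime p, following Silverman, "Advanced Topics in
-- the Arithmetic of Elliptic Curves", IV.9.  Each normalisation "after a
-- change of coordinates we may assume" is found by a finite search.
module Tate (p : ℕ) where
  open ℤ using (_+_; _*_; _-_)
  open ℕ using (_^_)
  open Weierstrass
  open Invariantsℤ

  -- p ^ k ∣ a
  infix 4 _∣ᵖ_
  _∣ᵖ_ : ℕ → ℤ → Bool
  k ∣ᵖ a = does (p ^ k ∣? ∣ a ∣)

  vΔ : Weierstrass ℤ → ℕ
  vΔ W = valuation p ∣ Δ W ∣

  divisible : (e₁ e₂ e₃ e₄ e₆ : ℕ) → Weierstrass ℤ → Bool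
  divisible e₁ e₂ e₃ e₄ e₆ W =
    (e₁ ∣ᵖ a₁ W) ∧ (e₂ ∣ᵖ a₂ W) ∧ (e₃ ∣ᵖ a₃ W) ∧ (e₄ ∣ᵖ a₄ W) ∧ (e₆ ∣ᵖ a₆ W)

  -- Representatives of p ^ k ℤ modulo p ^ (1 + k).
  residues : ℕ → List ℤ
  residues k = map (λ i → + (p ^ k ℕ.* i)) (upTo p)

  -- The first of the given translates of W satisfying P.  In every use
  -- below, one exists if p is prime; W itself is only a default value.
  normalise : (rs ss ts : List ℤ) → (Weierstrass ℤ → Bool) → Weierstrass ℤ → Weierstrass ℤ
  normalise rs ss ts P W = fromMaybe W (findᵇ P
    (map (λ (r , s , t) → translate r s t W)
      (cartesianProduct rs (cartesianProduct ss ts))))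

  none : List ℤ
  none = [ + 0 ]

  -- The index n ≥ 1 of type I*ₙ.  At stage k the model is divisible by
  -- (1 , 1 , 1 + k , 2 + k , 2 + 2k), and the two quadratics
  --   Y² + (a₃ / p^(1+k)) Y - a₆ / p^(2+2k)                 (n = 2k - 1)
  --   (a₂ / p) X² + (a₄ / p^(2+k)) X + a₆ / p^(3+2k)        (n = 2k)
  -- are tested for distinct roots in turn.  Since n < vΔ W, the fuel vΔ W
  -- suffices.
  starIndex : (fuel k : ℕ) → Weierstrass ℤ → ℕ
  starIndex zero       k W = 0
  starIndex (suc fuel) k W =
    if not ((3 ℕ.+ 2 ℕ.* k) ∣ᵖ b₆ W) then 2 ℕ.* k ℕ.∸ 1 else
    let W₁ = normalise none none (residues (1 ℕ.+ k))
               (divisible 1 1 (2 ℕ.+ k) (2 ℕ.+ k) (3 ℕ.+ 2 ℕ.* k)) W in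
    if not ((5 ℕ.+ 2 ℕ.* k) ∣ᵖ a₄ W₁ * a₄ W₁ - + 4 * a₂ W₁ * a₆ W₁) then 2 ℕ.* k else
    starIndex fuel (suc k)
      (normalise (residues (1 ℕ.+ k)) none none
        (divisible 1 1 (2 ℕ.+ k) (3 ℕ.+ k) (4 ℕ.+ 2 ℕ.* k)) W₁)

  -- p⁶ times the discriminant of T³ + (a₂/p) T² + (a₄/p²) T + a₆/p³.
  cubicDiscriminant : Weierstrass ℤ → ℤ
  cubicDiscriminant W =
    a₂ W * a₂ W * a₄ W * a₄ W - + 4 * a₄ W * a₄ W * a₄ W
      - + 4 * a₂ W * a₂ W * a₂ W * a₆ W - + 27 * a₆ W * a₆ W
      + + 18 * a₂ W * a₄ W * a₆ W

  -- The Kodaira symbol, and v_p(Δ) for a minimal model.  The fuel must be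
  -- at least vΔ W; each rescaling lowers vΔ by 12, so when no fuel is left
  -- the reduction is good.
  tate : (fuel : ℕ) → Weierstrass ℤ → Kodaira × ℕ
  tate zero       W = I 0 , 0
  tate (suc fuel) W =
    if not (1 ∣ᵖ Δ W) then (I 0 , 0) else
    -- move the singular point of the reduction to (0 , 0)
    let W₁ = normalise (residues 0) none (residues 0) (divisible 0 0 1 1 1) W in
    if not (1 ∣ᵖ b₂ W₁) then (I (vΔ W₁) , vΔ W₁) else
    if not (2 ∣ᵖ a₆ W₁) then (II  , vΔ W₁) else
    if not (3 ∣ᵖ b₈ W₁) then (III , vΔ W₁) else
    if not (3 ∣ᵖ b₆ W₁) then (IV  , vΔ W₁) else
    let W₂ = normalise none (residues 0) (residues 1) (divisible 1 1 2 2 3) W₁ in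
    if not (7 ∣ᵖ cubicDiscriminant W₂) then (I* 0 , vΔ W₂) else
    -- p ∤ (a₂/p)² - 3 a₄/p²: the cubic has a double but no triple root
    if not (3 ∣ᵖ a₂ W₂ * a₂ W₂ - + 3 * a₄ W₂)
    then (let W₃ = normalise (residues 1) none none (divisible 1 1 2 3 4) W₂ in
          (I* (starIndex (vΔ W₃) 1 W₃) , vΔ W₃))
    else
    let W₄ = normalise (residues 1) none none (divisible 1 2 2 3 4) W₂ in
    if not (5 ∣ᵖ b₆ W₄) then (IV* , vΔ W₄) else
    let W₅ = normalise none none (residues 2) (divisible 1 2 3 3 5) W₄ in
    if not (4 ∣ᵖ a₄ W₅) then (III* , vΔ W₅) else
    if not (divisible 1 2 3 4 6 W₅) then (II* , vΔ W₅) else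
    tate fuel (rescale p W₅)

conductorExponent : ℕ → Weierstrass ℤ → ℕ
conductorExponent p W = exponent (Tate.tate p (Tate.vΔ p W) W)
  where
  exponent : Kodaira × ℕ → ℕ
  exponent (I zero    , _) = 0
  exponent (I (suc _) , _) = 1
  exponent (K         , v) = 2 ℕ.+ (v ℕ.∸ 1 ℕ.∸ components K)

-- The substitution x = x′ / d², y = y′ / d³, with d the product of the
-- denominators of the coefficients; the new coefficients dⁱ aᵢ are
-- integers, so that they equal their numerators.
integralModel : Weierstrass ℚ → Weierstrass ℤ
integralModel (weierstrass a₁ a₂ a₃ a₄ a₆) = weierstrass
  (clear 1 a₁) (clear 2 a₂) (clear 3 a₃) (clear 4 a₄) (clear 6 a₆)
  where
  d : ℕ
  d = ↧ₙ a₁ ℕ.* ↧ₙ a₂ ℕ.* ↧ₙ a₃ ℕ.* ↧ₙ a₄ ℕ.* ↧ₙ a₆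
  clear : ℕ → ℚ → ℤ
  clear i a = ↥ ((+ (d ℕ.^ i) / 1) ℚ.* a)

-- Primes of bad reduction divide Δ of the integral model, hence are
-- among the primes up to ∣Δ∣.
conductor : EllipticCurve → ℕ
conductor E = product (map (λ p → p ℕ.^ conductorExponent p W)
                           (filter prime? (upTo (suc ∣ Invariantsℤ.Δ W ∣))))
  where
  W : Weierstrass ℤ
  W = integralModel (equation E)

module Submission where

-- A curve with a rational point of order 12 is isomorphic over ℚ to a member of
-- a one-parameter family, with parameter x / y for coprime integers x and y
-- such that x y (x + y) (x - y) ≠ 0.  This product is divisible by 2 and by 3,
-- and as it vanishes only at cusps, j has a pole modulo 2 and modulo 3; so it
-- has modulo every odd prime ℓ dividing x² + y².  Such an ℓ exists and is not 3,
-- because x² + y² > 2 is a sum of two coprime squares.  Hence at least three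
-- primes divide the conductor.
--
-- Bad reduction is detected on the j-invariant c₄³ / Δ, which Tate’s algorithm
-- preserves: if it ends with good reduction at p, then j is p-integral.
--
-- The family is found without associativity of the group law, from the chain
-- of lines through P and k P.  If P = (0 , 0) with horizontal tangent, nₖ is
-- the slope of the line through P and k P, and Xₖ the abscissa of k P, then
-- Xₖ + Xₖ₊₁, Xₖ Xₖ₊₁ and (nₖ₋₁ + nₖ + a₁) Xₖ are polynomials in nₖ and the
-- coefficients of the curve.  Since 12 P = ∞ the chain is symmetric about k = 6,
-- so that n₅ = n₆, and this is the equation of X₁(12).

-- The conductor is defined by running Tate's algorithm on a model that merely clears denominators
-- and need not be minimal. What is extracted from the algorithm is therefore only this: exponent 0
-- at p forces j to be p-integral. That concerns `c₄` and `Δ` alone, which translations fix and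
-- rescalings change by fixed powers of p, and it lets E be compared with any integral model of the
-- family through j.
--
-- The model of the family is awkward at primes dividing x - y, a factor of `e`. At 2 it is then a
-- scaling by 2 of a smaller model, and at 3 the numbers `A`, `B` and `e` all become divisible by 3;
-- hence `Halved` and `Thirded`. These cases do occur: for x and y odd and congruent modulo 3, none
-- of x, y is even, and x - y may be the only one of the four factors that 3 divides.
--
-- Solving the chain means cancelling factors that vanish for points of smaller order. They are
-- nonzero because the abscissa of k P differs from that of P for 1 < k < 11.

open import Defs
open import Algebra.Bundles using (CommutativeRing)
open import Algebra.Bundles.Raw using (RawRing)
import Algebra.Definitions.RawMonoid as RawMonoidDefinitions
open import Algebra.Morphism.Construct.Identity using (isRingHomomorphism)
open import Algebra.Morphism.Structures using (module RingMorphisms)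
import Algebra.Properties.Group as GroupProperties
import Algebra.Solver.Ring as RingSolver
open import Algebra.Solver.Ring.AlmostCommutativeRing
  using (_-Raw-AlmostCommutative⟶_; fromCommutativeRing)
open import Algebra.Structures using (IsCommutativeRing)
open import Data.Bool.Base using (Bool; true; false; not; if_then_else_; _∧_)
open import Data.Empty using (⊥)
open import Data.Integer.Base as ℤ using (ℤ; +_; +0) hiding (module ℤ)
open import Data.Integer.DivMod using (a≡a%ℕn+[a/ℕn]*n; n%ℕd<d)
import Data.Integer.Divisibility.Signed as Signed
import Data.Integer.Properties as ℤₚ
open import Data.List.Base using (List; []; _∷_; map; filter; upTo; findᵇ; cartesianProduct)
open import Data.List.Membership.Propositional.Properties using (∈-map⁺; ∈-filter⁺; ∈-upTo⁺)
open import Data.List.Relation.Unary.All using ([]; _∷_)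
open import Data.Maybe.Base as Maybe using (fromMaybe)
open import Data.Nat.Base as ℕ using (ℕ; zero; suc; s≤s; z≤n) hiding (module ℕ)
import Data.Nat.Coprimality as Coprimality
import Data.Nat.Divisibility as ℕ
import Data.Nat.DivMod as ℕ
open import Data.Nat.ListAction using (product)
open import Data.Nat.ListAction.Properties using (∈⇒∣product)
open import Data.Nat.Primality
  using (Prime; prime?; euclidsLemma; prime⇒irreducible; prime⇒nonTrivial; ¬prime[1])
open import Data.Nat.Primality.Factorisation using (PrimeFactorisation; factorise)
import Data.Nat.Properties as ℕₚ
open import Data.Product.Base using (Σ; ∃; _×_; _,_; proj₁; proj₂)
open import Data.Rational.Base as ℚ using (ℚ; mkℚ; 0ℚ; 1ℚ; _/_; ≢-nonZero) hiding (module ℚ)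
import Data.Rational.Properties as ℚₚ
import Data.Rational.Unnormalised.Base as ℚᵘ
import Data.Rational.Unnormalised.Properties as ℚᵘₚ
open import Data.Sum.Base as Sum using (_⊎_; inj₁; inj₂; [_,_]′)
open import Function.Base using (_∘_; id)
open import Level using (0ℓ)
open import Relation.Binary.PropositionalEquality as ≡
  using (_≡_; _≢_; module ≡-Reasoning)
open import Relation.Nullary using (¬_; Dec; yes; no; contradiction)
open import Relation.Nullary.Decidable
  using (True; toWitness; recompute; decidable-stable; dec⇒maybe; from-no; from-yes)

open RingMorphisms using (IsRingHomomorphism)

-- The embedding of ℤ in ℚ

module _ where
  open ≡ using (refl; sym; trans; cong; cong₂; subst; subst₂)
  open ℤ using (∣_∣)

  -- The reduced form of `i / 1`, which is stuck on a variable `i`. With numerator and denominator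
  -- visible, sums and products in ℚ compute.
  fromℤ : ℤ → ℚ
  fromℤ i = mkℚ i 0 (Coprimality.sym (Coprimality.1-coprimeTo ∣ i ∣))

  ι : ℤ → ℚ
  ι i = i / 1

  ι≡fromℤ : ∀ i → ι i ≡ fromℤ i
  ι≡fromℤ i = ℚₚ.↥p/↧p≡p (fromℤ i)

  ↥-ι : ∀ i → ℚ.↥ (ι i) ≡ i
  ↥-ι i = cong ℚ.↥_ (ι≡fromℤ i)

  ι-injective : ∀ {i j} → ι i ≡ ι j → i ≡ j
  ι-injective {i} {j} eq = trans (sym (↥-ι i)) (trans (cong ℚ.↥_ eq) (↥-ι j))

  ι-homo-+ : ∀ i j → ι (i ℤ.+ j) ≡ ι i ℚ.+ ι j
  ι-homo-+ i j = begin
    ι (i ℤ.+ j)             ≡⟨ cong₂ (λ u v → ι (u ℤ.+ v)) (ℤₚ.*-identityʳ i) (ℤₚ.*-identityʳ j) ⟨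
    fromℤ i ℚ.+ fromℤ j     ≡⟨ cong₂ ℚ._+_ (ι≡fromℤ i) (ι≡fromℤ j) ⟨
    ι i ℚ.+ ι j             ∎
    where open ≡-Reasoning

  ι-homo-* : ∀ i j → ι (i ℤ.* j) ≡ ι i ℚ.* ι j
  ι-homo-* i j = sym (cong₂ ℚ._*_ (ι≡fromℤ i) (ι≡fromℤ j))

  ι-homo-neg : ∀ i → ι (ℤ.- i) ≡ ℚ.- ι i
  ι-homo-neg i = begin
    ι (ℤ.- i)       ≡⟨ ι≡fromℤ (ℤ.- i) ⟩
    fromℤ (ℤ.- i)   ≡⟨ neg i ⟩
    ℚ.- fromℤ i     ≡⟨ cong ℚ.-_ (ι≡fromℤ i) ⟨
    ℚ.- ι i         ∎
    where
    open ≡-Reasoning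
    neg : ∀ i → fromℤ (ℤ.- i) ≡ ℚ.- fromℤ i
    neg (+ zero)   = refl
    neg (+ suc n)  = refl
    neg ℤ.-[1+ n ] = refl

-- Valuations

module _ where
  open ≡ using (refl; sym; trans; cong; cong₂; subst; subst₂)
  open import Data.Nat.Divisibility using (_∣_; _∣?_; divides; quotient; m∣m*n)

  -- The auxiliary function in the definition of valuation cannot be named from
  -- outside; it is recovered here as the solution of a unification problem,
  -- which needs its arguments to be distinct variables.
  mutual
    valuationGo : ℕ → ℕ → ℕ → ℕ → ℕ
    valuationGo = _

    private
      valuationStep : ∀ p n → Dec (p ∣ suc n) → ℕ
      valuationStep p n (yes p∣n) = suc (valuationGo p (suc n) n (quotient p∣n))
      valuationStep p n (no  _)   = 0

      valuation-suc : ∀ p n → valuation p (suc n) ≡ valuationStep p n (p ∣? suc n)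
      valuation-suc p n with p ∣? suc n
      ... | no _    = refl
      ... | yes p∣n with quotient p∣n | suc n
      ...   | q | N = refl

  module _ {p : ℕ} (1<p : 1 ℕ.< p) where

    private instance
      p≢0 : ℕ.NonZero p
      p≢0 = ℕ.>-nonZero (ℕₚ.<-trans (s≤s z≤n) 1<p)

    private
      -- The local function of `valuation` carries the enclosing argument `N` along; letting it
      -- change to `N′` makes values inside `valuation p m` and `valuation p (p * m)` comparable.
      valuationGo-mono : ∀ N N′ {f f′} m → f ℕ.≤ f′ → valuationGo p N f m ℕ.≤ valuationGo p N′ f′ m
      valuationGo-mono N N′ m z≤n = z≤n
      valuationGo-mono N N′ m (s≤s f≤f′) with p ∣? m
      ... | no _    = z≤n
      ... | yes p∣m = s≤s (valuationGo-mono N N′ (quotient p∣m) f≤f′)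

      valuationGo-* : ∀ N fuel m → suc (valuationGo p N fuel m) ≡ valuationGo p N (suc fuel)
          (p ℕ.* m)
      valuationGo-* N fuel m with p ∣? p ℕ.* m
      ... | no p∤pm          = contradiction (m∣m*n m) p∤pm
      ... | yes (divides q eq) = cong (suc ∘ valuationGo p N fuel)
        (ℕₚ.*-cancelˡ-≡ m q p (trans eq (ℕₚ.*-comm q p)))

    ∣⇒0<valuation : ∀ {n} → 0 ℕ.< n → p ∣ n → 0 ℕ.< valuation p n
    ∣⇒0<valuation {suc n} _ p∣n with p ∣? suc n
    ... | yes _  = s≤s z≤n
    ... | no p∤n = contradiction p∣n p∤n

    valuation-* : ∀ {m} → 0 ℕ.< m → valuation p m ℕ.< valuation p (p ℕ.* m)
    valuation-* {m} 0<m = begin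
      suc (valuation p m)                    ≡⟨ valuationGo-* m m m ⟩
      valuationGo p m (suc m) (p ℕ.* m)      ≤⟨ valuationGo-mono m (p ℕ.* m) (p ℕ.* m) m<p*m ⟩
      valuation p (p ℕ.* m)                  ∎
      where
      open ℕₚ.≤-Reasoning
      m<p*m : m ℕ.< p ℕ.* m
      m<p*m = subst (m ℕ.<_) (ℕₚ.*-comm m p) (ℕₚ.m<m*n m p {{ℕ.>-nonZero 0<m}} 1<p)

    -- Used with k = 12: a rescaling in Tate's algorithm lowers the valuation of Δ by at least 12
    -- while it consumes one unit of fuel.
    valuation-^* : ∀ k {m} → 0 ℕ.< m → k ℕ.+ valuation p m ℕ.≤ valuation p (p ℕ.^ k ℕ.* m)
    valuation-^* zero    {m} 0<m = ℕₚ.≤-reflexive (cong (valuation p) (sym (ℕₚ.+-identityʳ m)))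
    valuation-^* (suc k) {m} 0<m = begin
      suc (k ℕ.+ valuation p m)              ≤⟨ s≤s (valuation-^* k 0<m) ⟩
      suc (valuation p (p ℕ.^ k ℕ.* m))      ≤⟨ valuation-* (ℕₚ.*-mono-≤ (ℕₚ.m^n>0 p k) 0<m) ⟩
      valuation p (p ℕ.* (p ℕ.^ k ℕ.* m))    ≡⟨ cong (valuation p) (ℕₚ.*-assoc p (p ℕ.^ k) m) ⟨
      valuation p (p ℕ.^ suc k ℕ.* m)        ∎
      where open ℕₚ.≤-Reasoning

-- Changes of coordinates

-- Over ℤ, `translated` unfolds to `translate`. The general ring lets the same formulas be used over
-- ℚ and be reified by the solver. `scaled` goes in the direction opposite to `rescale`, so no
-- division occurs.
module Substitution (A : RawRing 0ℓ 0ℓ) (ι : ℤ → RawRing.Carrier A) where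
  open RawRing A

  infixr 8 _^_
  _^_ : Carrier → ℕ → Carrier
  x ^ zero  = ι (+ 1)
  x ^ suc n = x * x ^ n

  private
    infixl 6 _-_
    _-_ : Carrier → Carrier → Carrier
    a - b = a + (- b)

  translated : (r s t : Carrier) → Weierstrass Carrier → Weierstrass Carrier
  translated r s t (weierstrass a₁ a₂ a₃ a₄ a₆) = weierstrass
    (a₁ + ι (+ 2) * s)
    (a₂ - s * a₁ + ι (+ 3) * r - s * s)
    (a₃ + r * a₁ + ι (+ 2) * t)
    (a₄ - s * a₃ + ι (+ 2) * r * a₂ - (t + r * s) * a₁ + ι (+ 3) * r * r - ι (+ 2) * s * t)
    (a₆ + r * a₄ + r * r * a₂ + r * r * r - t * a₃ - t * t - r * t * a₁)

  scaled : Carrier → Weierstrass Carrier → Weierstrass Carrier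
  scaled u (weierstrass a₁ a₂ a₃ a₄ a₆) =
    weierstrass (u ^ 1 * a₁) (u ^ 2 * a₂) (u ^ 3 * a₃) (u ^ 4 * a₄) (u ^ 6 * a₆)

-- For nonzero `m` and Δ this is j = k / m, written without division so that it makes sense over ℤ.
c₄³∣Δ : ∀ (A : RawRing 0ℓ 0ℓ) (ι : ℤ → RawRing.Carrier A) →
        RawRing.Carrier A → RawRing.Carrier A → Weierstrass (RawRing.Carrier A) → Set
c₄³∣Δ A ι m k W = m * (c₄ W * c₄ W * c₄ W) ≈ k * Δ W
  where
  open RawRing A
  open Invariants A ι

IsCommutativeRawRing : RawRing 0ℓ 0ℓ → Set
IsCommutativeRawRing A = IsCommutativeRing _≈_ _+_ _*_ -_ 0# 1#
  where open RawRing A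

module Identities
  (A : RawRing 0ℓ 0ℓ) (isCommutativeRing : IsCommutativeRawRing A)
  (ι : ℤ → RawRing.Carrier A) (ι-homo : IsRingHomomorphism ℤ.+-*-rawRing A ι)
  where

  open RawRing A

  private
    R : CommutativeRing 0ℓ 0ℓ
    R = record { isCommutativeRing = isCommutativeRing }

    hom : ℤ.+-*-rawRing -Raw-AlmostCommutative⟶ fromCommutativeRing R
    hom = record
      { ⟦_⟧ = ι ; +-homo = +-homo ; *-homo = *-homo ; -‿homo =
          -‿homo ; 0-homo = 0#-homo ; 1-homo = 1#-homo }
      where open IsRingHomomorphism ι-homo

  open CommutativeRing R using (refl; sym; trans; reflexive; setoid; *-cong; *-congˡ)

  open RingSolver ℤ.+-*-rawRing (fromCommutativeRing R) hom
    (λ i j → Maybe.map (λ eq → reflexive (≡.cong ι eq)) (dec⇒maybe (i ℤₚ.≟ j)))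
    using (Polynomial; solve; _:+_; _:*_; _:-_; :-_; _:=_; con) public

  -- Evaluated in this ring, the formulas for c₄ and Δ reify themselves.
  polynomials : ℕ → RawRing 0ℓ 0ℓ
  polynomials n = record
    { Carrier = Polynomial n ; _≈_ = _≡_ ; _+_ = _:+_ ; _*_ = _:*_ ; -_ = :-_
    ; 0# = con (+ 0) ; 1# = con (+ 1) }

  private
    module I        = Invariants A ι
    module S        = Substitution A ι
    module Iₚ n     = Invariants (polynomials n) con
    module Sₚ n     = Substitution (polynomials n) con

  c₄-translated : ∀ r s t W → I.c₄ (S.translated r s t W) ≈ I.c₄ W
  c₄-translated r s t (weierstrass a₁ a₂ a₃ a₄ a₆) = solve 8 (λ r s t a₁ a₂ a₃ a₄ a₆ →
      let W = weierstrass a₁ a₂ a₃ a₄ a₆ in Iₚ.c₄ 8 (Sₚ.translated 8 r s t W) := Iₚ.c₄ 8 W)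
    refl r s t a₁ a₂ a₃ a₄ a₆

  Δ-translated : ∀ r s t W → I.Δ (S.translated r s t W) ≈ I.Δ W
  Δ-translated r s t (weierstrass a₁ a₂ a₃ a₄ a₆) = solve 8 (λ r s t a₁ a₂ a₃ a₄ a₆ →
      let W = weierstrass a₁ a₂ a₃ a₄ a₆ in Iₚ.Δ 8 (Sₚ.translated 8 r s t W) := Iₚ.Δ 8 W)
    refl r s t a₁ a₂ a₃ a₄ a₆

  c₄-scaled : ∀ u W → I.c₄ (S.scaled u W) ≈ u S.^ 4 * I.c₄ W
  c₄-scaled u (weierstrass a₁ a₂ a₃ a₄ a₆) = solve 6 (λ u a₁ a₂ a₃ a₄ a₆ →
      let W = weierstrass a₁ a₂ a₃ a₄ a₆ in Iₚ.c₄ 6 (Sₚ.scaled 6 u W) := Sₚ._^_ 6 u 4 :* Iₚ.c₄ 6 W)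
    refl u a₁ a₂ a₃ a₄ a₆

  Δ-scaled : ∀ u W → I.Δ (S.scaled u W) ≈ u S.^ 12 * I.Δ W
  Δ-scaled u (weierstrass a₁ a₂ a₃ a₄ a₆) = solve 6 (λ u a₁ a₂ a₃ a₄ a₆ →
      let W = weierstrass a₁ a₂ a₃ a₄ a₆ in Iₚ.Δ 6 (Sₚ.scaled 6 u W) := Sₚ._^_ 6 u 12 :* Iₚ.Δ 6 W)
    refl u a₁ a₂ a₃ a₄ a₆

  -- c₄ has weight 4 and Δ weight 12, so scalings cancel in c₄³ / Δ. Here d clears the denominators
  -- of E, v leads to the Tate normal form and e from there to the family.
  cube-^ : ∀ d e v c D → let d⁴c = d S.^ 4 * c ; e⁴v⁴c = e S.^ 4 * (v S.^ 4 * c) in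
           d⁴c * d⁴c * d⁴c * (e S.^ 12 * (v S.^ 12 * D)) ≈ d S.^ 12 * D * (e⁴v⁴c * e⁴v⁴c * e⁴v⁴c)
  cube-^ = solve 5 (λ d e v c D →
      let d⁴c = Sₚ._^_ 5 d 4 :* c ; e⁴v⁴c = Sₚ._^_ 5 e 4 :* (Sₚ._^_ 5 v 4 :* c) in
      d⁴c :* d⁴c :* d⁴c :* (Sₚ._^_ 5 e 12 :* (Sₚ._^_ 5 v 12 :* D)) :=
          Sₚ._^_ 5 d 12 :* D :* (e⁴v⁴c :* e⁴v⁴c :* e⁴v⁴c))
    refl

  module _ (m k u : Carrier) (W : Weierstrass Carrier) where
    open import Relation.Binary.Reasoning.Setoid setoid
    private
      c c′ : Carrier
      c  = I.c₄ W
      c′ = I.c₄ (S.scaled u W)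
      c′≈ : c′ ≈ u S.^ 4 * c
      c′≈ = c₄-scaled u W

      mc′³ : m * (c′ * c′ * c′) ≈ u S.^ 12 * (m * (c * c * c))
      mc′³ = begin
        m * (c′ * c′ * c′)
            ≈⟨ *-congˡ (*-cong (*-cong c′≈ c′≈) c′≈) ⟩
        m * (u S.^ 4 * c * (u S.^ 4 * c) * (u S.^ 4 * c))
          ≈⟨ solve 3 (λ u m c → let u⁴c = Sₚ._^_ 3 u 4 :* c in
               m :* (u⁴c :* u⁴c :* u⁴c) := Sₚ._^_ 3 u 12 :* (m :* (c :* c :* c))) refl u m c ⟩
        u S.^ 12 * (m * (c * c * c))                        ∎

      kΔ′ : k * I.Δ (S.scaled u W) ≈ u S.^ 12 * (k * I.Δ W)
      kΔ′ = begin
        k * I.Δ (S.scaled u W)      ≈⟨ *-congˡ (Δ-scaled u W) ⟩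
        k * (u S.^ 12 * I.Δ W)
            ≈⟨ solve 3 (λ v k D → k :* (v :* D) := v :* (k :* D)) refl (u S.^ 12) k (I.Δ W) ⟩
        u S.^ 12 * (k * I.Δ W)      ∎

    c₄³∣Δ-scaled : c₄³∣Δ A ι m k W → c₄³∣Δ A ι m k (S.scaled u W)
    c₄³∣Δ-scaled eq = trans mc′³ (trans (*-congˡ eq) (sym kΔ′))

    c₄³∣Δ-unscaled : c₄³∣Δ A ι m k (S.scaled u W) →
                     u S.^ 12 * (m * (c * c * c)) ≈ u S.^ 12 * (k * I.Δ W)
    c₄³∣Δ-unscaled eq = trans (sym mc′³) (trans eq kΔ′)

module Identitiesℤ = Identities ℤ.+-*-rawRing ℤₚ.+-*-isCommutativeRing id
  (isRingHomomorphism ℤ.+-*-rawRing ≡.refl)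

ι-isRingHomomorphism : IsRingHomomorphism ℤ.+-*-rawRing ℚ.+-*-rawRing ι
ι-isRingHomomorphism = record
  { isSemiringHomomorphism = record
      { isNearSemiringHomomorphism = record
          { +-isMonoidHomomorphism = record
              { isMagmaHomomorphism =
                  record { isRelHomomorphism = record { cong = ≡.cong ι } ; homo = ι-homo-+ }
              ; ε-homo = ≡.refl }
          ; *-homo = ι-homo-* }
      ; 1#-homo = ≡.refl }
  ; -‿homo = ι-homo-neg }

module Identitiesℚ = Identities ℚ.+-*-rawRing ℚₚ.+-*-isCommutativeRing ι ι-isRingHomomorphism

module Substitutionℤ = Substitution ℤ.+-*-rawRing id
module Substitutionℚ = Substitution ℚ.+-*-rawRing ι

-- Evaluating a formula in this ring shows that it commutes with ι.
record IntegralRational : Set where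
  field
    integer  : ℤ
    rational : ℚ
    equal    : rational ≡ ι integer
open IntegralRational

integral : ℤ → IntegralRational
integral i = record { integer = i ; rational = ι i ; equal = ≡.refl }

integralRationals : RawRing 0ℓ 0ℓ
integralRationals = record
  { Carrier = IntegralRational
  ; _≈_ = _≡_
  ; _+_ = λ x y → record
      { integer  = integer x ℤ.+ integer y
      ; rational = rational x ℚ.+ rational y
      ; equal    = ≡.trans (≡.cong₂ ℚ._+_ (equal x) (equal y))
          (≡.sym (ι-homo-+ (integer x) (integer y))) }
  ; _*_ = λ x y → record
      { integer  = integer x ℤ.* integer y
      ; rational = rational x ℚ.* rational y
      ; equal    = ≡.trans (≡.cong₂ ℚ._*_ (equal x) (equal y))
          (≡.sym (ι-homo-* (integer x) (integer y))) }
  ; -_  = λ x → record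
      { integer  = ℤ.- integer x
      ; rational = ℚ.- rational x
      ; equal    = ≡.trans (≡.cong ℚ.-_ (equal x)) (≡.sym (ι-homo-neg (integer x))) }
  ; 0#  = integral (+ 0)
  ; 1#  = integral (+ 1)
  }

mapWeierstrass : ∀ {A B : Set} → (A → B) → Weierstrass A → Weierstrass B
mapWeierstrass f (weierstrass a₁ a₂ a₃ a₄ a₆) = weierstrass (f a₁) (f a₂) (f a₃) (f a₄) (f a₆)

module _ (W : Weierstrass ℤ) where
  private module I = Invariants integralRationals integral (mapWeierstrass integral W)

  c₄-ι : Invariantsℚ.c₄ (mapWeierstrass ι W) ≡ ι (Invariantsℤ.c₄ W)
  c₄-ι = equal I.c₄

  Δ-ι : Invariantsℚ.Δ (mapWeierstrass ι W) ≡ ι (Invariantsℤ.Δ W)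
  Δ-ι = equal I.Δ

module _ where
  open ≡ using (refl)

  weierstrass-cong : ∀ {A : Set} {a₁ a₂ a₃ a₄ a₆ a₁′ a₂′ a₃′ a₄′ a₆′ : A} →
    a₁ ≡ a₁′ → a₂ ≡ a₂′ → a₃ ≡ a₃′ → a₄ ≡ a₄′ → a₆ ≡ a₆′ →
    weierstrass a₁ a₂ a₃ a₄ a₆ ≡ weierstrass a₁′ a₂′ a₃′ a₄′ a₆′
  weierstrass-cong refl refl refl refl refl = refl

-- The universal curve over X₁(12)

-- An integral form of the universal elliptic curve with a point of order 12,
-- (0 , 0): here t = x / (x - y) is the usual coordinate on X₁(12), and the
-- Tate normal form with b = - B / e² and 1 - c = A / e has been scaled by e.
module Family (R : RawRing 0ℓ 0ℓ) (ι : ℤ → RawRing.Carrier R) (x y : RawRing.Carrier R) where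
  open RawRing R using (Carrier; _+_; _*_; -_)

  private
    infixl 6 _⊖_
    _⊖_ : Carrier → Carrier → Carrier
    a ⊖ b = a + (- b)

  Q₂ Q₃ e A B : Carrier
  Q₂ = x * x + y * y
  Q₃ = x * x + x * y + y * y
  e  = x * x * x * (x ⊖ y)
  A  = e ⊖ y * (x + y) * Q₃
  B  = - (x * x * y * (x + y) * Q₃ * Q₂)

  curve : Weierstrass Carrier
  curve = weierstrass A B (B * e) (ι (+ 0)) (ι (+ 0))

-- If x ≡ y mod 2, the model is not minimal at 2: it is a scaling by 2 of this one.
module Halved (R : RawRing 0ℓ 0ℓ) (ι : ℤ → RawRing.Carrier R) (y w : RawRing.Carrier R) where
  open RawRing R using (Carrier; _+_; _*_; -_)

  x h e A B : Carrier
  x = y + ι (+ 2) * w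
  open Family R ι x y using (Q₃)
  h = y * y + ι (+ 2) * (y * w + w * w)
  e = x * x * x * w
  A = e + (y + w) * (- (y * Q₃))
  B = (y + w) * (- (x * x * y * Q₃ * h))

  curve : Weierstrass Carrier
  curve = weierstrass A B (B * e) (ι (+ 0)) (ι (+ 0))

-- If x ≡ y mod 3, then A, B and e are divisible by 3.
module Thirded (R : RawRing 0ℓ 0ℓ) (ι : ℤ → RawRing.Carrier R) (y w : RawRing.Carrier R) where
  open RawRing R using (Carrier; _+_; _*_; -_)

  x Q₃/3 e A B : Carrier
  x = y + ι (+ 3) * w
  open Family R ι x y using (Q₂)
  Q₃/3 = y * y + ι (+ 3) * (y * w + w * w)
  e = x * x * x * w
  A = e + (- (y * (x + y) * Q₃/3))
  B = - (x * x * y * (x + y) * Q₃/3 * Q₂)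

module Familyℤ  = Family ℤ.+-*-rawRing id
module Halvedℤ  = Halved ℤ.+-*-rawRing id
module Thirdedℤ = Thirded ℤ.+-*-rawRing id

-- Polynomial identities of the family

module FamilyIdentities
  (R : RawRing 0ℓ 0ℓ) (isCommutativeRing : IsCommutativeRawRing R)
  (ι : ℤ → RawRing.Carrier R) (ι-homo : IsRingHomomorphism ℤ.+-*-rawRing R ι)
  where

  open RawRing R

  open Identities R isCommutativeRing ι ι-homo
  open IsCommutativeRing isCommutativeRing using (refl)

  private
    module I     = Invariants R ι
    module Iₚ n  = Invariants (polynomials n) con
    module F     = Family R ι
    module Fₚ n  = Family (polynomials n) con

    0′ : Carrier
    0′ = ι (+ 0)

  -- Modulo `B` the curve becomes Y² + A X Y = X³, which is nodal where `A` is a unit.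
  c₄-mod-B : ∀ A B e → I.c₄ (weierstrass A B (B * e) 0′ 0′) ≈
             A * A * A * A + B * (ι (+ 8) * A * A + ι (+ 16) * B + - (ι (+ 24) * A * e))
  c₄-mod-B = solve 3 (λ A B e → let 0′ = con (+ 0) in Iₚ.c₄ 3 (weierstrass A B (B :* e) 0′ 0′) :=
    A :* A :* A :* A :+ B :* (con (+ 8) :* A :* A :+ con (+ 16) :* B :+ :- (con (+ 24) :* A :* e)))
        refl

  c₄-mod-2 : ∀ A B e → I.c₄ (weierstrass A B (B * e) 0′ 0′) ≈
             A * A * A * A + ι (+ 2) * (B * (ι (+ 4) * A * A + ι (+ 8) * B + - (ι (+ 12) * A * e)))
  c₄-mod-2 = solve 3 (λ A B e → let 0′ = con (+ 0) in Iₚ.c₄ 3 (weierstrass A B (B :* e) 0′ 0′) :=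
    A :* A :* A :* A :+ con (+ 2) :*
        (B :* (con (+ 4) :* A :* A :+ con (+ 8) :* B :+ :- (con (+ 12) :* A :* e)))) refl

  cofactor : Carrier → Carrier → Carrier → Carrier
  cofactor A B e = A * A * A * e + ι (+ 36) * A * B * e
    + - ((A * A + ι (+ 4) * B) * (A * A + ι (+ 4) * B)) + - (ι (+ 27) * B * e * e)

  private
    cofactorₚ : ∀ {n} → Polynomial n → Polynomial n → Polynomial n → Polynomial n
    cofactorₚ A B e = A :* A :* A :* e :+ con (+ 36) :* A :* B :* e
      :+ :- ((A :* A :+ con (+ 4) :* B) :* (A :* A :+ con (+ 4) :* B))
          :+ :- (con (+ 27) :* B :* e :* e)

  -- `B * e` is kept together as one factor because at 2 it may be `e` rather than `B` that is even.
  Δ-factored : ∀ A B e → I.Δ (weierstrass A B (B * e) 0′ 0′) ≈ B * e * (B * B * e * cofactor A B e)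
  Δ-factored = solve 3 (λ A B e → let 0′ = con (+ 0) in Iₚ.Δ 3 (weierstrass A B (B :* e) 0′ 0′) :=
    B :* e :* (B :* B :* e :* cofactorₚ A B e)) refl

  -- The factor beside 9 is 16 B² modulo 3, a unit if 3 does not divide `B`; so the power of 3 in c₄
  -- is then known exactly.
  c₄-tripled : ∀ A B e → let 3* = ι (+ 3) *_ in
    I.c₄ (weierstrass (3* A) (3* B) (3* B * 3* e) 0′ 0′) ≈
    ι (+ 9) * (ι (+ 16) * B * B + ι (+ 3) * (ι (+ 3) * A * A * A * A + ι (+ 8) * A * A * B
        + - (ι (+ 24) * A * B * e)))
  c₄-tripled = solve 3 (λ A B e → let 0′ = con (+ 0) ; 3* = con (+ 3) :*_ in
    Iₚ.c₄ 3 (weierstrass (3* A) (3* B) (3* B :* 3* e) 0′ 0′) :=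
    con (+ 9) :* (con (+ 16) :* B :* B :+ con (+ 3) :*
        (con (+ 3) :* A :* A :* A :* A :+ con (+ 8) :* A :* A :* B
            :+ :- (con (+ 24) :* A :* B :* e)))) refl

  Δ-tripled : ∀ A B e → let 3* = ι (+ 3) *_ in
    I.Δ (weierstrass (3* A) (3* B) (3* B * 3* e) 0′ 0′) ≈
    ι (+ 2187) * (B * B * B * e * e * (ι (+ 9) * A * A * A * e + ι (+ 108) * A * B * e
      + - ((ι (+ 3) * A * A + ι (+ 4) * B) * (ι (+ 3) * A * A + ι (+ 4) * B))
          + - (ι (+ 81) * B * e * e)))
  Δ-tripled = solve 3 (λ A B e → let 0′ = con (+ 0) ; 3* = con (+ 3) :*_ in
    Iₚ.Δ 3 (weierstrass (3* A) (3* B) (3* B :* 3* e) 0′ 0′) :=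
    con (+ 2187) :* (B :* B :* B :* e :* e :*
        (con (+ 9) :* A :* A :* A :* e :+ con (+ 108) :* A :* B :* e
      :+ :- ((con (+ 3) :* A :* A :+ con (+ 4) :* B) :* (con (+ 3) :* A :* A :+ con (+ 4) :* B))
          :+ :- (con (+ 81) :* B :* e :* e)))) refl

  -- For Δ = 3⁷ D and c₄ = 9 c, the relation m c₄³ = k Δ becomes m c³ = 3 k D.
  cancel-3⁶ : ∀ m c k D → m * (ι (+ 9) * c * (ι (+ 9) * c) * (ι (+ 9) * c))
      + - (k * (ι (+ 2187) * D)) ≈
              ι (+ 729) * (m * (c * c * c) + - (ι (+ 3) * (k * D)))
  cancel-3⁶ = solve 4
      (λ m c k D → m :* (con (+ 9) :* c :* (con (+ 9) :* c) :* (con (+ 9) :* c))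
          :+ :- (k :* (con (+ 2187) :* D)) :=
              con (+ 729) :* (m :* (c :* c :* c) :+ :- (con (+ 3) :* (k :* D)))) refl

  -- x, y, x + y and Q₂ divide `B`. At a prime dividing one of them, coprimality makes the remaining
  -- fourth power a unit, and `A` with it; the coefficient 2 for x + y and Q₂ confines these two to
  -- odd primes.
  A-mod-x : ∀ x y → F.A x y ≈ - (y * y * y * y) +
            x * (x * x * x + - (ι (+ 2) * x * x * y) + - (ι (+ 2) * x * y * y)
                + - (ι (+ 2) * y * y * y))
  A-mod-x = solve 2 (λ x y → Fₚ.A 2 x y := :- (y :* y :* y :* y) :+
            x :* (x :* x :* x :+ :- (con (+ 2) :* x :* x :* y) :+ :- (con (+ 2) :* x :* y :* y)
                :+ :- (con (+ 2) :* y :* y :* y))) refl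

  A-mod-y : ∀ x y → F.A x y ≈ x * x * x * x +
            y * (- (ι (+ 2) * x * x * x) + - (ι (+ 2) * x * x * y) + - (ι (+ 2) * x * y * y)
                + - (y * y * y))
  A-mod-y = solve 2 (λ x y → Fₚ.A 2 x y := x :* x :* x :* x :+
            y :* (:- (con (+ 2) :* x :* x :* x) :+ :- (con (+ 2) :* x :* x :* y)
                :+ :- (con (+ 2) :* x :* y :* y) :+ :- (y :* y :* y))) refl

  A-mod-x+y : ∀ x y → F.A x y ≈ ι (+ 2) * (x * x * x * x)
      + (x + y) * (- (x * x * x) + - (y * F.Q₃ x y))
  A-mod-x+y = solve 2 (λ x y → Fₚ.A 2 x y :=
      con (+ 2) :* (x :* x :* x :* x) :+ (x :+ y) :* (:- (x :* x :* x) :+ :- (y :* Fₚ.Q₃ 2 x y)))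
          refl

  A-mod-Q₂ : ∀ x y → F.A x y ≈ ι (+ 2) * (x * x * x * x)
      + F.Q₂ x y * (- F.Q₂ x y + - (ι (+ 2) * x * y))
  A-mod-Q₂ = solve 2 (λ x y → Fₚ.A 2 x y :=
      con (+ 2) :* (x :* x :* x :* x) :+ Fₚ.Q₂ 2 x y :*
          (:- Fₚ.Q₂ 2 x y :+ :- (con (+ 2) :* x :* y))) refl

  B-div-x : ∀ x y → F.B x y ≈ x * (- (x * y * (x + y) * F.Q₃ x y * F.Q₂ x y))
  B-div-x = solve 2 (λ x y → Fₚ.B 2 x y :=
      x :* (:- (x :* y :* (x :+ y) :* Fₚ.Q₃ 2 x y :* Fₚ.Q₂ 2 x y))) refl

  B-div-y : ∀ x y → F.B x y ≈ y * (- (x * x * (x + y) * F.Q₃ x y * F.Q₂ x y))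
  B-div-y = solve 2 (λ x y →
      Fₚ.B 2 x y := y :* (:- (x :* x :* (x :+ y) :* Fₚ.Q₃ 2 x y :* Fₚ.Q₂ 2 x y))) refl

  B-div-x+y : ∀ x y → F.B x y ≈ (x + y) * (- (x * x * y * F.Q₃ x y * F.Q₂ x y))
  B-div-x+y = solve 2 (λ x y → Fₚ.B 2 x y :=
      (x :+ y) :* (:- (x :* x :* y :* Fₚ.Q₃ 2 x y :* Fₚ.Q₂ 2 x y))) refl

  B-div-Q₂ : ∀ x y → F.B x y ≈ F.Q₂ x y * (- (x * x * y * (x + y) * F.Q₃ x y))
  B-div-Q₂ = solve 2 (λ x y → Fₚ.B 2 x y :=
      Fₚ.Q₂ 2 x y :* (:- (x :* x :* y :* (x :+ y) :* Fₚ.Q₃ 2 x y))) refl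

  private
    module H     = Halved R ι
    module Hₚ n  = Halved (polynomials n) con
    module T     = Thirded R ι
    module Tₚ n  = Thirded (polynomials n) con
    module S     = Substitution R ι
    module Sₚ n  = Substitution (polynomials n) con

  halved-A : ∀ y w → F.A (H.x y w) y ≈ (ι (+ 2) S.^ 1) * H.A y w
  halved-A = solve 2 (λ y w → Fₚ.A 2 (Hₚ.x 2 y w) y := Sₚ._^_ 2 (con (+ 2)) 1 :* Hₚ.A 2 y w) refl

  halved-B : ∀ y w → F.B (H.x y w) y ≈ (ι (+ 2) S.^ 2) * H.B y w
  halved-B = solve 2 (λ y w → Fₚ.B 2 (Hₚ.x 2 y w) y := Sₚ._^_ 2 (con (+ 2)) 2 :* Hₚ.B 2 y w) refl

  halved-C : ∀ y w → F.B (H.x y w) y * F.e (H.x y w) y ≈ (ι (+ 2) S.^ 3) * (H.B y w * H.e y w)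
  halved-C = solve 2 (λ y w → Fₚ.B 2 (Hₚ.x 2 y w) y :* Fₚ.e 2 (Hₚ.x 2 y w) y :=
      Sₚ._^_ 2 (con (+ 2)) 3 :* (Hₚ.B 2 y w :* Hₚ.e 2 y w)) refl

  halved-Q₂ : ∀ y w → F.Q₂ (H.x y w) y ≈ ι (+ 2) * H.h y w
  halved-Q₂ = solve 2 (λ y w → Fₚ.Q₂ 2 (Hₚ.x 2 y w) y := con (+ 2) :* Hₚ.h 2 y w) refl

  -- At w = 0 one has x = y, so that `e` vanishes and `A` is - y² Q₃ with Q₃ = 3 y². This serves the
  -- case of even w, where y is odd.
  halved-A-mod-w : ∀ y w → H.A y w ≈ - (ι (+ 3) * (y * y * y * y)) +
    w * (H.x y w * H.x y w * H.x y w + - (ι (+ 9) * y * y * y) + - (ι (+ 10) * y * y * w)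
        + - (ι (+ 4) * y * w * w))
  halved-A-mod-w = solve 2 (λ y w → Hₚ.A 2 y w := :- (con (+ 3) :* (y :* y :* y :* y)) :+
    w :* (Hₚ.x 2 y w :* Hₚ.x 2 y w :* Hₚ.x 2 y w :+ :- (con (+ 9) :* y :* y :* y)
        :+ :- (con (+ 10) :* y :* y :* w) :+ :- (con (+ 4) :* y :* w :* w))) refl

  thirded-A : ∀ y w → F.A (T.x y w) y ≈ ι (+ 3) * T.A y w
  thirded-A = solve 2 (λ y w → Fₚ.A 2 (Tₚ.x 2 y w) y := con (+ 3) :* Tₚ.A 2 y w) refl

  thirded-B : ∀ y w → F.B (T.x y w) y ≈ ι (+ 3) * T.B y w
  thirded-B = solve 2 (λ y w → Fₚ.B 2 (Tₚ.x 2 y w) y := con (+ 3) :* Tₚ.B 2 y w) refl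

  thirded-e : ∀ y w → F.e (T.x y w) y ≈ ι (+ 3) * T.e y w
  thirded-e = solve 2 (λ y w → Fₚ.e 2 (Tₚ.x 2 y w) y := con (+ 3) :* Tₚ.e 2 y w) refl

  thirded-x+y : ∀ y w → T.x y w + y ≈ ι (+ 2) * y + ι (+ 3) * w
  thirded-x+y = solve 2 (λ y w → Tₚ.x 2 y w :+ y := con (+ 2) :* y :+ con (+ 3) :* w) refl

  thirded-Q₂ : ∀ y w → F.Q₂ (T.x y w) y ≈ ι (+ 2) * (y * y)
      + ι (+ 3) * (ι (+ 2) * y * w + ι (+ 3) * w * w)
  thirded-Q₂ = solve 2 (λ y w → Fₚ.Q₂ 2 (Tₚ.x 2 y w) y :=
    con (+ 2) :* (y :* y) :+ con (+ 3) :* (con (+ 2) :* y :* w :+ con (+ 3) :* w :* w)) refl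

module FamilyIdentitiesℤ = FamilyIdentities ℤ.+-*-rawRing ℤₚ.+-*-isCommutativeRing id
  (isRingHomomorphism ℤ.+-*-rawRing ≡.refl)

-- Tate’s algorithm and potentially good reduction

module _ where
  open ≡ using (refl; sym; trans; cong; cong₂; subst; subst₂)
  open ℤ using (∣_∣)
  open import Data.Nat.Divisibility using (_∣_; _∣?_; 0∣⇒≡0; n∣m⇒m%n≡0; ∣-trans; ∣⇒≤; m∣m*n)
  open Invariantsℤ
  open Substitutionℤ
  open Weierstrass

  -- The j-invariant c₄³ / Δ is p-integral.
  record PotentiallyGood (p : ℕ) (W : Weierstrass ℤ) : Set where
    field
      m k   : ℤ
      p∤m   : ¬ p ∣ ∣ m ∣
      m*c₄³ : c₄³∣Δ ℤ.+-*-rawRing id m k W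

  good⇒potentiallyGood : ∀ {p} W → ¬ p ∣ ∣ Δ W ∣ → PotentiallyGood p W
  good⇒potentiallyGood W p∤Δ = record
    { m = Δ W ; k = c₄ W ℤ.* c₄ W ℤ.* c₄ W ; p∤m = p∤Δ
    ; m*c₄³ = ℤₚ.*-comm (Δ W) (c₄ W ℤ.* c₄ W ℤ.* c₄ W) }

  potentiallyGood-cong : ∀ {p} W W′ → c₄ W ≡ c₄ W′ → Δ W ≡ Δ W′ → PotentiallyGood p W →
      PotentiallyGood p W′
  potentiallyGood-cong W W′ c≡ Δ≡ g = record
    { m = m ; k = k ; p∤m = p∤m
    ; m*c₄³ = subst₂ (λ c D → m ℤ.* (c ℤ.* c ℤ.* c) ≡ k ℤ.* D) c≡ Δ≡ m*c₄³ }
    where open PotentiallyGood g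

  potentiallyGood-scaled : ∀ {p} u W → PotentiallyGood p W → PotentiallyGood p (scaled u W)
  potentiallyGood-scaled u W g = record
    { m = m ; k = k ; p∤m = p∤m ; m*c₄³ = Identitiesℤ.c₄³∣Δ-scaled m k u W m*c₄³ }
    where open PotentiallyGood g

  pos-^ : ∀ n k → + (n ℕ.^ k) ≡ (+ n) ^ k
  pos-^ n zero    = refl
  pos-^ n (suc k) = trans (ℤₚ.pos-* n (n ℕ.^ k)) (cong (+ n ℤ.*_) (pos-^ n k))

  divideBy-exact : ∀ d a → d ∣ ∣ a ∣ → + d ℤ.* divideBy d a ≡ a
  divideBy-exact zero a d∣a = sym (ℤₚ.∣i∣≡0⇒i≡0 (0∣⇒≡0 d∣a))
  divideBy-exact d@(suc _) (+ n) d∣a =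
    trans (sym (ℤₚ.pos-* d (n ℕ./ d))) (cong +_ (ℕ.m*[n/m]≡n d∣a))
  -- For a negative numerator, integer division branches on whether the remainder is zero; the
  -- rewrite selects the exact branch.
  divideBy-exact d@(suc _) a@(ℤ.-[1+ n ]) d∣a rewrite n∣m⇒m%n≡0 (suc n) d d∣a = begin
    + d ℤ.* ℤ.- (+ (suc n ℕ./ d))     ≡⟨ ℤₚ.neg-distribʳ-* (+ d) (+ (suc n ℕ./ d)) ⟨
    ℤ.- (+ d ℤ.* + (suc n ℕ./ d))     ≡⟨ cong ℤ.-_ (ℤₚ.pos-* d (suc n ℕ./ d)) ⟨
    ℤ.- (+ (d ℕ.* (suc n ℕ./ d)))     ≡⟨ cong (ℤ.-_ ∘ +_) (ℕ.m*[n/m]≡n d∣a) ⟩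
    a                                 ∎
    where open ≡-Reasoning

  -- A property shared by all candidates and by the default value survives any search. Taken with
  -- "same c₄ and Δ as W", this covers every normalisation, whatever it finds.
  fromMaybe-findᵇ-map : ∀ {X A : Set} {f : X → A} {a} (Q : A → Set) (P : A → Bool) xs →
                        Q a → (∀ x → Q (f x)) → Q (fromMaybe a (findᵇ P (map f xs)))
  fromMaybe-findᵇ-map Q P [] qa qf = qa
  fromMaybe-findᵇ-map {f = f} Q P (x ∷ xs) qa qf with P (f x)
  ... | true  = qf x
  ... | false = fromMaybe-findᵇ-map Q P xs qa qf

  ∧-true : ∀ {a b} → a ∧ b ≡ true → a ≡ true × b ≡ true
  ∧-true {true} eq = refl , eq

  not-injective : ∀ {b} → not b ≡ false → b ≡ true
  not-injective {true} _ = refl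

  -- Takes the cascade in `tate` one condition at a time while the equation for the Kodaira symbol
  -- is passed on; an exit with a different symbol is then closed by an absurd pattern.
  if-elim : ∀ {K} {P : Set} b {x y : Kodaira × ℕ} →
            (b ≡ true → proj₁ x ≡ K → P) → (b ≡ false → proj₁ y ≡ K → P) →
            proj₁ (if b then x else y) ≡ K → P
  if-elim true  t e = t refl
  if-elim false t e = e refl

  module _ {p : ℕ} (1<p : 1 ℕ.< p) where
    open Tate p

    ∣ᵖ-true : ∀ k a → (k ∣ᵖ a) ≡ true → p ℕ.^ k ∣ ∣ a ∣
    ∣ᵖ-true k a eq with p ℕ.^ k ∣? ∣ a ∣
    ... | yes d = d

    ∣ᵖ-false : ∀ k a → not (k ∣ᵖ a) ≡ true → ¬ p ℕ.^ k ∣ ∣ a ∣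
    ∣ᵖ-false k a eq with p ℕ.^ k ∣? ∣ a ∣
    ... | no ∤ = ∤

    SameInvariants : Weierstrass ℤ → Weierstrass ℤ → Set
    SameInvariants W W′ = c₄ W′ ≡ c₄ W × Δ W′ ≡ Δ W

    same-trans : ∀ W₁ W₂ W₃ → SameInvariants W₁ W₂ → SameInvariants W₂ W₃ → SameInvariants W₁ W₃
    same-trans W₁ W₂ W₃ (c , d) (c′ , d′) = trans c′ c , trans d′ d

    normalise-invariants : ∀ rs ss ts P W → SameInvariants W (normalise rs ss ts P W)
    normalise-invariants rs ss ts P W = fromMaybe-findᵇ-map {f = λ (r , s , t) →
        translate r s t W} (SameInvariants W) P (cartesianProduct rs (cartesianProduct ss ts))
            (refl , refl)
      λ (r , s , t) → Identitiesℤ.c₄-translated r s t W , Identitiesℤ.Δ-translated r s t W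

    divisible⇒scaled-rescale : ∀ W → divisible 1 2 3 4 6 W ≡ true → scaled (+ p) (rescale p W) ≡ W
    divisible⇒scaled-rescale W@(weierstrass a₁ a₂ a₃ a₄ a₆) eq =
      let d₁ , eq = ∧-true eq ; d₂ , eq = ∧-true eq ; d₃ , eq = ∧-true eq ; d₄ , d₆ = ∧-true eq in
      weierstrass-cong (exact 1 a₁ d₁) (exact 2 a₂ d₂) (exact 3 a₃ d₃) (exact 4 a₄ d₄)
          (exact 6 a₆ d₆)
      where
      exact : ∀ k a → (k ∣ᵖ a) ≡ true → (+ p) ^ k ℤ.* divideBy (p ℕ.^ k) a ≡ a
      exact k a d = trans (cong (ℤ._* divideBy (p ℕ.^ k) a) (sym (pos-^ p k)))
          (divideBy-exact (p ℕ.^ k) a (∣ᵖ-true k a d))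

    ∣Δ-scaled∣ : ∀ W → ∣ Δ (scaled (+ p) W) ∣ ≡ p ℕ.^ 12 ℕ.* ∣ Δ W ∣
    ∣Δ-scaled∣ W = begin
      ∣ Δ (scaled (+ p) W) ∣           ≡⟨ cong ∣_∣ (Identitiesℤ.Δ-scaled (+ p) W) ⟩
      ∣ (+ p) ^ 12 ℤ.* Δ W ∣           ≡⟨ cong (λ u → ∣ u ℤ.* Δ W ∣) (pos-^ p 12) ⟨
      ∣ + (p ℕ.^ 12) ℤ.* Δ W ∣         ≡⟨ ℤₚ.abs-* (+ (p ℕ.^ 12)) (Δ W) ⟩
      p ℕ.^ 12 ℕ.* ∣ Δ W ∣             ∎
      where open ≡-Reasoning

    0<∣Δ∣ : ∀ W → Δ W ≢ +0 → 0 ℕ.< ∣ Δ W ∣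
    0<∣Δ∣ W Δ≢0 = ℕₚ.n≢0⇒n>0 (Δ≢0 ∘ ℤₚ.∣i∣≡0⇒i≡0)

    0<vΔ : ∀ W → Δ W ≢ +0 → p ∣ ∣ Δ W ∣ → 0 ℕ.< vΔ W
    0<vΔ W Δ≢0 = ∣⇒0<valuation 1<p (0<∣Δ∣ W Δ≢0)

    rescaled-potentiallyGood : ∀ fuel W W₅ →
      (∀ W′ → Δ W′ ≢ +0 → vΔ W′ ℕ.≤ fuel → proj₁ (tate fuel W′) ≡ I 0 → PotentiallyGood p W′) →
      SameInvariants W W₅ → Δ W ≢ +0 → vΔ W ℕ.≤ suc fuel → divisible 1 2 3 4 6 W₅ ≡ true →
      proj₁ (tate fuel (rescale p W₅)) ≡ I 0 → PotentiallyGood p W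
    rescaled-potentiallyGood fuel W W₅ ind (c₄W₅≡ , ΔW₅≡) Δ≢0 vΔ≤ div eq =
      potentiallyGood-cong (scaled (+ p) W′) W c₄≡ Δ≡
        (potentiallyGood-scaled (+ p) W′ (ind W′ ΔW′≢0 vΔW′≤fuel eq))
      where
      W′ : Weierstrass ℤ
      W′ = rescale p W₅
      W≡ : scaled (+ p) W′ ≡ W₅
      W≡ = divisible⇒scaled-rescale W₅ div
      c₄≡ : c₄ (scaled (+ p) W′) ≡ c₄ W
      c₄≡ = trans (cong c₄ W≡) c₄W₅≡
      Δ≡ : Δ (scaled (+ p) W′) ≡ Δ W
      Δ≡ = trans (cong Δ W≡) ΔW₅≡
      ∣Δ∣≡ : p ℕ.^ 12 ℕ.* ∣ Δ W′ ∣ ≡ ∣ Δ W ∣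
      ∣Δ∣≡ = trans (sym (∣Δ-scaled∣ W′)) (cong ∣_∣ Δ≡)
      ΔW′≢0 : Δ W′ ≢ +0
      ΔW′≢0 ΔW′≡0 = Δ≢0 (ℤₚ.∣i∣≡0⇒i≡0 (trans (sym ∣Δ∣≡)
        (trans (cong (λ D → p ℕ.^ 12 ℕ.* ∣ D ∣) ΔW′≡0) (ℕₚ.*-zeroʳ (p ℕ.^ 12)))))
      vΔW′≤fuel : vΔ W′ ℕ.≤ fuel
      vΔW′≤fuel = ℕₚ.≤-pred (begin
        suc (vΔ W′)                             ≤⟨ s≤s (ℕₚ.m≤n+m (vΔ W′) 11) ⟩
        12 ℕ.+ vΔ W′                            ≤⟨ valuation-^* 1<p 12 (0<∣Δ∣ W′ ΔW′≢0) ⟩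
        valuation p (p ℕ.^ 12 ℕ.* ∣ Δ W′ ∣)     ≡⟨ cong (valuation p) ∣Δ∣≡ ⟩
        vΔ W                                    ≤⟨ vΔ≤ ⟩
        suc fuel                                ∎)
        where open ℕₚ.≤-Reasoning

    -- The multiplicative exit returns `I (vΔ W₁)`, so its constructor alone does not exclude `I 0`;
    -- the divisibility of Δ by p does.
    vΔ≢0 : ∀ W W₁ → SameInvariants W W₁ → Δ W ≢ +0 → p ∣ ∣ Δ W ∣ → I (vΔ W₁) ≢ I 0
    vΔ≢0 W W₁ (_ , ΔW₁≡) Δ≢0 p∣Δ I≡I₀ = ℕₚ.<⇒≢ (0<vΔ W Δ≢0 p∣Δ)
      (sym (trans (cong (λ D → valuation p ∣ D ∣) (sym ΔW₁≡)) (I-injective I≡I₀)))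
      where
      I-injective : ∀ {m n} → I m ≡ I n → m ≡ n
      I-injective refl = refl

    -- Good reduction is announced in two places: where p does not divide Δ, and where the fuel is
    -- exhausted. The bound on `vΔ` reduces the second to the first. The other exits carry other
    -- symbols, and the rescaling recurses on a model with the same j.
    tate-I₀ : ∀ fuel W → Δ W ≢ +0 → vΔ W ℕ.≤ fuel → proj₁ (tate fuel W) ≡ I 0 → PotentiallyGood p W
    tate-I₀ zero W Δ≢0 vΔ≤fuel eq =
      good⇒potentiallyGood W (λ p∣Δ → contradiction (0<vΔ W Δ≢0 p∣Δ) (ℕₚ.≤⇒≯ vΔ≤fuel))
    tate-I₀ (suc fuel) W Δ≢0 vΔ≤fuel =
      let W₁ = normalise (residues 0) none (residues 0) (divisible 0 0 1 1 1) W
          W₂ = normalise none (residues 0) (residues 1) (divisible 1 1 2 2 3) W₁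
          W₄ = normalise (residues 1) none none (divisible 1 2 2 3 4) W₂
          W₅ = normalise none none (residues 2) (divisible 1 2 3 3 5) W₄
          same₁ = normalise-invariants (residues 0) none (residues 0) (divisible 0 0 1 1 1) W
          same₂ = same-trans W W₁ W₂ same₁
            (normalise-invariants none (residues 0) (residues 1) (divisible 1 1 2 2 3) W₁)
          same₄ = same-trans W W₂ W₄ same₂
            (normalise-invariants (residues 1) none none (divisible 1 2 2 3 4) W₂)
          same₅ = same-trans W W₄ W₅ same₄
            (normalise-invariants none none (residues 2) (divisible 1 2 3 3 5) W₄)
      in
      if-elim (not (1 ∣ᵖ Δ W))
        (λ b _ → good⇒potentiallyGood W (subst
            (λ n → ¬ n ∣ ∣ Δ W ∣) (ℕₚ.*-identityʳ p) (∣ᵖ-false 1 (Δ W) b))) (λ b₁ →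
      if-elim (not (1 ∣ᵖ b₂ W₁)) (λ _ I≡I₀ → contradiction I≡I₀ (vΔ≢0 W W₁ same₁ Δ≢0
        (subst (_∣ ∣ Δ W ∣) (ℕₚ.*-identityʳ p) (∣ᵖ-true 1 (Δ W) (not-injective b₁))))) (λ _ →
      if-elim (not (2 ∣ᵖ a₆ W₁)) (λ _ ()) (λ _ →
      if-elim (not (3 ∣ᵖ b₈ W₁)) (λ _ ()) (λ _ →
      if-elim (not (3 ∣ᵖ b₆ W₁)) (λ _ ()) (λ _ →
      if-elim (not (7 ∣ᵖ cubicDiscriminant W₂)) (λ _ ()) (λ _ →
      if-elim (not (3 ∣ᵖ a₂ W₂ ℤ.* a₂ W₂ ℤ.- + 3 ℤ.* a₄ W₂)) (λ _ ()) (λ _ →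
      if-elim (not (5 ∣ᵖ b₆ W₄)) (λ _ ()) (λ _ →
      if-elim (not (4 ∣ᵖ a₄ W₅)) (λ _ ()) (λ _ →
      if-elim (not (divisible 1 2 3 4 6 W₅)) (λ _ ()) (λ b →
      rescaled-potentiallyGood fuel W W₅ (tate-I₀ fuel) same₅ Δ≢0 vΔ≤fuel
          (not-injective b)))))))))))

  conductorExponent-0 : ∀ {p} → 1 ℕ.< p → ∀ W → Δ W ≢ +0 → conductorExponent p W ≡ 0 →
      PotentiallyGood p W
  conductorExponent-0 {p} 1<p W Δ≢0 eq = tate-I₀ 1<p (Tate.vΔ p W) W Δ≢0 ℕₚ.≤-refl (I₀ eq)
    where
    I₀ : conductorExponent p W ≡ 0 → proj₁ (Tate.tate p (Tate.vΔ p W) W) ≡ I 0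
    I₀ eq with Tate.tate p (Tate.vΔ p W) W
    I₀ eq | I zero , _  = refl
    I₀ () | I (suc _) , _
    I₀ () | I* _ , _
    I₀ () | II , _
    I₀ () | III , _
    I₀ () | IV , _
    I₀ () | IV* , _
    I₀ () | III* , _
    I₀ () | II* , _

  prime⇒1< : ∀ {p} → Prime p → 1 ℕ.< p
  prime⇒1< {p} pp = ℕ.nonTrivial⇒n>1 p {{prime⇒nonTrivial pp}}

  bad⇒∣p^conductorExponent : ∀ {p} → Prime p → ∀ W → Δ W ≢ +0 → ¬ PotentiallyGood p W →
      p ∣ p ℕ.^ conductorExponent p W
  bad⇒∣p^conductorExponent {p} pp W Δ≢0 bad =
      ∣-^ (conductorExponent p W) (bad ∘ conductorExponent-0 (prime⇒1< pp) W Δ≢0)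
    where
    ∣-^ : ∀ e → e ≢ 0 → p ∣ p ℕ.^ e
    ∣-^ zero    e≢0 = contradiction refl e≢0
    ∣-^ (suc e) _   = m∣m*n (p ℕ.^ e)

  bad⇒∣Δ : ∀ {p} W → ¬ PotentiallyGood p W → p ∣ ∣ Δ W ∣
  bad⇒∣Δ {p} W bad = decidable-stable (p ∣? ∣ Δ W ∣) (bad ∘ good⇒potentiallyGood W)

  -- The conductor multiplies over the primes up to the absolute value of Δ; a prime dividing the
  -- nonzero Δ lies in that range.
  ∣product-primes : ∀ {p} → Prime p → (f : ℕ → ℕ) → p ∣ f p → ∀ n → n ≢ 0 → p ∣ n →
                    p ∣ product (map f (filter prime? (upTo (suc n))))
  ∣product-primes pp f p∣fp n n≢0 p∣n = ∣-trans p∣fp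
    (∈⇒∣product (∈-map⁺ f (∈-filter⁺ prime? (∈-upTo⁺ (s≤s (∣⇒≤ {{ℕ.≢-nonZero n≢0}} p∣n))) pp)))

  bad⇒∣conductor : ∀ E {p} → Prime p → Δ (integralModel (EllipticCurve.equation E)) ≢ +0 →
                   ¬ PotentiallyGood p (integralModel (EllipticCurve.equation E)) → p ∣ conductor E
  bad⇒∣conductor E {p} pp Δ≢0 bad = ∣product-primes pp f (bad⇒∣p^conductorExponent pp W Δ≢0 bad)
      ∣ Δ W ∣ (Δ≢0 ∘ ℤₚ.∣i∣≡0⇒i≡0) (bad⇒∣Δ W bad)
    where
    W : Weierstrass ℤ
    W = integralModel (EllipticCurve.equation E)
    f : ℕ → ℕ
    f p = p ℕ.^ conductorExponent p W

-- Integral models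

module _ where
  open ≡ using (refl; sym; trans; cong; cong₂; subst; subst₂)
  open ℚ using (↥_; ↧ₙ_)
  open import Data.Nat.Divisibility using (_∣_; divides; ∣-trans; m∣m*n; n∣m*n)

  ι-↧* : ∀ a → ι (+ ↧ₙ a) ℚ.* a ≡ ι (↥ a)
  ι-↧* a@(mkℚ n d-1 _) = begin
    ι (+ ↧ₙ a) ℚ.* a            ≡⟨ cong (ℚ._* a) (ι≡fromℤ (+ ↧ₙ a)) ⟩
    fromℤ (+ ↧ₙ a) ℚ.* a
        ≡⟨ ℚₚ.toℚᵘ-injective (ℚᵘₚ.≃-trans (ℚₚ.toℚᵘ-homo-* (fromℤ (+ ↧ₙ a)) a) (ℚᵘ.*≡* cross)) ⟩
    fromℤ n                     ≡⟨ ι≡fromℤ n ⟨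
    ι n                         ∎
    where
    open ≡-Reasoning
    cross : + suc d-1 ℤ.* n ℤ.* + 1 ≡ n ℤ.* (+ suc (d-1 ℕ.+ 0))
    cross = trans (ℤₚ.*-identityʳ (+ suc d-1 ℤ.* n)) (trans (ℤₚ.*-comm (+ suc d-1) n)
      (cong (λ k → n ℤ.* + suc k) (sym (ℕₚ.+-identityʳ d-1))))

  -- `clear` in `integralModel` takes a numerator without testing for integrality. Nothing is lost,
  -- since `↧ₙ a` times `a` is already the integer `↥ a`.
  ι-multiple* : ∀ {n} a → ↧ₙ a ∣ n → ι (↥ (ι (+ n) ℚ.* a)) ≡ ι (+ n) ℚ.* a
  ι-multiple* {n} a (divides k refl) = trans (cong (ι ∘ ↥_) eq)
      (trans (cong ι (↥-ι (+ k ℤ.* ↥ a))) (sym eq))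
    where
    open ≡-Reasoning
    eq : ι (+ (k ℕ.* ↧ₙ a)) ℚ.* a ≡ ι (+ k ℤ.* ↥ a)
    eq = begin
      ι (+ (k ℕ.* ↧ₙ a)) ℚ.* a          ≡⟨ cong (λ i → ι i ℚ.* a) (ℤₚ.pos-* k (↧ₙ a)) ⟩
      ι (+ k ℤ.* + ↧ₙ a) ℚ.* a          ≡⟨ cong (ℚ._* a) (ι-homo-* (+ k) (+ ↧ₙ a)) ⟩
      ι (+ k) ℚ.* ι (+ ↧ₙ a) ℚ.* a      ≡⟨ ℚₚ.*-assoc (ι (+ k)) (ι (+ ↧ₙ a)) a ⟩
      ι (+ k) ℚ.* (ι (+ ↧ₙ a) ℚ.* a)    ≡⟨ cong (ι (+ k) ℚ.*_) (ι-↧* a) ⟩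
      ι (+ k) ℚ.* ι (↥ a)               ≡⟨ ι-homo-* (+ k) (↥ a) ⟨
      ι (+ k ℤ.* ↥ a)                   ∎

  ι-^ : ∀ n k → ι (+ (n ℕ.^ k)) ≡ ι (+ n) Substitutionℚ.^ k
  ι-^ n zero    = refl
  ι-^ n (suc k) = trans (cong ι (ℤₚ.pos-* n (n ℕ.^ k)))
    (trans (ι-homo-* (+ n) (+ (n ℕ.^ k))) (cong (ι (+ n) ℚ.*_) (ι-^ n k)))

  integralModel-scaled : ∀ W → ∃ λ u → u ≢ 0ℚ × mapWeierstrass ι (integralModel W) ≡
      Substitutionℚ.scaled u W
  integralModel-scaled (weierstrass a₁ a₂ a₃ a₄ a₆) = ι (+ d) , ιd≢0 ,
    -- The first argument is the weight minus one: the power `d ^ suc i` is then visibly a multiple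
    -- of `d`.
    weierstrass-cong (clear 0 a₁ d₁) (clear 1 a₂ d₂) (clear 2 a₃ d₃) (clear 3 a₄ d₄) (clear 5 a₆ d₆)
    where
    d₁₂ d₁₃ d₁₄ d : ℕ
    d₁₂ = ↧ₙ a₁ ℕ.* ↧ₙ a₂
    d₁₃ = d₁₂ ℕ.* ↧ₙ a₃
    d₁₄ = d₁₃ ℕ.* ↧ₙ a₄
    d = d₁₄ ℕ.* ↧ₙ a₆
    d₆ : ↧ₙ a₆ ∣ d
    d₆ = n∣m*n d₁₄
    d₁₄∣d : d₁₄ ∣ d
    d₁₄∣d = m∣m*n (↧ₙ a₆)
    d₁₃∣d : d₁₃ ∣ d
    d₁₃∣d = ∣-trans (m∣m*n (↧ₙ a₄)) d₁₄∣d
    d₁₂∣d : d₁₂ ∣ d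
    d₁₂∣d = ∣-trans (m∣m*n (↧ₙ a₃)) d₁₃∣d
    d₄ : ↧ₙ a₄ ∣ d
    d₄ = ∣-trans (n∣m*n d₁₃) d₁₄∣d
    d₃ : ↧ₙ a₃ ∣ d
    d₃ = ∣-trans (n∣m*n d₁₂) d₁₃∣d
    d₂ : ↧ₙ a₂ ∣ d
    d₂ = ∣-trans (n∣m*n (↧ₙ a₁)) d₁₂∣d
    d₁ : ↧ₙ a₁ ∣ d
    d₁ = ∣-trans (m∣m*n (↧ₙ a₂)) d₁₂∣d
    clear : ∀ i a → ↧ₙ a ∣ d → ι (↥ (ι (+ (d ℕ.^ suc i)) ℚ.* a)) ≡ ι (+ d) Substitutionℚ.^ suc i
        ℚ.* a
    clear i a ∣d = trans (ι-multiple* a (∣-trans ∣d (m∣m*n (d ℕ.^ i))))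
        (cong (ℚ._* a) (ι-^ d (suc i)))
    ιd≢0 : ι (+ d) ≢ 0ℚ
    ιd≢0 eq = ℕ.≢-nonZero⁻¹ d {{nz}} (ℤₚ.+-injective (ι-injective {+ d} {+ 0} eq))
      where
      nz : ℕ.NonZero d
      nz = ℕₚ.m*n≢0 d₁₄ (↧ₙ a₆)
          {{ℕₚ.m*n≢0 d₁₃ (↧ₙ a₄) {{ℕₚ.m*n≢0 d₁₂ (↧ₙ a₃) {{ℕₚ.m*n≢0 (↧ₙ a₁) (↧ₙ a₂)}}}}}}

-- Points of order 12

module PlaneCubic (R : RawRing 0ℓ 0ℓ) (W : Weierstrass (RawRing.Carrier R)) where
  open RawRing R
  open Weierstrass W

  private
    infixl 6 _-_
    _-_ : Carrier → Carrier → Carrier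
    a - b = a + (- b)

  F : Carrier → Carrier → Carrier
  F x y = (y * y + a₁ * x * y + a₃ * y) - (x * x * x + a₂ * x * x + a₄ * x + a₆)

  -- F x (y₁ + m (x - x₁)) = F x₁ y₁ + (x - x₁) (α m x₁ y₁ x₂ + (x - x₂) (x₃ - x))
  -- for x₃ = m² + a₁ m - a₂ - x₁ - x₂.
  α : (m x₁ y₁ x₂ : Carrier) → Carrier
  α m x₁ y₁ x₂ = m * (y₁ + y₁) + m * m * (x₂ - x₁) + a₁ * (y₁ + m * x₂) + a₃ * m
               - (x₂ * x₂ + x₂ * x₁ + x₁ * x₁) - a₂ * (x₂ + x₁) - a₄

module PlaneCubicℚ = PlaneCubic ℚ.+-*-rawRing

module _ where
  open ≡ using (refl; sym; trans; cong; cong₂; subst; subst₂)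
  open ℚ using (_+_; _*_; -_; _-_; 1/_; _÷_; ↥_; ↧ₙ_)
  open ℤ using (∣_∣)
  open import Data.Nat.Divisibility using (_∣_)
  open GroupProperties ℚₚ.+-0-group
    using () renaming (x∙y⁻¹≈ε⇒x≈y to p-q≡0⇒p≡q; x≈y⇒x∙y⁻¹≈ε to p≡q⇒p-q≡0)
  open Identitiesℚ using (solve; _:+_; _:*_; _:-_; :-_; _:=_; con; polynomials)
  open Substitutionℚ using (translated; scaled; _^_)

  ÷-* : ∀ p q .{{_ : ℚ.NonZero q}} → (p ÷ q) * q ≡ p
  ÷-* p q = trans (ℚₚ.*-assoc p (1/ q) q) (trans (cong (p *_) (ℚₚ.*-inverseˡ q)) (ℚₚ.*-identityʳ p))

  *-cancelʳ : ∀ p q r → r ≢ 0ℚ → p * r ≡ q * r → p ≡ q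
  *-cancelʳ p q r r≢0 eq = begin
    p                 ≡⟨ ℚₚ.*-identityʳ p ⟨
    p * 1ℚ            ≡⟨ cong (p *_) (ℚₚ.*-inverseʳ r) ⟨
    p * (r * 1/ r)    ≡⟨ ℚₚ.*-assoc p r (1/ r) ⟨
    p * r * 1/ r      ≡⟨ cong (_* 1/ r) eq ⟩
    q * r * 1/ r      ≡⟨ ℚₚ.*-assoc q r (1/ r) ⟩
    q * (r * 1/ r)    ≡⟨ cong (q *_) (ℚₚ.*-inverseʳ r) ⟩
    q * 1ℚ            ≡⟨ ℚₚ.*-identityʳ q ⟩
    q                 ∎
    where
    open ≡-Reasoning
    instance _ = ≢-nonZero r≢0

  *-cancelˡ : ∀ p q r → r ≢ 0ℚ → r * p ≡ r * q → p ≡ q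
  *-cancelˡ p q r r≢0 eq = *-cancelʳ p q r r≢0 (trans (ℚₚ.*-comm p r) (trans eq (ℚₚ.*-comm r q)))

  module _ (W : Weierstrass ℚ) where
    open Weierstrass W
    open GroupLaw W

    open PlaneCubicℚ W

    -- What the chord and tangent cases of `⊕` have in common. For x₁ = x₂ the field `slope` says
    -- nothing about `m`; there `α≡0` expresses tangency.
    record Secant (x₁ y₁ x₂ y₂ x₃ y₃ : ℚ) : Set where
      field
        m     : ℚ
        slope : m * (x₂ - x₁) ≡ y₂ - y₁
        α≡0   : α m x₁ y₁ x₂ ≡ 0ℚ
        x₃≡   : x₃ ≡ m * m + a₁ * m - a₂ - x₁ - x₂
        y₃≡   : y₃ ≡ - (m * (x₃ - x₁) + y₁) - a₁ * x₃ - a₃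

    onCurve⇒F≡0 : ∀ x y → OnCurve x y → F x y ≡ 0ℚ
    onCurve⇒F≡0 x y = p≡q⇒p-q≡0

    chord-α : ∀ m x₁ y₁ x₂ y₂ → OnCurve x₁ y₁ → OnCurve x₂ y₂ → x₂ - x₁ ≢ 0ℚ →
              m * (x₂ - x₁) ≡ y₂ - y₁ → α m x₁ y₁ x₂ ≡ 0ℚ
    chord-α m x₁ y₁ x₂ y₂ on₁ on₂ ≢0 slope = *-cancelʳ _ 0ℚ (x₂ - x₁) ≢0 (begin
      α m x₁ y₁ x₂ * (x₂ - x₁)
        ≡⟨ solve 9 (λ a₁ a₂ a₃ a₄ a₆ m x₁ y₁ x₂ →
             let module C = PlaneCubic (polynomials 9) (weierstrass a₁ a₂ a₃ a₄ a₆) in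
             C.α m x₁ y₁ x₂ :* (x₂ :- x₁) := C.F x₂ (y₁ :+ m :* (x₂ :- x₁)) :- C.F x₁ y₁)
           refl a₁ a₂ a₃ a₄ a₆ m x₁ y₁ x₂ ⟩
      F x₂ (y₁ + m * (x₂ - x₁)) - F x₁ y₁      ≡⟨ cong (λ u → F x₂ (y₁ + u) - F x₁ y₁) slope ⟩
      F x₂ (y₁ + (y₂ - y₁)) - F x₁ y₁
        ≡⟨ cong (λ u → F x₂ u - F x₁ y₁) (solve 2 (λ y₁ y₂ → y₁ :+ (y₂ :- y₁) := y₂) refl y₁ y₂) ⟩
      F x₂ y₂ - F x₁ y₁
          ≡⟨ cong₂ _-_ (onCurve⇒F≡0 x₂ y₂ on₂) (onCurve⇒F≡0 x₁ y₁ on₁) ⟩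
      0ℚ                                       ≡⟨ ℚₚ.*-zeroˡ (x₂ - x₁) ⟨
      0ℚ * (x₂ - x₁)                           ∎)
      where open ≡-Reasoning

    same-y : ∀ x y₁ y₂ → OnCurve x y₁ → OnCurve x y₂ → y₁ + y₂ + a₁ * x + a₃ ≢ 0ℚ → y₁ ≡ y₂
    same-y x y₁ y₂ on₁ on₂ ≢0 = p-q≡0⇒p≡q y₁ y₂ (*-cancelʳ _ 0ℚ _ ≢0 (begin
      (y₁ - y₂) * (y₁ + y₂ + a₁ * x + a₃)
        ≡⟨ solve 8 (λ a₁ a₂ a₃ a₄ a₆ x y₁ y₂ →
             let module C = PlaneCubic (polynomials 8) (weierstrass a₁ a₂ a₃ a₄ a₆) in
             (y₁ :- y₂) :* (y₁ :+ y₂ :+ a₁ :* x :+ a₃) := C.F x y₁ :- C.F x y₂)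
           refl a₁ a₂ a₃ a₄ a₆ x y₁ y₂ ⟩
      F x y₁ - F x y₂
          ≡⟨ cong₂ _-_ (onCurve⇒F≡0 x y₁ on₁) (onCurve⇒F≡0 x y₂ on₂) ⟩
      0ℚ                                       ≡⟨ ℚₚ.*-zeroˡ (y₁ + y₂ + a₁ * x + a₃) ⟨
      0ℚ * (y₁ + y₂ + a₁ * x + a₃)             ∎))
      where open ≡-Reasoning

    tangent-α : ∀ m x y →
                m * (y + y + a₁ * x + a₃) ≡ ι (+ 3) * x * x + ι (+ 2) * a₂ * x + a₄ - a₁ * y →
                α m x y x ≡ 0ℚ
    tangent-α m x y slope = trans
      (solve 8 (λ a₁ a₂ a₃ a₄ a₆ m x y →
          PlaneCubic.α (polynomials 8) (weierstrass a₁ a₂ a₃ a₄ a₆) m x y x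
          := m :* (y :+ y :+ a₁ :* x :+ a₃) :-
             (con (+ 3) :* x :* x :+ con (+ 2) :* a₂ :* x :+ a₄ :- a₁ :* y))
        refl a₁ a₂ a₃ a₄ a₆ m x y)
      (p≡q⇒p-q≡0 slope)

    ⊕-secant : ∀ {x₁ y₁ x₂ y₂ x₃ y₃} .{on₁ : OnCurve x₁ y₁} .{on₂ : OnCurve x₂ y₂}
        .{on₃ : OnCurve x₃ y₃} →
               affine x₁ y₁ on₁ ⊕ affine x₂ y₂ on₂ ≡ affine x₃ y₃ on₃ → Secant x₁ y₁ x₂ y₂ x₃ y₃
    ⊕-secant {x₁} {y₁} {x₂} {y₂} {on₁ = on₁} {on₂} eq with x₁ ℚₚ.≟ x₂
    ⊕-secant {x₁} {y₁} {x₂} {y₂} {on₁ = on₁} {on₂} refl | no x₁≢x₂ = record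
      { m = (y₂ - y₁) ÷ (x₂ - x₁)
      ; slope = ÷-* (y₂ - y₁) (x₂ - x₁)
      -- The points carry irrelevant proofs of lying on the curve; decidable equality on ℚ recovers
      -- usable ones.
      ; α≡0 = chord-α ((y₂ - y₁) ÷ (x₂ - x₁)) x₁ y₁ x₂ y₂ (recompute (_ ℚₚ.≟ _) on₁)
          (recompute (_ ℚₚ.≟ _) on₂)
                x₂-x₁≢0 (÷-* (y₂ - y₁) (x₂ - x₁))
      ; x₃≡ = refl
      ; y₃≡ = refl
      }
      where
      x₂-x₁≢0 : x₂ - x₁ ≢ 0ℚ
      x₂-x₁≢0 = x₁≢x₂ ∘ sym ∘ p-q≡0⇒p≡q x₂ x₁
      instance _ = ≢-nonZero x₂-x₁≢0
    ⊕-secant {x₁} {y₁} {x₂} {y₂} {on₁ = on₁} {on₂} eq | yes refl with y₁ + y₂ + a₁ * x₁ + a₃ ℚₚ.≟ 0ℚ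
    ⊕-secant {x₁} {y₁} {x₂} {y₂} {on₁ = on₁} {on₂} () | yes refl | yes _
    ⊕-secant {x₁} {y₁} {x₂} {y₂} {on₁ = on₁} {on₂} refl | yes refl | no ≢0 = record
      { m = m
      ; slope = begin
          m * (x₁ - x₁)    ≡⟨ cong (m *_) (ℚₚ.+-inverseʳ x₁) ⟩
          m * 0ℚ           ≡⟨ ℚₚ.*-zeroʳ m ⟩
          0ℚ               ≡⟨ p≡q⇒p-q≡0 (sym y₁≡y₂) ⟨
          y₂ - y₁          ∎
      ; α≡0 = tangent-α m x₁ y₁ (subst (λ y → m * (y₁ + y + a₁ * x₁ + a₃) ≡ numerator) (sym y₁≡y₂)
                (÷-* numerator (y₁ + y₂ + a₁ * x₁ + a₃)))
      ; x₃≡ = refl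
      ; y₃≡ = refl
      }
      where
      open ≡-Reasoning
      instance _ = ≢-nonZero ≢0
      numerator m : ℚ
      numerator = ι (+ 3) * x₁ * x₁ + ι (+ 2) * a₂ * x₁ + a₄ - a₁ * y₁
      m = numerator ÷ (y₁ + y₂ + a₁ * x₁ + a₃)
      y₁≡y₂ : y₁ ≡ y₂
      y₁≡y₂ = same-y x₁ y₁ y₂ (recompute (_ ℚₚ.≟ _) on₁) (recompute (_ ℚₚ.≟ _) on₂) ≢0

    ⊕-∞ : ∀ {x₁ y₁ x₂ y₂} .{on₁ : OnCurve x₁ y₁} .{on₂ : OnCurve x₂ y₂} →
          affine x₁ y₁ on₁ ⊕ affine x₂ y₂ on₂ ≡ ∞ → x₁ ≡ x₂
    ⊕-∞ {x₁} {y₁} {x₂} {y₂} eq with x₁ ℚₚ.≟ x₂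
    ⊕-∞ () | no _
    ⊕-∞ eq | yes x₁≡x₂ = x₁≡x₂

    2-torsion : ∀ {x y} .{on : OnCurve x y} → y + y + a₁ * x + a₃ ≡ 0ℚ →
        affine x y on ⊕ affine x y on ≡ ∞
    2-torsion {x} {y} eq with x ℚₚ.≟ x
    ... | no x≢x = contradiction refl x≢x
    ... | yes refl with y + y + a₁ * x + a₃ ℚₚ.≟ 0ℚ
    ...   | yes _ = refl
    ...   | no ≢0 = contradiction eq ≢0

  -- The line Y = n X through the point (0 , 0) of the curve
  -- Y² + A X Y + C Y = X³ + B X² meets the curve again at (X , Y) and at the
  -- negative of (X′ , Y′).
  record OriginLine (A B C X Y X′ Y′ : ℚ) : Set where
    field
      n       : ℚ
      Y≡      : Y ≡ n * X
      X+X′≡   : X + X′ ≡ n * n + A * n - B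
      X*X′≡   : X * X′ ≡ - (C * n)
      Y′≡     : n * X′ ≡ - Y′ - A * X′ - C

  module _ (W : Weierstrass ℚ) (x₀ y₀ s : ℚ) (tangent : PlaneCubicℚ.α W s x₀ y₀ x₀ ≡ 0ℚ) where
    open Weierstrass W
    open PlaneCubicℚ W
    private
      module W₀ = Weierstrass (translated x₀ s y₀ W)

    -- The translation moves (x₀ , y₀) to the origin and shears by the tangent slope `s`; the linear
    -- coefficient in X is then the negative of the tangency defect.
    W₀-a₄ : W₀.a₄ ≡ 0ℚ
    W₀-a₄ = begin
      W₀.a₄               ≡⟨ solve 8 (λ a₁ a₂ a₃ a₄ a₆ x₀ y₀ s →
                               let W = weierstrass a₁ a₂ a₃ a₄ a₆ in
                               Weierstrass.a₄ (Substitution.translated (polynomials 8)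
                                   con x₀ s y₀ W)
                               := :- PlaneCubic.α (polynomials 8) W s x₀ y₀ x₀)
                             refl a₁ a₂ a₃ a₄ a₆ x₀ y₀ s ⟩
      - α s x₀ y₀ x₀      ≡⟨ cong -_ tangent ⟩
      0ℚ                  ∎
      where open ≡-Reasoning

    W₀-a₆ : GroupLaw.OnCurve W x₀ y₀ → W₀.a₆ ≡ 0ℚ
    W₀-a₆ on = begin
      W₀.a₆               ≡⟨ solve 8 (λ a₁ a₂ a₃ a₄ a₆ x₀ y₀ s →
                               let W = weierstrass a₁ a₂ a₃ a₄ a₆ in
                               Weierstrass.a₆ (Substitution.translated (polynomials 8)
                                   con x₀ s y₀ W)
                               := :- PlaneCubic.F (polynomials 8) W x₀ y₀)
                             refl a₁ a₂ a₃ a₄ a₆ x₀ y₀ s ⟩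
      - F x₀ y₀           ≡⟨ cong -_ (onCurve⇒F≡0 W x₀ y₀ on) ⟩
      0ℚ                  ∎
      where open ≡-Reasoning

    -- On Y = n X the cubic becomes X (X² - (n² + A n - B) X - C n) = 0, which gives sum and product
    -- of the two other roots. The shear by `s` turns the slope m into m - s.
    secant⇒line : ∀ {x y x′ y′} → Secant W x₀ y₀ x y x′ y′ →
                  OriginLine W₀.a₁ W₀.a₂ W₀.a₃ (x - x₀) (y - y₀ - s * (x - x₀))
                                             (x′ - x₀) (y′ - y₀ - s * (x′ - x₀))
    secant⇒line {x} {y} {x′} {y′} S = record
      { n = m - s
      ; Y≡ = begin
          y - y₀ - s * (x - x₀)                  ≡⟨ cong (_- s * (x - x₀)) slope ⟨
          m * (x - x₀) - s * (x - x₀)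
              ≡⟨ solve 3 (λ m s u → m :* u :- s :* u := (m :- s) :* u) refl m s (x - x₀) ⟩
          (m - s) * (x - x₀)                     ∎
      ; X+X′≡ = begin
          x - x₀ + (x′ - x₀)                     ≡⟨ cong (λ x′ → x - x₀ + (x′ - x₀)) x₃≡ ⟩
          x - x₀ + (m * m + a₁ * m - a₂ - x₀ - x - x₀)
            ≡⟨ solve 6 (λ a₁ a₂ x₀ x m s →
                 x :- x₀ :+ (m :* m :+ a₁ :* m :- a₂ :- x₀ :- x :- x₀) :=
                 (m :- s) :* (m :- s) :+ (a₁ :+ con (+ 2) :* s) :* (m :- s)
                   :- (a₂ :- s :* a₁ :+ con (+ 3) :* x₀ :- s :* s))
               refl a₁ a₂ x₀ x m s ⟩
          (m - s) * (m - s) + W₀.a₁ * (m - s) - W₀.a₂ ∎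
      ; X*X′≡ = begin
          (x - x₀) * (x′ - x₀)                   ≡⟨ cong (λ x′ → (x - x₀) * (x′ - x₀)) x₃≡ ⟩
          (x - x₀) * (m * m + a₁ * m - a₂ - x₀ - x - x₀)
            ≡⟨ solve 10 (λ a₁ a₂ a₃ a₄ a₆ x₀ y₀ x m s →
                 let open PlaneCubic (polynomials 10) (weierstrass a₁ a₂ a₃ a₄ a₆) renaming (α to αₚ) in
                 (x :- x₀) :* (m :* m :+ a₁ :* m :- a₂ :- x₀ :- x :- x₀) :=
                 αₚ m x₀ y₀ x :- αₚ s x₀ y₀ x₀ :- (a₃ :+ x₀ :* a₁ :+ con (+ 2) :* y₀) :* (m :- s))
               refl a₁ a₂ a₃ a₄ a₆ x₀ y₀ x m s ⟩
          α m x₀ y₀ x - α s x₀ y₀ x₀ - W₀.a₃ * (m - s)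
            ≡⟨ cong₂ (λ u v → u - v - W₀.a₃ * (m - s)) α≡0 tangent ⟩
          0ℚ - W₀.a₃ * (m - s)                   ≡⟨ ℚₚ.+-identityˡ _ ⟩
          - (W₀.a₃ * (m - s))                    ∎
      ; Y′≡ = begin
          (m - s) * (x′ - x₀)
            ≡⟨ solve 7 (λ a₁ a₃ x₀ y₀ x′ m s →
                 (m :- s) :* (x′ :- x₀) :=
                 :- (:- (m :* (x′ :- x₀) :+ y₀) :- a₁ :* x′ :- a₃ :- y₀ :- s :* (x′ :- x₀))
                   :- (a₁ :+ con (+ 2) :* s) :* (x′ :- x₀) :- (a₃ :+ x₀ :* a₁ :+ con (+ 2) :* y₀))
               refl a₁ a₃ x₀ y₀ x′ m s ⟩
          - (- (m * (x′ - x₀) + y₀) - a₁ * x′ - a₃ - y₀ - s * (x′ - x₀)) - W₀.a₁ * (x′ - x₀) - W₀.a₃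
            ≡⟨ cong (λ y′ → - (y′ - y₀ - s * (x′ - x₀)) - W₀.a₁ * (x′ - x₀) - W₀.a₃) y₃≡ ⟨
          - (y′ - y₀ - s * (x′ - x₀)) - W₀.a₁ * (x′ - x₀) - W₀.a₃ ∎
      }
      where
      open Secant S
      open ≡-Reasoning

  OriginLine-scaled : ∀ v {A B C X Y X′ Y′} → OriginLine A B C X Y X′ Y′ →
                OriginLine (v * A) (v * v * B) (v * v * v * C) (v * v * X) (v * v * v * Y)
                    (v * v * X′) (v * v * v * Y′)
  OriginLine-scaled v {A} {B} {C} {X} {Y} {X′} {Y′} L = record
    { n = v * n
    ; Y≡ = trans (cong (v * v * v *_) Y≡)
        (solve 3 (λ v n X → v :* v :* v :* (n :* X) := v :* n :* (v :* v :* X)) refl v n X)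
    ; X+X′≡ = trans (solve 3 (λ v X X′ → v :* v :* X :+ v :* v :* X′ := v :* v :* (X :+ X′)) refl v
        X X′)
        (trans (cong (v * v *_) X+X′≡) (solve 4 (λ v A B n → v :* v :* (n :* n :+ A :* n :- B) :=
           v :* n :* (v :* n) :+ v :* A :* (v :* n) :- v :* v :* B) refl v A B n))
    ; X*X′≡ = trans (solve 3
        (λ v X X′ → v :* v :* X :* (v :* v :* X′) := v :* v :* v :* v :* (X :* X′)) refl v X X′)
        (trans (cong (v * v * v * v *_) X*X′≡)
            (solve 3 (λ v C n → v :* v :* v :* v :* :- (C :* n) :=
           :- (v :* v :* v :* C :* (v :* n))) refl v C n))
    ; Y′≡ = trans (solve 3 (λ v n X′ → v :* n :* (v :* v :* X′) := v :* v :* v :* (n :* X′)) refl v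
        n X′)
        (trans (cong (v * v * v *_) Y′≡)
            (solve 5 (λ v A C X′ Y′ → v :* v :* v :* (:- Y′ :- A :* X′ :- C) :=
           :- (v :* v :* v :* Y′) :- v :* A :* (v :* v :* X′) :- v :* v :* v :* C) refl v A
               C X′ Y′))
    }
    where open OriginLine L

  -- `X k` and `Y k` are the coordinates of k P for 0 < k < 12, with P at the origin and a
  -- horizontal tangent there. That 12 P = ∞ enters only as `X₁₁≡0`, since 11 P = - P has the
  -- abscissa of P; `C≢0` says that P is not 2-torsion.
  record Chain (A B C : ℚ) : Set where
    field
      X Y    : ℕ → ℚ
      X₁≡0   : X 1 ≡ 0ℚ
      X₁₁≡0  : X 11 ≡ 0ℚ
      C≢0    : C ≢ 0ℚ
      line   : ∀ k → 0 ℕ.< k → k ℕ.< 11 → OriginLine A B C (X k) (Y k) (X (suc k)) (Y (suc k))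
      n₁≡0   : OriginLine.n (line 1 (s≤s z≤n) (s≤s (s≤s z≤n))) ≡ 0ℚ

  Chain-scaled : ∀ v → v ≢ 0ℚ → ∀ {A B C} → Chain A B C → Chain (v * A) (v * v * B) (v * v * v * C)
  Chain-scaled v v≢0 {A} {B} {C} ch = record
    { X = λ k → v * v * X k
    ; Y = λ k → v * v * v * Y k
    ; X₁≡0 = trans (cong (v * v *_) X₁≡0) (ℚₚ.*-zeroʳ (v * v))
    ; X₁₁≡0 = trans (cong (v * v *_) X₁₁≡0) (ℚₚ.*-zeroʳ (v * v))
    ; C≢0 = λ eq → C≢0 (*-cancelˡ C 0ℚ v v≢0 (*-cancelˡ _ _ v v≢0 (*-cancelˡ _ _ v v≢0
        (trans (solve 2 (λ v C → v :* (v :* (v :* C)) := v :* v :* v :* C) refl v C)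
          (trans eq (solve 1 (λ v → con (+ 0) := v :* (v :* (v :* con (+ 0)))) refl v))))))
    ; line = λ k 0<k k<11 → OriginLine-scaled v (line k 0<k k<11)
    ; n₁≡0 = trans (cong (v *_) n₁≡0) (ℚₚ.*-zeroʳ v)
    }
    where open Chain ch

  -- The Tate normal form y² + (1 - c) x y - b y = x³ - b x², with r = b / c and
  -- s = c / (r - 1); the last relation is the equation of X₁(12) in s and t.
  record TateForm (A b : ℚ) : Set where
    field
      s t  : ℚ
      A≡   : let r = 1ℚ + t * (s - 1ℚ) ; c = s * (r - 1ℚ) in A ≡ 1ℚ - c
      b≡   : let r = 1ℚ + t * (s - 1ℚ) ; c = s * (r - 1ℚ) in b ≡ r * c
      st²≡ : s * (t * t) ≡ ι (+ 3) * (t * t) - ι (+ 3) * t + 1ℚ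
      b≢0  : b ≢ 0ℚ
      t≢0  : t ≢ 0ℚ

  -- The unknowns are eliminated in turn: X₂ = b, X₃ = c, X₄ = r (r - 1),
  -- X₅ = r s (s - 1), X₆ = s t (t - 1), where n₂ = c, n₃ = r - 1, n₄ = r (s - 1)
  -- and n₅ = n₆ = s (t - 1).
  tateForm₅ : ∀ {s t X₆} → let r = 1ℚ + t * (s - 1ℚ) ; c = s * (r - 1ℚ) ; n₅ = s * (t - 1ℚ) in
    r * c ≢ 0ℚ → X₆ ≢ 0ℚ → s ≢ 0ℚ → s - 1ℚ ≢ 0ℚ →
    r * s * (s - 1ℚ) * X₆ ≡ r * c * n₅ → (n₅ + n₅ + (1ℚ - c)) * X₆ ≡ r * c →
    TateForm (1ℚ - c) (r * c)
  tateForm₅ {s} {t} {X₆} b≢0 X₆≢0 s≢0 s-1≢0 product₅ T₆ = record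
    { s = s ; t = t ; A≡ = refl ; b≡ = refl ; b≢0 = b≢0 ; t≢0 = t≢0
    -- After substituting X₆ = s t (t - 1), the difference of the two sides of `T₆` is s² t (3 t² -
    -- 3 t + 1 - s t²); the cancelled factors are s, t and s.
    ; st²≡ = sym (*-cancelˡ _ _ s s≢0 (*-cancelˡ _ _ t t≢0 (*-cancelˡ _ _ s s≢0 (begin
        s * (t * (s * (ι (+ 3) * (t * t) - ι (+ 3) * t + 1ℚ)))
          ≡⟨ solve 2 (λ s t →
              let 1# = con (+ 1) ; r = 1# :+ t :* (s :- 1#) ; c = s :* (r :- 1#) ; n₅ = s :* (t :- 1#) in
              s :* (t :* (s :* (con (+ 3) :* (t :* t) :- con (+ 3) :* t :+ 1#)))
              := (n₅ :+ n₅ :+ (1# :- c)) :* (t :* s :* (t :- 1#)) :- r :* c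
                  :+ s :* (t :* (s :* (s :* (t :* t)))))
             refl s t ⟩
        (n₅ + n₅ + (1ℚ - c)) * (t * s * (t - 1ℚ)) - r * c + s * (t * (s * (s * (t * t))))
          ≡⟨ cong (λ X → (n₅ + n₅ + (1ℚ - c)) * X - r * c + s * (t * (s * (s * (t * t))))) X₆≡ ⟨
        (n₅ + n₅ + (1ℚ - c)) * X₆ - r * c + s * (t * (s * (s * (t * t))))
          ≡⟨ cong (λ u → u - r * c + s * (t * (s * (s * (t * t))))) T₆ ⟩
        r * c - r * c + s * (t * (s * (s * (t * t))))
          ≡⟨ solve 2 (λ u v → u :- u :+ v := v) refl (r * c) (s * (t * (s * (s * (t * t))))) ⟩
        s * (t * (s * (s * (t * t)))) ∎))))
    }
    where
    open ≡-Reasoning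
    r c n₅ : ℚ
    r = 1ℚ + t * (s - 1ℚ)
    c = s * (r - 1ℚ)
    n₅ = s * (t - 1ℚ)
    r≢0 : r ≢ 0ℚ
    r≢0 r≡0 = b≢0 (trans (cong (_* c) r≡0) (ℚₚ.*-zeroˡ c))
    X₆≡ : X₆ ≡ t * s * (t - 1ℚ)
    X₆≡ = *-cancelˡ _ _ r r≢0 (*-cancelˡ _ _ s s≢0 (*-cancelˡ _ _ (s - 1ℚ) s-1≢0 (begin
      (s - 1ℚ) * (s * (r * X₆))
          ≡⟨ solve 4 (λ u s r X → u :* (s :* (r :* X)) := r :* s :* u :* X) refl (s - 1ℚ) s r X₆ ⟩
      r * s * (s - 1ℚ) * X₆           ≡⟨ product₅ ⟩
      r * c * n₅                      ≡⟨ solve 3 (λ s t r →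
                                           let 1# = con (+ 1) in
                                           r :* (s :* (1# :+ t :* (s :- 1#) :- 1#)) :*
                                               (s :* (t :- 1#))
                                           := (s :- 1#) :* (s :* (r :* (t :* s :* (t :- 1#))))) refl
                                               s t r ⟩
      (s - 1ℚ) * (s * (r * (t * s * (t - 1ℚ)))) ∎)))
    t≢0 : t ≢ 0ℚ
    t≢0 t≡0 = X₆≢0 (trans X₆≡ (trans (cong (λ u → u * s * (t - 1ℚ)) t≡0)
      (solve 2 (λ s u → con (+ 0) :* s :* u := con (+ 0)) refl s (t - 1ℚ))))

  tateForm₄ : ∀ {r s n₅ X₅ X₆} → let c = s * (r - 1ℚ) ; n₄ = r * (s - 1ℚ) in
    r * c ≢ 0ℚ → X₅ ≢ 0ℚ → X₆ ≢ 0ℚ →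
    r * (r - 1ℚ) * X₅ ≡ r * c * n₄ → (n₄ + n₅ + (1ℚ - c)) * X₅ ≡ r * c →
    X₅ * X₆ ≡ r * c * n₅ → (n₅ + n₅ + (1ℚ - c)) * X₆ ≡ r * c →
    TateForm (1ℚ - c) (r * c)
  tateForm₄ {r} {s} {n₅} {X₅} {X₆} b≢0 X₅≢0 X₆≢0 product₄ T₅ product₅ T₆ =
    conclude X₅≡ t r≡ n₅≡
    where
    open ≡-Reasoning
    c : ℚ
    c = s * (r - 1ℚ)
    r≢0 : r ≢ 0ℚ
    r≢0 r≡0 = b≢0 (trans (cong (_* c) r≡0) (ℚₚ.*-zeroˡ c))
    c≢0 : c ≢ 0ℚ
    c≢0 c≡0 = b≢0 (trans (cong (r *_) c≡0) (ℚₚ.*-zeroʳ r))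
    s≢0 : s ≢ 0ℚ
    s≢0 s≡0 = c≢0 (trans (cong (_* (r - 1ℚ)) s≡0) (ℚₚ.*-zeroˡ (r - 1ℚ)))
    r-1≢0 : r - 1ℚ ≢ 0ℚ
    r-1≢0 r-1≡0 = c≢0 (trans (cong (s *_) r-1≡0) (ℚₚ.*-zeroʳ s))
    X₅≡ : X₅ ≡ r * s * (s - 1ℚ)
    X₅≡ = *-cancelˡ _ _ (r * (r - 1ℚ)) (λ eq → b≢0 (trans
      (solve 3 (λ r s u → r :* (s :* u) := s :* (r :* u)) refl r s (r - 1ℚ))
          (trans (cong (s *_) eq) (ℚₚ.*-zeroʳ s))))
      (trans product₄ (solve 2 (λ r s → let 1# = con (+ 1) in
        r :* (s :* (r :- 1#)) :* (r :* (s :- 1#)) := r :* (r :- 1#) :* (r :* s :* (s :- 1#))) refl r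
            s))
    -- Dividing `T₅` by r s leaves (n₅ + 1 + s - r) (s - 1) = r - 1. Its first factor serves as t,
    -- so that r - 1 need not be divided by s - 1.
    t : ℚ
    t = n₅ + 1ℚ + s - r
    r≡ : r ≡ 1ℚ + t * (s - 1ℚ)
    r≡ = begin
      r                      ≡⟨ solve 1 (λ r → r := con (+ 1) :+ (r :- con (+ 1))) refl r ⟩
      1ℚ + (r - 1ℚ)          ≡⟨ cong (_+_ 1ℚ) (*-cancelˡ _ _ s s≢0 (*-cancelˡ _ _ r r≢0 (begin
        r * (s * (r - 1ℚ))          ≡⟨ T₅ ⟨
        (r * (s - 1ℚ) + n₅ + (1ℚ - c)) * X₅  ≡⟨ cong ((r * (s - 1ℚ) + n₅ + (1ℚ - c)) *_) X₅≡ ⟩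
        (r * (s - 1ℚ) + n₅ + (1ℚ - c)) * (r * s * (s - 1ℚ))
          ≡⟨ solve 3 (λ r s n → let 1# = con (+ 1) in
              (r :* (s :- 1#) :+ n :+ (1# :- s :* (r :- 1#))) :* (r :* s :* (s :- 1#))
              := r :* (s :* ((n :+ 1# :+ s :- r) :* (s :- 1#)))) refl r s n₅ ⟩
        r * (s * (t * (s - 1ℚ))) ∎))) ⟩
      1ℚ + t * (s - 1ℚ)      ∎
    n₅≡ : n₅ ≡ s * (t - 1ℚ)
    n₅≡ = begin
      n₅
          ≡⟨ solve 3 (λ r s n → n := n :+ con (+ 1) :+ s :- r :- con (+ 1) :- s :+ r) refl r s n₅ ⟩
      t - 1ℚ - s + r         ≡⟨ cong (λ u → t - 1ℚ - s + u) r≡ ⟩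
      t - 1ℚ - s + (1ℚ + t * (s - 1ℚ)) ≡⟨ solve 2 (λ s t → let 1# = con (+ 1) in
                                  t :- 1# :- s :+ (1# :+ t :* (s :- 1#)) :=
                                      s :* (t :- 1#)) refl s t ⟩
      s * (t - 1ℚ)           ∎
    s-1≢0 : s - 1ℚ ≢ 0ℚ
    s-1≢0 eq = X₅≢0 (trans X₅≡ (trans (cong (r * s *_) eq) (ℚₚ.*-zeroʳ (r * s))))
    -- Restated for a variable t, so that the three equations can be substituted by matching on
    -- `refl`.
    conclude : X₅ ≡ r * s * (s - 1ℚ) → ∀ t → r ≡ 1ℚ + t * (s - 1ℚ) → n₅ ≡ s * (t - 1ℚ) →
        TateForm (1ℚ - c) (r * c)
    conclude refl t refl refl = tateForm₅ {s} {t} {X₆} b≢0 X₆≢0 s≢0 s-1≢0 product₅ T₆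

  tateForm₃ : ∀ {c r n₄ n₅ X₄ X₅ X₆} → r * c ≢ 0ℚ → X₅ ≢ 0ℚ → X₆ ≢ 0ℚ →
    c * X₄ ≡ r * c * (r - 1ℚ) → (r - 1ℚ + n₄ + (1ℚ - c)) * X₄ ≡ r * c →
    X₄ * X₅ ≡ r * c * n₄ → (n₄ + n₅ + (1ℚ - c)) * X₅ ≡ r * c →
    X₅ * X₆ ≡ r * c * n₅ → (n₅ + n₅ + (1ℚ - c)) * X₆ ≡ r * c →
    TateForm (1ℚ - c) (r * c)
  tateForm₃ {c} {r} {n₄} {n₅} {X₄} {X₅} {X₆} b≢0 X₅≢0 X₆≢0 product₃ T₄ product₄ T₅ product₅ T₆ =
    conclude X₄≡ s n₄≡ c≡
    where
    open ≡-Reasoning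
    r≢0 : r ≢ 0ℚ
    r≢0 r≡0 = b≢0 (trans (cong (_* c) r≡0) (ℚₚ.*-zeroˡ c))
    c≢0 : c ≢ 0ℚ
    c≢0 c≡0 = b≢0 (trans (cong (r *_) c≡0) (ℚₚ.*-zeroʳ r))
    instance _ = ≢-nonZero r≢0
    X₄≡ : X₄ ≡ r * (r - 1ℚ)
    X₄≡ = *-cancelˡ _ _ c c≢0
        (trans product₃ (solve 3 (λ r c u → r :* c :* u := c :* (r :* u)) refl r c (r - 1ℚ)))
    -- Chosen to make n₄ = r (s - 1); `T₄` then shows that this s is also c / (r - 1).
    s : ℚ
    s = 1ℚ + n₄ ÷ r
    n₄≡ : n₄ ≡ r * (s - 1ℚ)
    n₄≡ = begin
      n₄                     ≡⟨ ÷-* n₄ r ⟨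
      n₄ ÷ r * r
          ≡⟨ solve 2 (λ q r → q :* r := r :* (con (+ 1) :+ q :- con (+ 1))) refl (n₄ ÷ r) r ⟩
      r * (s - 1ℚ)           ∎
    c≡ : c ≡ s * (r - 1ℚ)
    c≡ = sym (*-cancelˡ _ _ r r≢0 (*-cancelˡ _ _ r r≢0 (begin
      r * (r * (s * (r - 1ℚ)))
        ≡⟨ solve 3 (λ r s c → let 1# = con (+ 1) in
             r :* (r :* (s :* (r :- 1#))) :=
             (r :- 1# :+ r :* (s :- 1#) :+ (1# :- c)) :* (r :* (r :- 1#))
                 :+ r :* c :* (r :- 1#)) refl r s c ⟩
      (r - 1ℚ + r * (s - 1ℚ) + (1ℚ - c)) * (r * (r - 1ℚ)) + r * c * (r - 1ℚ)
        ≡⟨ cong₂ (λ n X → (r - 1ℚ + n + (1ℚ - c)) * X + r * c * (r - 1ℚ)) n₄≡ X₄≡ ⟨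
      (r - 1ℚ + n₄ + (1ℚ - c)) * X₄ + r * c * (r - 1ℚ)
        ≡⟨ cong (_+ r * c * (r - 1ℚ)) T₄ ⟩
      r * c + r * c * (r - 1ℚ)
        ≡⟨ solve 2 (λ r c → r :* c :+ r :* c :* (r :- con (+ 1)) := r :* (r :* c)) refl r c ⟩
      r * (r * c) ∎)))
    conclude : X₄ ≡ r * (r - 1ℚ) → ∀ s → n₄ ≡ r * (s - 1ℚ) → c ≡ s * (r - 1ℚ) →
        TateForm (1ℚ - c) (r * c)
    conclude refl s refl refl = tateForm₄ {r} {s} {n₅} {X₅} {X₆} b≢0 X₅≢0 X₆≢0 product₄ T₅
        product₅ T₆

  tateForm₂ : ∀ {A b n₂ n₃ n₄ n₅ X₂ X₃ X₄ X₅ X₆} → b ≢ 0ℚ → X₅ ≢ 0ℚ → X₆ ≢ 0ℚ →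
    X₂ ≡ b → (n₂ + A) * X₂ ≡ b → X₂ + X₃ ≡ n₂ * n₂ + A * n₂ + b → (n₂ + n₃ + A) * X₃ ≡ b →
    X₃ * X₄ ≡ b * n₃ → (n₃ + n₄ + A) * X₄ ≡ b →
    X₄ * X₅ ≡ b * n₄ → (n₄ + n₅ + A) * X₅ ≡ b →
    X₅ * X₆ ≡ b * n₅ → (n₅ + n₅ + A) * X₆ ≡ b →
    TateForm A b
  tateForm₂ {A} {b} {c} {n₃} {n₄} {n₅} {X₂} {X₃} {X₄} {X₅} {X₆}
    b≢0 X₅≢0 X₆≢0 refl T₂ sum₂ T₃ product₃ T₄ product₄ T₅ product₅ T₆ =
    conclude A≡ X₃≡ r n₃≡ b≡
    where
    open ≡-Reasoning
    A≡ : A ≡ 1ℚ - c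
    A≡ = begin
      A               ≡⟨ solve 2 (λ A c → A := c :+ A :- c) refl A c ⟩
      c + A - c       ≡⟨ cong (_- c) (*-cancelʳ (c + A) 1ℚ b b≢0
          (trans T₂ (sym (ℚₚ.*-identityˡ b)))) ⟩
      1ℚ - c          ∎
    X₃≡ : X₃ ≡ c
    X₃≡ = begin
      X₃                         ≡⟨ solve 2 (λ b X → X := b :+ X :- b) refl b X₃ ⟩
      b + X₃ - b                 ≡⟨ cong (_- b) sum₂ ⟩
      c * c + A * c + b - b      ≡⟨ cong (λ A → c * c + A * c + b - b) A≡ ⟩
      c * c + (1ℚ - c) * c + b - b
          ≡⟨ solve 2 (λ b c → c :* c :+ (con (+ 1) :- c) :* c :+ b :- b := c) refl b c ⟩
      c                          ∎
    r : ℚ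
    r = n₃ + 1ℚ
    n₃≡ : n₃ ≡ r - 1ℚ
    n₃≡ = solve 1 (λ n → n := n :+ con (+ 1) :- con (+ 1)) refl n₃
    b≡ : b ≡ r * c
    b≡ = begin
      b                          ≡⟨ T₃ ⟨
      (c + n₃ + A) * X₃          ≡⟨ cong₂ (λ A X → (c + n₃ + A) * X) A≡ X₃≡ ⟩
      (c + n₃ + (1ℚ - c)) * c
          ≡⟨ solve 2 (λ n c → (c :+ n :+ (con (+ 1) :- c)) :* c :=
              (n :+ con (+ 1)) :* c) refl n₃ c ⟩
      r * c                      ∎
    conclude : A ≡ 1ℚ - c → X₃ ≡ c → ∀ r → n₃ ≡ r - 1ℚ → b ≡ r * c → TateForm A b
    conclude refl refl r refl refl = tateForm₃ {c} {r} {n₄} {n₅} {X₄} {X₅} {X₆} b≢0 X₅≢0 X₆≢0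
        product₃ T₄ product₄ T₅ product₅ T₆

  -- Relations along the chain

  module _ {A B C : ℚ} (C≢0 : C ≢ 0ℚ) where

    -- The two ordinates above X′ add up to - A X′ - C. The next line gives n′ X′ for the point
    -- itself, and the previous line gives n X′ for its negative.
    slopes : ∀ {X Y X′ Y′ X″ Y″} (L : OriginLine A B C X Y X′ Y′)
        (L′ : OriginLine A B C X′ Y′ X″ Y″) →
             (OriginLine.n L + OriginLine.n L′ + A) * X′ ≡ - C
    slopes {X′ = X′} {Y′} L L′ = begin
      (n + n′ + A) * X′
          ≡⟨ solve 4 (λ n n′ A X → (n :+ n′ :+ A) :* X := n :* X :+ (n′ :* X :+ A :* X)) refl n n′
              A X′ ⟩
      n * X′ + (n′ * X′ + A * X′)
          ≡⟨ cong₂ (λ u v → u + (v + A * X′)) (OriginLine.Y′≡ L) (sym (OriginLine.Y≡ L′)) ⟩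
      - Y′ - A * X′ - C + (Y′ + A * X′)
          ≡⟨ solve 3 (λ Y u C → :- Y :- u :- C :+ (Y :+ u) := :- C) refl Y′ (A * X′) C ⟩
      - C                                   ∎
      where
      open ≡-Reasoning
      n n′ : ℚ
      n  = OriginLine.n L
      n′ = OriginLine.n L′

    X≢0 : ∀ {X Y X′ Y′ X″ Y″} → OriginLine A B C X Y X′ Y′ → OriginLine A B C X′ Y′ X″ Y″ → X′ ≢ 0ℚ
    X≢0 L L′ refl = C≢0 (trans (solve 1 (λ C → C := :- (:- C)) refl C)
      (cong -_ (trans (sym (slopes L L′)) (ℚₚ.*-zeroʳ (OriginLine.n L + OriginLine.n L′ + A)))))

    -- By uniqueness of the chain, j P = - (12 - j) P propagates to smaller j.
    reflect : ∀ {X₁ Y₁ X₂ Y₂ X₃ Y₃ Z₁ V₁ Z₂ V₂ Z₃ V₃}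
      (L₁ : OriginLine A B C X₁ Y₁ X₂ Y₂) (L₂ : OriginLine A B C X₂ Y₂ X₃ Y₃)
      (M₁ : OriginLine A B C Z₁ V₁ Z₂ V₂) (M₂ : OriginLine A B C Z₂ V₂ Z₃ V₃) →
      X₁ ≡ Z₃ × OriginLine.n L₁ ≡ OriginLine.n M₂ → X₂ ≡ Z₂ × OriginLine.n L₂ ≡ OriginLine.n M₁
    reflect {X₁} {X₂ = X₂} {Z₂ = Z₂} L₁ L₂ M₁ M₂ (refl , n≡) = X₂≡Z₂ , (begin
      OriginLine.n L₂              ≡⟨ isolate (OriginLine.n L₁) (OriginLine.n L₂) A ⟩
      OriginLine.n L₁ + OriginLine.n L₂ + A - A - OriginLine.n L₁
          ≡⟨ cong₂ (λ u v → u - A - v) sums n≡ ⟩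
      OriginLine.n M₂ + OriginLine.n M₁ + A - A - OriginLine.n M₂
          ≡⟨ isolate (OriginLine.n M₂) (OriginLine.n M₁) A ⟨
      OriginLine.n M₁              ∎)
      where
      open ≡-Reasoning
      isolate : ∀ m n A → n ≡ m + n + A - A - m
      isolate = solve 3 (λ m n A → n := m :+ n :+ A :- A :- m) refl
      X₂≡Z₂ : X₂ ≡ Z₂
      X₂≡Z₂ = begin
        X₂                   ≡⟨ solve 2 (λ X Z → X := Z :+ X :- Z) refl X₂ X₁ ⟩
        X₁ + X₂ - X₁
            ≡⟨ cong (_- X₁) (trans (OriginLine.X+X′≡ L₁)
                (trans (cong (λ n → n * n + A * n - B) n≡) (sym (OriginLine.X+X′≡ M₂)))) ⟩
        Z₂ + X₁ - X₁         ≡⟨ solve 2 (λ X Z → Z :+ X :- X := Z) refl X₁ Z₂ ⟩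
        Z₂                   ∎
      sums : OriginLine.n L₁ + OriginLine.n L₂ + A ≡ OriginLine.n M₂ + OriginLine.n M₁ + A
      sums = *-cancelʳ _ _ Z₂ (X≢0 M₁ M₂) (begin
        (OriginLine.n L₁ + OriginLine.n L₂ + A) * Z₂
            ≡⟨ cong ((OriginLine.n L₁ + OriginLine.n L₂ + A) *_) X₂≡Z₂ ⟨
        (OriginLine.n L₁ + OriginLine.n L₂ + A) * X₂    ≡⟨ slopes L₁ L₂ ⟩
        - C                                 ≡⟨ slopes M₁ M₂ ⟨
        (OriginLine.n M₁ + OriginLine.n M₂ + A) * Z₂
            ≡⟨ cong (λ u → (u + A) * Z₂) (ℚₚ.+-comm (OriginLine.n M₁) (OriginLine.n M₂)) ⟩
        (OriginLine.n M₂ + OriginLine.n M₁ + A) * Z₂    ∎)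

  -- X₂ = - B, because the first line is horizontal; B = 0 would put 2 P above P.
  Chain⇒B≢0 : ∀ {A B C} → Chain A B C → B ≢ 0ℚ
  Chain⇒B≢0 {A} {B} {C} ch B≡0 = X≢0 C≢0 l₁ l₂ (begin
    X 2                  ≡⟨ solve 1 (λ X → X := con (+ 0) :+ X) refl (X 2) ⟩
    0ℚ + X 2             ≡⟨ cong (_+ X 2) X₁≡0 ⟨
    X 1 + X 2            ≡⟨ OriginLine.X+X′≡ l₁ ⟩
    n₁ * n₁ + A * n₁ - B ≡⟨ cong₂ (λ n B → n * n + A * n - B) n₁≡0 B≡0 ⟩
    0ℚ * 0ℚ + A * 0ℚ - 0ℚ
        ≡⟨ solve 1 (λ A → let 0# = con (+ 0) in 0# :* 0# :+ A :* 0# :- 0# := 0#) refl A ⟩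
    0ℚ                   ∎)
    where
    open ≡-Reasoning
    open Chain ch
    l₁ = line 1 (s≤s z≤n) (s≤s (s≤s z≤n))
    l₂ = line 2 (s≤s z≤n) (s≤s (s≤s (s≤s z≤n)))
    n₁ = OriginLine.n l₁

  Chain⇒TateForm : ∀ {A B C} → Chain A B C → B ≡ C → TateForm A (- B)
  Chain⇒TateForm {A} {B} ch refl = tateForm₂ {A} {b = - B} {n 2} {n 3} {n 4} {n 5} {X 2} {X 3} {X 4}
      {X 5} {X 6}
    (λ -B≡0 → Chain⇒B≢0 ch (trans (solve 1 (λ B → B := :- (:- B)) refl B) (cong -_ -B≡0)))
    (X≢0 C≢0 (l 4) (l 5)) (X≢0 C≢0 (l 5) (l 6))
    X₂≡
    (trans (cong (_* X 2) (trans (solve 2 (λ n A → n :+ A := con (+ 0) :+ n :+ A) refl (n 2) A)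
      (cong (λ u → u + n 2 + A) (sym n₁≡0)))) (slopes C≢0 (l 1) (l 2)))
    (OriginLine.X+X′≡ (l 2)) (slopes C≢0 (l 2) (l 3)) (X*X′≡ (l 3)) (slopes C≢0 (l 3) (l 4))
    (X*X′≡ (l 4)) (slopes C≢0 (l 4) (l 5)) (X*X′≡ (l 5))
    (subst (λ m → (n 5 + m + A) * X 6 ≡ - B) (sym n₅≡n₆) (slopes C≢0 (l 5) (l 6)))
    where
    open ≡-Reasoning
    open Chain ch
    l : ∀ k {0<k : True (0 ℕₚ.<? k)} {k<11 : True (k ℕₚ.<? 11)} →
        OriginLine A B B (X k) (Y k) (X (suc k)) (Y (suc k))
    l k {0<k} {k<11} = line k (toWitness 0<k) (toWitness k<11)
    n : ∀ k {0<k : True (0 ℕₚ.<? k)} {k<11 : True (k ℕₚ.<? 11)} → ℚ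
    n k {0<k} {k<11} = OriginLine.n (l k {0<k} {k<11})
    X₂≡ : X 2 ≡ - B
    X₂≡ = begin
      X 2                  ≡⟨ solve 1 (λ X → X := con (+ 0) :+ X) refl (X 2) ⟩
      0ℚ + X 2             ≡⟨ cong (_+ X 2) X₁≡0 ⟨
      X 1 + X 2            ≡⟨ OriginLine.X+X′≡ (l 1) ⟩
      n 1 * n 1 + A * n 1 - B ≡⟨ cong (λ n → n * n + A * n - B) n₁≡0 ⟩
      0ℚ * 0ℚ + A * 0ℚ - B
          ≡⟨ solve 2 (λ A B → let 0# = con (+ 0) in 0# :* 0# :+ A :* 0# :- B := :- B) refl A B ⟩
      - B                  ∎
    X*X′≡ : ∀ {X Y X′ Y′} (L : OriginLine A B B X Y X′ Y′) → X * X′ ≡ - B * OriginLine.n L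
    X*X′≡ L = trans (OriginLine.X*X′≡ L)
        (solve 2 (λ B n → :- (B :* n) := :- B :* n) refl B (OriginLine.n L))
    n₁₀≡0 : n 10 ≡ 0ℚ
    n₁₀≡0 = *-cancelˡ _ _ B C≢0 (begin
      B * n 10             ≡⟨ solve 2 (λ B n → B :* n := :- (:- (B :* n))) refl B (n 10) ⟩
      - - (B * n 10)       ≡⟨ cong -_ (OriginLine.X*X′≡ (l 10)) ⟨
      - (X 10 * X 11)      ≡⟨ cong (λ u → - (X 10 * u)) X₁₁≡0 ⟩
      - (X 10 * 0ℚ)
          ≡⟨ solve 2 (λ X B → :- (X :* con (+ 0)) := B :* con (+ 0)) refl (X 10) B ⟩
      B * 0ℚ               ∎)
    -- Starting from n₁ = n₁₀ = 0, four reflections yield n k = n (11 - k) for k = 2, 3, 4, 5.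
    n₅≡n₆ : n 5 ≡ n 6
    n₅≡n₆ = proj₂
      (reflect C≢0 (l 4) (l 5) (l 6) (l 7)
      (reflect C≢0 (l 3) (l 4) (l 7) (l 8)
      (reflect C≢0 (l 2) (l 3) (l 8) (l 9)
      (reflect C≢0 (l 1) (l 2) (l 9) (l 10)
        (trans X₁≡0 (sym X₁₁≡0) , trans n₁≡0 (sym n₁₀≡0))))))

  open Weierstrass

  -- From a point of order 12 to a chain

  module _ (W : Weierstrass ℚ) where
    open GroupLaw W
    open RawMonoidDefinitions rawMonoid using () renaming (_×_ to _·_)

    private
      -- The values at ∞ are irrelevant.
      xCoordinate yCoordinate : Point → ℚ
      xCoordinate ∞              = 0ℚ
      xCoordinate (affine x _ _) = x
      yCoordinate ∞              = 0ℚ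
      yCoordinate (affine _ y _) = y

    secant : ∀ {x y} .{on : OnCurve x y} Q → Q ≢ ∞ → affine x y on ⊕ Q ≢ ∞ →
             Secant W x y (xCoordinate Q) (yCoordinate Q)
               (xCoordinate (affine x y on ⊕ Q)) (yCoordinate (affine x y on ⊕ Q))
    secant ∞ Q≢∞ R≢∞ = contradiction refl Q≢∞
    secant {x} {y} {on} Q@(affine _ _ _) Q≢∞ R≢∞ with affine x y on ⊕ Q in eq
    ... | ∞            = contradiction refl R≢∞
    ... | affine _ _ _ = ⊕-secant W eq

    ⊕≡∞⇒x≡x : ∀ {x y} .{on : OnCurve x y} Q → affine x y on ⊕ Q ≡ ∞ → x ≡ xCoordinate Q
    ⊕≡∞⇒x≡x {x} {y} {on} (affine x₂ y₂ on₂) eq = ⊕-∞ W {x} {y} {x₂} {y₂} {on} {on₂} eq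

    order12⇒chain : ∀ P → HasOrder rawMonoid P 12 → ∃ λ r → ∃ λ s → ∃ λ t →
                    let W₀ = translated r s t W in
                    a₄ W₀ ≡ 0ℚ × a₆ W₀ ≡ 0ℚ × Chain (a₁ W₀) (a₂ W₀) (a₃ W₀)
    order12⇒chain ∞ (_ , _ , <12) = contradiction refl (<12 1 (s≤s z≤n) (s≤s (s≤s z≤n)))
    order12⇒chain P@(affine x₀ y₀ on) (_ , 12P≡∞ , <12) =
      x₀ , s , y₀ , W₀-a₄ W x₀ y₀ s tangent , W₀-a₆ W x₀ y₀ s tangent (recompute (_ ℚₚ.≟ _) on) ,
          record
        { X = λ k → xCoordinate (k · P) - x₀
        ; Y = λ k → yCoordinate (k · P) - y₀ - s * (xCoordinate (k · P) - x₀)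
        ; X₁≡0 = ℚₚ.+-inverseʳ x₀
        ; X₁₁≡0 = trans (cong (_- x₀) (sym (⊕≡∞⇒x≡x (11 · P) 12P≡∞))) (ℚₚ.+-inverseʳ x₀)
        -- C is the denominator of the tangent slope at P; its vanishing would mean 2 P = ∞.
        ; C≢0 = λ C≡0 → <12 2 (s≤s z≤n) (s≤s (s≤s (s≤s z≤n))) (2-torsion W {x₀} {y₀} {on}
            (trans (solve 4 (λ y a₁ x a₃ → y :+ y :+ a₁ :* x :+ a₃ :=
                a₃ :+ x :* a₁ :+ con (+ 2) :* y) refl y₀ (a₁ W) x₀ (a₃ W)) C≡0))
        ; line = λ k 0<k k<11 → secant⇒line W x₀ y₀ s tangent (sec k 0<k k<11)
        ; n₁≡0 = ℚₚ.+-inverseʳ s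
        }
      where
      sec : ∀ k → 0 ℕ.< k → k ℕ.< 11 → Secant W x₀ y₀ (xCoordinate (k · P)) (yCoordinate (k · P))
                                           (xCoordinate (suc k · P)) (yCoordinate (suc k · P))
      sec k 0<k k<11 = secant (k · P) (<12 k 0<k (ℕₚ.m≤n⇒m≤1+n k<11))
          (<12 (suc k) (s≤s z≤n) (s≤s k<11))
      -- `1 · P` computes to `P`, so the secant of index 1 is the tangent at P.
      s : ℚ
      s = Secant.m (sec 1 (s≤s z≤n) (s≤s (s≤s z≤n)))
      tangent : PlaneCubicℚ.α W s x₀ y₀ x₀ ≡ 0ℚ
      tangent = Secant.α≡0 (sec 1 (s≤s z≤n) (s≤s (s≤s z≤n)))

  -- From the Tate normal form to the integral family

  module Familyℚ = Family ℚ.+-*-rawRing ι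

  curve-ι : ∀ x y → mapWeierstrass ι (Familyℤ.curve x y) ≡ Familyℚ.curve (ι x) (ι y)
  curve-ι x y = sym (weierstrass-cong (equal F.A) (equal F.B) (equal (F.B F.* F.e)) refl refl)
    where
    open IntegralRational
    module F where
      open Family integralRationals integral (integral x) (integral y) public
      open RawRing integralRationals public using (_*_)

  -- Write S = s t². Then S = 3 t² - 3 t + 1 yields q² S = Q₃, q² (S - t²) = y (x + y) and q² (t + S
  -- - t²) = Q₂, the factors in the family. Each coefficient is first expressed so that s occurs
  -- only through S, and S is then replaced by the polynomial `P` in t.
  tateForm⇒family : ∀ {A b} (T : TateForm A b) q → let x = TateForm.t T * q ; y = x - q in
    scaled (Familyℚ.e x y) (weierstrass A (- b) (- b) 0ℚ 0ℚ) ≡ Familyℚ.curve x y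
  tateForm⇒family {A} {b} T q = weierstrass-cong eA eB eC (ℚₚ.*-zeroʳ (e ^ 4)) (ℚₚ.*-zeroʳ (e ^ 6))
    where
    open TateForm T
    open ≡-Reasoning
    x y e : ℚ
    x = t * q
    y = x - q
    e = Familyℚ.e x y
    P : ℚ
    P = ι (+ 3) * (t * t) - ι (+ 3) * t + 1ℚ
    eA : e ^ 1 * A ≡ Familyℚ.A x y
    eA = begin
      e ^ 1 * A                                      ≡⟨ cong (e ^ 1 *_) A≡ ⟩
      e ^ 1 * (1ℚ - s * (1ℚ + t * (s - 1ℚ) - 1ℚ))
        ≡⟨ solve 3 (λ s t q → let
               1# = con (+ 1)
               S = s :* (t :* t)
               module F = Family (polynomials 3) con (t :* q) (t :* q :- q) in
             F.e :* 1# :* (1# :- s :* (1# :+ t :* (s :- 1#) :- 1#))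
             := q :* q :* q :* q :* (t :* t :* t :- S :* (S :- t :* t))) refl s t q ⟩
      q * q * q * q * (t * t * t - s * (t * t) * (s * (t * t) - t * t))
        ≡⟨ cong (λ S → q * q * q * q * (t * t * t - S * (S - t * t))) st²≡ ⟩
      q * q * q * q * (t * t * t - P * (P - t * t))
        ≡⟨ solve 2 (λ t q → let
               P = con (+ 3) :* (t :* t) :- con (+ 3) :* t :+ con (+ 1)
               module F = Family (polynomials 2) con (t :* q) (t :* q :- q) in
             q :* q :* q :* q :* (t :* t :* t :- P :* (P :- t :* t)) := F.A) refl t q ⟩
      Familyℚ.A x y                                  ∎
    eB : e ^ 2 * (- b) ≡ Familyℚ.B x y
    eB = begin
      e ^ 2 * (- b)                                  ≡⟨ cong (λ b → e ^ 2 * (- b)) b≡ ⟩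
      e ^ 2 * (- ((1ℚ + t * (s - 1ℚ)) * (s * (1ℚ + t * (s - 1ℚ) - 1ℚ))))
        ≡⟨ solve 3 (λ s t q → let
               1# = con (+ 1)
               S = s :* (t :* t)
               r = 1# :+ t :* (s :- 1#)
               module F = Family (polynomials 3) con (t :* q) (t :* q :- q) in
             F.e :* (F.e :* 1#) :* (:- (r :* (s :* (r :- 1#))))
             := :- (q :* q :* q :* q :* q :* q :* q :* q :*
                 (t :* t :* (t :+ S :- t :* t) :* (S :* (S :- t :* t))))) refl s t q ⟩
      - (q * q * q * q * q * q * q * q *
          (t * t * (t + s * (t * t) - t * t) * (s * (t * t) * (s * (t * t) - t * t))))
        ≡⟨ cong (λ S → - (q * q * q * q * q * q * q * q *
            (t * t * (t + S - t * t) * (S * (S - t * t))))) st²≡ ⟩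
      - (q * q * q * q * q * q * q * q * (t * t * (t + P - t * t) * (P * (P - t * t))))
        ≡⟨ solve 2 (λ t q → let
               P = con (+ 3) :* (t :* t) :- con (+ 3) :* t :+ con (+ 1)
               module F = Family (polynomials 2) con (t :* q) (t :* q :- q) in
             :- (q :* q :* q :* q :* q :* q :* q :* q :*
                 (t :* t :* (t :+ P :- t :* t) :* (P :* (P :- t :* t)))) := F.B) refl t q ⟩
      Familyℚ.B x y                                  ∎
    eC : e ^ 3 * (- b) ≡ Familyℚ.B x y * e
    eC = begin
      e ^ 3 * (- b)              ≡⟨ ℚₚ.*-assoc e (e ^ 2) (- b) ⟩
      e * (e ^ 2 * (- b))        ≡⟨ cong (e *_) eB ⟩
      e * Familyℚ.B x y          ≡⟨ ℚₚ.*-comm e (Familyℚ.B x y) ⟩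
      Familyℚ.B x y * e          ∎

  -- Scaling by v multiplies a₂ by v² and a₃ by v³; they become equal, as in the Tate normal form,
  -- for v = B / C.
  chain⇒tateForm : ∀ {A B C} → Chain A B C → ∃ λ v → ∃ λ b →
                   TateForm (v * A) b × scaled v (weierstrass A B C 0ℚ 0ℚ) ≡ weierstrass (v * A)
                       (- b) (- b) 0ℚ 0ℚ
  chain⇒tateForm {A} {B} {C} ch = v , - (v * v * B) , Chain⇒TateForm (Chain-scaled v v≢0 ch) B≡C ,
    weierstrass-cong
      (cong (_* A) (ℚₚ.*-identityʳ v))
      (trans (cong (λ u → v * u * B) (ℚₚ.*-identityʳ v)) (sym (neg-neg (v * v * B))))
      (trans (solve 2 (λ v C → v :* (v :* (v :* con (+ 1))) :* C := v :* v :* v :* C) refl v C)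
          (trans (sym B≡C) (sym (neg-neg (v * v * B)))))
      (ℚₚ.*-zeroʳ (v ^ 4)) (ℚₚ.*-zeroʳ (v ^ 6))
    where
    open Chain ch
    instance _ = ≢-nonZero C≢0
    v : ℚ
    v = B ÷ C
    vC≡B : v * C ≡ B
    vC≡B = ÷-* B C
    neg-neg : ∀ p → - - p ≡ p
    neg-neg = solve 1 (λ p → :- (:- p) := p) refl
    v≢0 : v ≢ 0ℚ
    v≢0 v≡0 = Chain⇒B≢0 ch (trans (sym vC≡B) (trans (cong (_* C) v≡0) (ℚₚ.*-zeroˡ C)))
    B≡C : v * v * B ≡ v * v * v * C
    B≡C = trans (cong (v * v *_) (sym vC≡B)) (sym (ℚₚ.*-assoc (v * v) v C))

  -- Comparison of j-invariants

  *-≢0 : ∀ {p q} → p ≢ 0ℚ → q ≢ 0ℚ → p * q ≢ 0ℚ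
  *-≢0 {p} {q} p≢0 q≢0 pq≡0 = q≢0 (*-cancelˡ q 0ℚ p p≢0 (trans pq≡0 (sym (ℚₚ.*-zeroʳ p))))

  ^-≢0 : ∀ {p} n → p ≢ 0ℚ → p ^ n ≢ 0ℚ
  ^-≢0 zero    p≢0 = λ ()
  ^-≢0 (suc n) p≢0 = *-≢0 p≢0 (^-≢0 n p≢0)

  c₄-ι-scaled : ∀ M u W → mapWeierstrass ι M ≡ scaled u W →
      ι (Invariantsℤ.c₄ M) ≡ u ^ 4 * Invariantsℚ.c₄ W
  c₄-ι-scaled M u W eq = begin
    ι (Invariantsℤ.c₄ M)                      ≡⟨ c₄-ι M ⟨
    Invariantsℚ.c₄ (mapWeierstrass ι M)       ≡⟨ cong Invariantsℚ.c₄ eq ⟩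
    Invariantsℚ.c₄ (scaled u W)               ≡⟨ Identitiesℚ.c₄-scaled u W ⟩
    u ^ 4 * Invariantsℚ.c₄ W                  ∎
    where open ≡-Reasoning

  Δ-ι-scaled : ∀ M u W → mapWeierstrass ι M ≡ scaled u W →
      ι (Invariantsℤ.Δ M) ≡ u ^ 12 * Invariantsℚ.Δ W
  Δ-ι-scaled M u W eq = begin
    ι (Invariantsℤ.Δ M)                       ≡⟨ Δ-ι M ⟨
    Invariantsℚ.Δ (mapWeierstrass ι M)        ≡⟨ cong Invariantsℚ.Δ eq ⟩
    Invariantsℚ.Δ (scaled u W)                ≡⟨ Identitiesℚ.Δ-scaled u W ⟩
    u ^ 12 * Invariantsℚ.Δ W                  ∎
    where open ≡-Reasoning

  Δ≢0-ι-scaled : ∀ M u W → mapWeierstrass ι M ≡ scaled u W → u ≢ 0ℚ →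
                 Invariantsℚ.Δ W ≢ 0ℚ → Invariantsℤ.Δ M ≢ + 0
  Δ≢0-ι-scaled M u W eq u≢0 Δ≢0 ΔM≡0 =
    *-≢0 (^-≢0 12 u≢0) Δ≢0 (trans (sym (Δ-ι-scaled M u W eq)) (cong ι ΔM≡0))

  sameJ : ∀ (cW ΔW cV ΔV : ℤ) (d e v c D : ℚ) →
    ι cW ≡ d ^ 4 * c → ι ΔW ≡ d ^ 12 * D → ι cV ≡ e ^ 4 * (v ^ 4 * c) →
        ι ΔV ≡ e ^ 12 * (v ^ 12 * D) →
    cW ℤ.* cW ℤ.* cW ℤ.* ΔV ≡ ΔW ℤ.* (cV ℤ.* cV ℤ.* cV)
  sameJ cW ΔW cV ΔV d e v c D cW≡ ΔW≡ cV≡ ΔV≡ =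
      ι-injective {cW ℤ.* cW ℤ.* cW ℤ.* ΔV} {ΔW ℤ.* (cV ℤ.* cV ℤ.* cV)} (begin
      ι (cW ℤ.* cW ℤ.* cW ℤ.* ΔV)
        ≡⟨ trans (ι-homo-* (cW ℤ.* cW ℤ.* cW) ΔV) (cong (_* ι ΔV) (ι-cube cW)) ⟩
      ι cW * ι cW * ι cW * ι ΔV
        ≡⟨ cong₂ (λ c D → c * c * c * D) cW≡ ΔV≡ ⟩
      d ^ 4 * c * (d ^ 4 * c) * (d ^ 4 * c) * (e ^ 12 * (v ^ 12 * D))
        ≡⟨ Identitiesℚ.cube-^ d e v c D ⟩
      d ^ 12 * D * (e ^ 4 * (v ^ 4 * c) * (e ^ 4 * (v ^ 4 * c)) * (e ^ 4 * (v ^ 4 * c)))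
        ≡⟨ cong₂ (λ D c → D * (c * c * c)) ΔW≡ cV≡ ⟨
      ι ΔW * (ι cV * ι cV * ι cV)
        ≡⟨ trans (ι-homo-* ΔW (cV ℤ.* cV ℤ.* cV)) (cong (ι ΔW *_) (ι-cube cV)) ⟨
      ι (ΔW ℤ.* (cV ℤ.* cV ℤ.* cV)) ∎)
    where
    open ≡-Reasoning
    ι-cube : ∀ i → ι (i ℤ.* i ℤ.* i) ≡ ι i * ι i * ι i
    ι-cube i = trans (ι-homo-* (i ℤ.* i) i) (cong (_* ι i) (ι-homo-* i i))

  record SameJ (W V : Weierstrass ℤ) : Set where
    constructor mkSameJ
    field
      c₄³Δ : let open Invariantsℤ in c₄ W ℤ.* c₄ W ℤ.* c₄ W ℤ.* Δ V ≡ Δ W ℤ.*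
          (c₄ V ℤ.* c₄ V ℤ.* c₄ V)

  ↥-↧-coprime : ∀ t → Coprimality.Coprime ∣ ↥ t ∣ (↧ₙ t)
  ↥-↧-coprime (ℚ.mkℚ n d-1 c) = Coprimality.recompute c

  sameJ-twist : ∀ M W V d r s t v e → mapWeierstrass ι M ≡ scaled d W →
                mapWeierstrass ι V ≡ scaled e (scaled v (translated r s t W)) → SameJ M V
  sameJ-twist M W V d r s t v e M≡ V≡ = mkSameJ
    (sameJ (Invariantsℤ.c₄ M) (Invariantsℤ.Δ M) (Invariantsℤ.c₄ V) (Invariantsℤ.Δ V) d e v c D
      (c₄-ι-scaled M d W M≡) (Δ-ι-scaled M d W M≡) cV ΔV)
    where
    open ≡-Reasoning
    W₀ : Weierstrass ℚ
    W₀ = translated r s t W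
    c D : ℚ
    c = Invariantsℚ.c₄ W
    D = Invariantsℚ.Δ W
    cV : ι (Invariantsℤ.c₄ V) ≡ e ^ 4 * (v ^ 4 * c)
    cV = begin
        ι (Invariantsℤ.c₄ V)                      ≡⟨ c₄-ι-scaled V e (scaled v W₀) V≡ ⟩
        e ^ 4 * Invariantsℚ.c₄ (scaled v W₀)      ≡⟨ cong (e ^ 4 *_) (Identitiesℚ.c₄-scaled v W₀) ⟩
        e ^ 4 * (v ^ 4 * Invariantsℚ.c₄ W₀)
            ≡⟨ cong (λ c → e ^ 4 * (v ^ 4 * c)) (Identitiesℚ.c₄-translated r s t W) ⟩
        e ^ 4 * (v ^ 4 * c)                       ∎
    ΔV : ι (Invariantsℤ.Δ V) ≡ e ^ 12 * (v ^ 12 * D)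
    ΔV = begin
        ι (Invariantsℤ.Δ V)                       ≡⟨ Δ-ι-scaled V e (scaled v W₀) V≡ ⟩
        e ^ 12 * Invariantsℚ.Δ (scaled v W₀)      ≡⟨ cong (e ^ 12 *_) (Identitiesℚ.Δ-scaled v W₀) ⟩
        e ^ 12 * (v ^ 12 * Invariantsℚ.Δ W₀)
            ≡⟨ cong (λ D → e ^ 12 * (v ^ 12 * D)) (Identitiesℚ.Δ-translated r s t W) ⟩
        e ^ 12 * (v ^ 12 * D)                     ∎

  -- x and x - y are numerator and denominator of t, whence the pair in `coprime`. Off x = y, the
  -- condition on `B` excludes the other rational cusps, where x, y or x + y vanishes.
  record FamilyMember (W : Weierstrass ℚ) : Set where
    field
      x y       : ℤ
      coprime   : ∀ {d} → d ∣ ∣ x ∣ → d ∣ ∣ x ℤ.- y ∣ → d ≡ 1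
      B≢0       : Familyℤ.B x y ≢ + 0
      x≢y       : x ≢ y
      r s w v u : ℚ
      curve≡    : mapWeierstrass ι (Familyℤ.curve x y) ≡ scaled u (scaled v (translated r s w W))

  chain⇒family : ∀ W r s w → let W₀ = translated r s w W in a₄ W₀ ≡ 0ℚ → a₆ W₀ ≡ 0ℚ →
    ∀ v b → TateForm (v * a₁ W₀) b →
    scaled v (weierstrass (a₁ W₀) (a₂ W₀) (a₃ W₀) 0ℚ 0ℚ) ≡ weierstrass (v * a₁ W₀) (- b) (- b) 0ℚ
        0ℚ →
    FamilyMember W
  chain⇒family W r s w a₄≡0 a₆≡0 v b T scaled≡ = record
    { x = x ; y = y ; coprime = coprime ; B≢0 = B≢0 ; x≢y =
        x≢y ; r = r ; s = s ; w = w ; v = v ; u = e ; curve≡ = curve≡ }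
    where
    open ≡-Reasoning
    open TateForm T using (t; t≢0; b≢0)
    W₀ : Weierstrass ℚ
    W₀ = translated r s w W
    q e : ℚ
    q = ι (+ ↧ₙ t)
    e = Familyℚ.e (t * q) (t * q - q)
    x y : ℤ
    x = ↥ t
    y = x ℤ.- + ↧ₙ t
    ιx≡ : ι x ≡ t * q
    ιx≡ = trans (sym (ι-↧* t)) (ℚₚ.*-comm q t)
    ιy≡ : ι y ≡ t * q - q
    ιy≡ = trans (ι-homo-+ x (ℤ.- + ↧ₙ t)) (cong₂ _+_ ιx≡ (ι-homo-neg (+ ↧ₙ t)))
    scaledW₀≡ : scaled v W₀ ≡ weierstrass (v * a₁ W₀) (- b) (- b) 0ℚ 0ℚ
    scaledW₀≡ = trans (cong (scaled v) (weierstrass-cong refl refl refl a₄≡0 a₆≡0)) scaled≡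
    curve≡ : mapWeierstrass ι (Familyℤ.curve x y) ≡ scaled e (scaled v W₀)
    curve≡ = begin
      mapWeierstrass ι (Familyℤ.curve x y)      ≡⟨ curve-ι x y ⟩
      Familyℚ.curve (ι x) (ι y)                 ≡⟨ cong₂ Familyℚ.curve ιx≡ ιy≡ ⟩
      Familyℚ.curve (t * q) (t * q - q)         ≡⟨ tateForm⇒family T q ⟨
      scaled e (weierstrass (v * a₁ W₀) (- b) (- b) 0ℚ 0ℚ) ≡⟨ cong (scaled e) scaledW₀≡ ⟨
      scaled e (scaled v W₀)                    ∎
    x-y≡ : x ℤ.- y ≡ + ↧ₙ t
    x-y≡ = trans (cong (λ z → x ℤ.+ z) (ℤₚ.neg-distrib-+ x (ℤ.- + ↧ₙ t)))
        (trans (sym (ℤₚ.+-assoc x (ℤ.- x) (ℤ.- (ℤ.- + ↧ₙ t))))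
      (trans (cong₂ ℤ._+_ (ℤₚ.+-inverseʳ x) (ℤₚ.neg-involutive (+ ↧ₙ t)))
          (ℤₚ.+-identityˡ (+ ↧ₙ t))))
    coprime : ∀ {d} → d ∣ ∣ x ∣ → d ∣ ∣ x ℤ.- y ∣ → d ≡ 1
    coprime {d} d∣x d∣x-y = ↥-↧-coprime t (d∣x , subst (λ z → d ∣ ∣ z ∣) x-y≡ d∣x-y)
    x≢y : x ≢ y
    x≢y x≡y with () ← trans (sym x-y≡) (ℤₚ.i≡j⇒i-j≡0 x≡y)
    q≢0 : q ≢ 0ℚ
    q≢0 eq with () ← ι-injective {+ ↧ₙ t} {+ 0} eq
    e≢0 : e ≢ 0ℚ
    e≢0 = *-≢0 (*-≢0 (*-≢0 tq≢0 tq≢0) tq≢0) (λ eq →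
        q≢0 (trans (solve 2 (λ u q → q := u :- (u :- q)) refl (t * q) q) eq))
      where
      tq≢0 : t * q ≢ 0ℚ
      tq≢0 = *-≢0 t≢0 q≢0
    B≢0 : Familyℤ.B x y ≢ + 0
    B≢0 B≡0 = *-≢0 (^-≢0 2 e≢0)
        (λ -b≡0 → b≢0 (trans (solve 1 (λ b → b := :- (:- b)) refl b) (cong -_ -b≡0)))
      (begin
        e ^ 2 * (- b)          ≡⟨ cong a₂ (tateForm⇒family T q) ⟩
        a₂ (Familyℚ.curve (t * q) (t * q - q)) ≡⟨ cong₂ (λ x y → a₂ (Familyℚ.curve x y)) ιx≡ ιy≡ ⟨
        a₂ (Familyℚ.curve (ι x) (ι y)) ≡⟨ cong a₂ (curve-ι x y) ⟨
        ι (Familyℤ.B x y)      ≡⟨ cong ι B≡0 ⟩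
        0ℚ                     ∎)

  order12⇒family : ∀ W P → HasOrder (GroupLaw.rawMonoid W) P 12 → FamilyMember W
  order12⇒family W P ord =
    let r , s , w , a₄≡0 , a₆≡0 , ch = order12⇒chain W P ord
        v , b , T , scaled≡ = chain⇒tateForm ch
    in chain⇒family W r s w a₄≡0 a₆≡0 v b T scaled≡

-- Primes of bad reduction

module _ where
  open ≡ using (refl; sym; trans; cong; cong₂; subst; subst₂)
  open ℤ using (_+_; _*_; -_)
  open import Data.Nat.Base using (_<_)
  open Signed
  open Invariantsℤ using (c₄; Δ)
  open Substitutionℤ using (scaled; _^_)
  open FamilyIdentitiesℤ

  prime-∣* : ∀ {p} → Prime p → ∀ a b → + p ∣ a * b → + p ∣ a ⊎ + p ∣ b
  prime-∣* {p} pp a b p∣ab = Sum.map ∣ᵤ⇒∣ ∣ᵤ⇒∣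
    (euclidsLemma ℤ.∣ a ∣ ℤ.∣ b ∣ pp (subst (p ℕ.∣_) (ℤₚ.abs-* a b) (∣⇒∣ᵤ p∣ab)))

  module _ {p : ℕ} (pp : Prime p) where

    ∤-* : ∀ a b → ¬ + p ∣ a → ¬ + p ∣ b → ¬ + p ∣ a * b
    ∤-* a b p∤a p∤b p∣ab = [ p∤a , p∤b ]′ (prime-∣* pp a b p∣ab)

    ∤-neg : ∀ a → ¬ + p ∣ a → ¬ + p ∣ - a
    ∤-neg a p∤a p∣-a = p∤a (subst (+ p ∣_) (ℤₚ.neg-involutive a) (∣m⇒∣-m p∣-a))

    ∤-^4 : ∀ a → ¬ + p ∣ a → ¬ + p ∣ a * a * a * a
    ∤-^4 a p∤a = ∤-* (a * a * a) a (∤-* (a * a) a (∤-* a a p∤a p∤a) p∤a) p∤a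

    ∤-+ : ∀ a b c → ¬ + p ∣ a → + p ∣ b → ¬ + p ∣ a + b * c
    ∤-+ a b c p∤a p∣b p∣a+bc = p∤a (∣m+n∣n⇒∣m p∣a+bc (∣m⇒∣m*n c p∣b))

  notPotentiallyGood : ∀ {p} → Prime p → ∀ V → + p ∣ Δ V → ¬ + p ∣ c₄ V → ¬ PotentiallyGood p V
  notPotentiallyGood {p} pp V p∣Δ p∤c₄ g =
    ∤-* pp m (c₄ V * c₄ V * c₄ V) (p∤m ∘ ∣⇒∣ᵤ)
        (∤-* pp (c₄ V * c₄ V) (c₄ V) (∤-* pp (c₄ V) (c₄ V) p∤c₄ p∤c₄) p∤c₄)
      (subst (+ p ∣_) (sym m*c₄³) (∣n⇒∣m*n k p∣Δ))
    where open PotentiallyGood g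

  *-cancelˡ-≢0 : ∀ i j k → i ≢ +0 → i * j ≡ i * k → j ≡ k
  *-cancelˡ-≢0 i j k i≢0 eq = ℤₚ.*-cancelˡ-≡ i j k {{ℤ.≢-nonZero i≢0}} eq

  -- Multiplied by `DM`, both sides become k DM DV.
  transfer : ∀ (cM DM cV DV m k : ℤ) → DM ≢ +0 → cM * cM * cM * DV ≡ DM * (cV * cV * cV) →
             m * (cM * cM * cM) ≡ k * DM → m * (cV * cV * cV) ≡ k * DV
  transfer cM DM cV DV m k DM≢0 same good = *-cancelˡ-≢0 DM (m * (cV * cV * cV)) (k * DV) DM≢0
      (begin
    DM * (m * (cV * cV * cV))      ≡⟨ swap DM m (cV * cV * cV) ⟩
    m * (DM * (cV * cV * cV))      ≡⟨ cong (m *_) same ⟨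
    m * (cM * cM * cM * DV)        ≡⟨ ℤₚ.*-assoc m (cM * cM * cM) DV ⟨
    m * (cM * cM * cM) * DV        ≡⟨ cong (_* DV) good ⟩
    k * DM * DV                    ≡⟨ trans (cong (_* DV) (ℤₚ.*-comm k DM)) (ℤₚ.*-assoc DM k DV) ⟩
    DM * (k * DV)                  ∎)
    where
    open ≡-Reasoning
    swap : ∀ a b c → a * (b * c) ≡ b * (a * c)
    swap a b c = trans (sym (ℤₚ.*-assoc a b c))
        (trans (cong (_* c) (ℤₚ.*-comm a b)) (ℤₚ.*-assoc b a c))

  potentiallyGood-sameJ : ∀ {p} M V → Δ M ≢ +0 → SameJ M V → PotentiallyGood p M →
      PotentiallyGood p V
  potentiallyGood-sameJ M V ΔM≢0 (mkSameJ same) g = record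
    { m = m ; k = k ; p∤m = p∤m ; m*c₄³ = transfer (c₄ M) (Δ M) (c₄ V) (Δ V) m k ΔM≢0 same m*c₄³ }
    where open PotentiallyGood g

  i^n≢0 : ∀ i n → i ≢ +0 → i ^ n ≢ +0
  i^n≢0 i zero    i≢0 ()
  i^n≢0 i (suc n) i≢0 eq = [ i≢0 , i^n≢0 i n i≢0 ]′ (ℤₚ.i*j≡0⇒i≡0∨j≡0 i eq)

  potentiallyGood-unscaled : ∀ {p} u V → u ≢ +0 → PotentiallyGood p (scaled u V) →
      PotentiallyGood p V
  potentiallyGood-unscaled u V u≢0 g = record
    { m = m ; k = k ; p∤m = p∤m
    ; m*c₄³ = *-cancelˡ-≢0 (u ^ 12) (m * (c₄ V * c₄ V * c₄ V)) (k * Δ V) (i^n≢0 u 12 u≢0)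
                (Identitiesℤ.c₄³∣Δ-unscaled m k u V m*c₄³) }
    where open PotentiallyGood g

  module _ {p : ℕ} (pp : Prime p) (A B e : ℤ) where
    private
      V : Weierstrass ℤ
      V = weierstrass A B (B * e) +0 +0

    bad-B : + p ∣ B → ¬ + p ∣ A → ¬ PotentiallyGood p V
    bad-B p∣B p∤A = notPotentiallyGood pp V
      (subst (+ p ∣_) (sym (FamilyIdentitiesℤ.Δ-factored A B e)) (∣m⇒∣m*n _ (∣m⇒∣m*n e p∣B)))
      (subst (λ z → ¬ + p ∣ z) (sym (FamilyIdentitiesℤ.c₄-mod-B A B e))
          (∤-+ pp (A * A * A * A) B _ (∤-^4 pp A p∤A) p∣B))

  -- Unlike in `bad-B`, the prime may divide `e` instead of `B`: all terms of c₄ other than A⁴ have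
  -- even coefficients.
  bad-2 : Prime 2 → ∀ A B e → + 2 ∣ B * e → ¬ + 2 ∣ A →
      ¬ PotentiallyGood 2 (weierstrass A B (B * e) +0 +0)
  bad-2 pp A B e 2∣Be 2∤A = notPotentiallyGood pp (weierstrass A B (B * e) +0 +0)
      (subst (+ 2 ∣_) (sym (FamilyIdentitiesℤ.Δ-factored A B e)) (∣m⇒∣m*n _ 2∣Be))
      (subst (λ z → ¬ + 2 ∣ z) (sym (FamilyIdentitiesℤ.c₄-mod-2 A B e))
          (∤-+ pp (A * A * A * A) (+ 2) _ (∤-^4 pp A 2∤A) ∣-refl))

  -- Here 3 divides c₄, so `notPotentiallyGood` does not apply. But c₄³ contains 3 exactly to the
  -- power 6 and Δ at least to the power 7, so j still has a pole at 3.
  3∤⇒bad-3 : Prime 3 → ∀ A B e → ¬ + 3 ∣ B →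
             ¬ PotentiallyGood 3 (weierstrass (+ 3 * A) (+ 3 * B) (+ 3 * B * (+ 3 * e)) +0 +0)
  3∤⇒bad-3 pp A B e 3∤B g = conclude _ _ (FamilyIdentitiesℤ.c₄-tripled A B e)
      (FamilyIdentitiesℤ.Δ-tripled A B e)
    (∤-+ pp (+ 16 * B * B) (+ 3) _ (∤-* pp (+ 16 * B) B (∤-* pp (+ 16) B (λ d → 3∤16 (∣⇒∣ᵤ d)) 3∤B)
        3∤B) ∣-refl)
    where
    open PotentiallyGood g
    V : Weierstrass ℤ
    V = weierstrass (+ 3 * A) (+ 3 * B) (+ 3 * B * (+ 3 * e)) +0 +0
    3∤16 : ¬ 3 ℕ.∣ 16
    3∤16 = from-no (3 ℕ.∣? 16)
    conclude : ∀ c D → c₄ V ≡ + 9 * c → Δ V ≡ + 2187 * D → ¬ + 3 ∣ c → ⊥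
    conclude c D c≡ D≡ 3∤c = ∤-* pp m (c * c * c) (p∤m ∘ ∣⇒∣ᵤ)
        (∤-* pp (c * c) c (∤-* pp c c 3∤c 3∤c) 3∤c)
      (subst (+ 3 ∣_) (sym
          (ℤₚ.i-j≡0⇒i≡j (m * (c * c * c)) (+ 3 * (k * D))
              (*-cancelˡ-≢0 (+ 729) (m * (c * c * c) + - (+ 3 * (k * D))) +0 (λ ()) eq)))
        (∣m⇒∣m*n (k * D) ∣-refl))
      where
      open ≡-Reasoning
      eq : + 729 * (m * (c * c * c) + - (+ 3 * (k * D))) ≡ + 729 * +0
      eq = begin
        + 729 * (m * (c * c * c) + - (+ 3 * (k * D)))
            ≡⟨ FamilyIdentitiesℤ.cancel-3⁶ m c k D ⟨
        m * (+ 9 * c * (+ 9 * c) * (+ 9 * c)) + - (k * (+ 2187 * D))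
          ≡⟨ ℤₚ.i≡j⇒i-j≡0 (subst₂ (λ c D → m * (c * c * c) ≡ k * D) c≡ D≡ m*c₄³) ⟩
        +0                                                   ≡⟨ ℤₚ.*-zeroʳ (+ 729) ⟨
        + 729 * +0                                           ∎

  prime-2 : Prime 2
  prime-2 = from-yes (prime? 2)

  prime-3 : Prime 3
  prime-3 = from-yes (prime? 3)

  2∤⇒odd : ∀ i → ¬ + 2 ∣ i → ∃ λ q → i ≡ + 1 + q * + 2
  2∤⇒odd i 2∤i = q , by-cases (i ℤ.%ℕ 2) (n%ℕd<d i 2) (a≡a%ℕn+[a/ℕn]*n i 2)
    where
    q : ℤ
    q = i ℤ./ℕ 2
    by-cases : ∀ r → r ℕ.< 2 → i ≡ + r + q * + 2 → i ≡ + 1 + q * + 2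
    by-cases 0 _ eq = contradiction (divides q (trans eq (ℤₚ.+-identityˡ (q * + 2)))) 2∤i
    by-cases 1 _ eq = eq
    by-cases (suc (suc r)) (s≤s (s≤s ())) _

  odd-odd : ∀ i j → ¬ + 2 ∣ i → ¬ + 2 ∣ j → ∃ λ w → i ≡ j + + 2 * w
  odd-odd i j 2∤i 2∤j with q , refl ← 2∤⇒odd i 2∤i | q′ , refl ← 2∤⇒odd j 2∤j =
    q + - q′ , difference q q′
    where
    difference : ∀ q q′ → + 1 + q * + 2 ≡ + 1 + q′ * + 2 + + 2 * (q + - q′)
    difference q q′ = Identitiesℤ.solve 2 (λ q q′ → con (+ 1) :+ q :* con (+ 2) :=
        con (+ 1) :+ q′ :* con (+ 2) :+ con (+ 2) :* (q :+ :- q′)) refl q q′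
      where open Identitiesℤ

  mod-3 : ∀ i → ¬ + 3 ∣ i → (∃ λ q → i ≡ + 1 + q * + 3) ⊎ (∃ λ q → i ≡ + 2 + q * + 3)
  mod-3 i 3∤i = by-cases (i ℤ.%ℕ 3) (n%ℕd<d i 3) (a≡a%ℕn+[a/ℕn]*n i 3)
    where
    q : ℤ
    q = i ℤ./ℕ 3
    by-cases : ∀ r → r ℕ.< 3 → i ≡ + r + q * + 3 →
        (∃ λ q → i ≡ + 1 + q * + 3) ⊎ (∃ λ q → i ≡ + 2 + q * + 3)
    by-cases 0 _ eq = contradiction (divides q (trans eq (ℤₚ.+-identityˡ (q * + 3)))) 3∤i
    by-cases 1 _ eq = inj₁ (q , eq)
    by-cases 2 _ eq = inj₂ (q , eq)
    by-cases (suc (suc (suc r))) (s≤s (s≤s (s≤s ()))) _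

  plus-minus-mod-3 : ∀ i j → ¬ + 3 ∣ i → ¬ + 3 ∣ j → + 3 ∣ i + j ⊎ (∃ λ w → i ≡ j + + 3 * w)
  plus-minus-mod-3 i j 3∤i 3∤j with mod-3 i 3∤i | mod-3 j 3∤j
  ... | inj₁ (q , refl) | inj₁ (q′ , refl) = inj₂ (q + - q′ ,
    (let open Identitiesℤ in solve 2 (λ q q′ → con (+ 1) :+ q :* con (+ 3) :=
        con (+ 1) :+ q′ :* con (+ 3) :+ con (+ 3) :* (q :+ :- q′)) refl q q′))
  ... | inj₂ (q , refl) | inj₂ (q′ , refl) = inj₂ (q + - q′ ,
    (let open Identitiesℤ in solve 2 (λ q q′ → con (+ 2) :+ q :* con (+ 3) :=
        con (+ 2) :+ q′ :* con (+ 3) :+ con (+ 3) :* (q :+ :- q′)) refl q q′))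
  ... | inj₁ (q , refl) | inj₂ (q′ , refl) = inj₁ (divides (+ 1 + (q + q′))
    (let open Identitiesℤ in solve 2 (λ q q′ →
        con (+ 1) :+ q :* con (+ 3) :+ (con (+ 2) :+ q′ :* con (+ 3)) :=
            (con (+ 1) :+ (q :+ q′)) :* con (+ 3)) refl q q′))
  ... | inj₂ (q , refl) | inj₁ (q′ , refl) = inj₁ (divides (+ 1 + (q + q′))
    (let open Identitiesℤ in solve 2 (λ q q′ →
        con (+ 2) :+ q :* con (+ 3) :+ (con (+ 1) :+ q′ :* con (+ 3)) :=
            (con (+ 1) :+ (q :+ q′)) :* con (+ 3)) refl q q′))

  ∣-cong : ∀ {d a b} → a ≡ b → d ∣ b → d ∣ a
  ∣-cong {d} eq = subst (d ∣_) (sym eq)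

  ∤-cong : ∀ {d a b} → a ≡ b → ¬ d ∣ b → ¬ d ∣ a
  ∤-cong {d} eq = subst (λ z → ¬ d ∣ z) (sym eq)

  module _ (x y : ℤ) (coprime : ∀ {p} → Prime p → + p ∣ x → ¬ + p ∣ y) where
    open Familyℤ x y

    module _ {p : ℕ} (pp : Prime p) where

      bad-x : + p ∣ x → ¬ PotentiallyGood p curve
      bad-x p∣x = bad-B pp A B e (∣-cong (B-div-x x y) (∣m⇒∣m*n _ p∣x))
        (∤-cong (A-mod-x x y)
            (∤-+ pp (- (y * y * y * y)) x _ (∤-neg pp (y * y * y * y) (∤-^4 pp y (coprime pp p∣x)))
                p∣x))

      bad-y : + p ∣ y → ¬ PotentiallyGood p curve
      bad-y p∣y = bad-B pp A B e (∣-cong (B-div-y x y) (∣m⇒∣m*n _ p∣y))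
        (∤-cong (A-mod-y x y) (∤-+ pp (x * x * x * x) y _ (∤-^4 pp x (λ p∣x → coprime pp p∣x p∣y))
            p∣y))

      module _ (p∤2 : ¬ + p ∣ + 2) where

        bad-x+y : + p ∣ x + y → ¬ PotentiallyGood p curve
        bad-x+y p∣x+y = bad-B pp A B e (∣-cong (B-div-x+y x y) (∣m⇒∣m*n _ p∣x+y))
          (∤-cong (A-mod-x+y x y) (∤-+ pp (+ 2 * (x * x * x * x)) (x + y) _
            (∤-* pp (+ 2) (x * x * x * x) p∤2
                (∤-^4 pp x λ p∣x → coprime pp p∣x (∣m+n∣m⇒∣n p∣x+y p∣x))) p∣x+y))

        bad-Q₂ : + p ∣ Q₂ → ¬ PotentiallyGood p curve
        bad-Q₂ p∣Q₂ = bad-B pp A B e (∣-cong (B-div-Q₂ x y) (∣m⇒∣m*n _ p∣Q₂))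
          (∤-cong (A-mod-Q₂ x y) (∤-+ pp (+ 2 * (x * x * x * x)) Q₂ _
            (∤-* pp (+ 2) (x * x * x * x) p∤2 (∤-^4 pp x λ p∣x →
              ∤-* pp y y (coprime pp p∣x) (coprime pp p∣x) (∣m+n∣m⇒∣n p∣Q₂ (∣m⇒∣m*n x p∣x)))) p∣Q₂))

    2∤3 : ¬ + 2 ∣ + 3
    2∤3 = from-no (2 ℕ.∣? 3) ∘ ∣⇒∣ᵤ

    bad-at-2 : ¬ PotentiallyGood 2 curve
    bad-at-2 with + 2 ∣? x | + 2 ∣? y
    ... | yes 2∣x | _       = bad-x prime-2 2∣x
    ... | no  _   | yes 2∣y = bad-y prime-2 2∣y
    ... | no  2∤x | no  2∤y with w , x≡ ← odd-odd x y 2∤x 2∤y =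
      halved-bad w x≡ (+ 2 ∣? w) ∘ potentiallyGood-unscaled (+ 2) (Halvedℤ.curve y w)
          (λ ()) ∘ subst (PotentiallyGood 2) (curve≡ w x≡)
      where
      curve≡ : ∀ w → x ≡ Halvedℤ.x y w → curve ≡ scaled (+ 2) (Halvedℤ.curve y w)
      curve≡ w refl = weierstrass-cong (halved-A y w) (halved-B y w) (halved-C y w) refl refl
      -- If w is even, so is `e`; if w is odd, then y + w is an even factor of `B`. In both cases
      -- `A` is odd.
      halved-bad : ∀ w → x ≡ Halvedℤ.x y w → Dec (+ 2 ∣ w) → ¬ PotentiallyGood 2 (Halvedℤ.curve y w)
      halved-bad w x≡ (yes 2∣w) = bad-2 prime-2 (Halvedℤ.A y w) (Halvedℤ.B y w) (Halvedℤ.e y w)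
        (∣n⇒∣m*n (Halvedℤ.B y w) (let x′ = Halvedℤ.x y w in ∣n⇒∣m*n (x′ * x′ * x′) 2∣w))
        (∤-cong (halved-A-mod-w y w) (∤-+ prime-2 (- (+ 3 * (y * y * y * y))) w _
          (∤-neg prime-2 (+ 3 * (y * y * y * y))
              (∤-* prime-2 (+ 3) (y * y * y * y) 2∤3 (∤-^4 prime-2 y 2∤y))) 2∣w))
      halved-bad w refl (no 2∤w) = bad-2 prime-2 (Halvedℤ.A y w) (Halvedℤ.B y w) (Halvedℤ.e y w)
        (∣m⇒∣m*n (Halvedℤ.e y w) (∣m⇒∣m*n _ 2∣y+w))
        (∤-+ prime-2 (Halvedℤ.e y w) (y + w) _
            (∤-* prime-2 (x * x * x) w (∤-* prime-2 (x * x) x (∤-* prime-2 x x 2∤x 2∤x) 2∤x) 2∤w)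
                2∣y+w)
        where
        2∣y+w : + 2 ∣ y + w
        2∣y+w with k , y≡ ← odd-odd y w 2∤y 2∤w = ∣-cong (cong (_+ w) y≡)
          (∣-cong {b = + 2 * (w + k)} (let open Identitiesℤ in
              solve 2 (λ w k → w :+ con (+ 2) :* k :+ w := con (+ 2) :* (w :+ k)) refl w k)
            (∣m⇒∣m*n (w + k) ∣-refl))

    3∤2 : ¬ + 3 ∣ + 2
    3∤2 = from-no (3 ℕ.∣? 2) ∘ ∣⇒∣ᵤ

    bad-at-3 : ¬ PotentiallyGood 3 curve
    bad-at-3 with + 3 ∣? x | + 3 ∣? y
    ... | yes 3∣x | _       = bad-x prime-3 3∣x
    ... | no  _   | yes 3∣y = bad-y prime-3 3∣y
    ... | no  3∤x | no  3∤y with plus-minus-mod-3 x y 3∤x 3∤y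
    ...   | inj₁ 3∣x+y    = bad-x+y prime-3 3∤2 3∣x+y
    ...   | inj₂ (w , x≡) = thirded-bad w x≡
      where
      -- With x ≡ y modulo 3, the factors x + y, Q₂ and Q₃ / 3 are congruent to 2 y, 2 y² and y², so
      -- the reduced `B` is a unit at 3.
      thirded-bad : ∀ w → x ≡ Thirdedℤ.x y w → ¬ PotentiallyGood 3 curve
      thirded-bad w refl = 3∤⇒bad-3 prime-3 T.A T.B T.e 3∤B ∘ subst (PotentiallyGood 3) curve≡
        where
        module T = Thirdedℤ y w
        curve≡ : curve ≡ weierstrass (+ 3 * T.A) (+ 3 * T.B) (+ 3 * T.B * (+ 3 * T.e)) +0 +0
        curve≡ = weierstrass-cong (thirded-A y w) (thirded-B y w)
            (cong₂ _*_ (thirded-B y w) (thirded-e y w)) refl refl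
        3∤yy : ¬ + 3 ∣ y * y
        3∤yy = ∤-* prime-3 y y 3∤y 3∤y
        3∤x+y : ¬ + 3 ∣ x + y
        3∤x+y = ∤-cong (thirded-x+y y w)
            (∤-+ prime-3 (+ 2 * y) (+ 3) w (∤-* prime-3 (+ 2) y 3∤2 3∤y) ∣-refl)
        3∤Q₂ : ¬ + 3 ∣ Q₂
        3∤Q₂ = ∤-cong (thirded-Q₂ y w)
            (∤-+ prime-3 (+ 2 * (y * y)) (+ 3) _ (∤-* prime-3 (+ 2) (y * y) 3∤2 3∤yy) ∣-refl)
        3∤Q₃/3 : ¬ + 3 ∣ T.Q₃/3
        3∤Q₃/3 = ∤-+ prime-3 (y * y) (+ 3) _ 3∤yy ∣-refl
        3∤B : ¬ + 3 ∣ T.B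
        3∤B = ∤-neg prime-3 (x * x * y * (x + y) * T.Q₃/3 * Q₂)
          (∤-* prime-3 (x * x * y * (x + y) * T.Q₃/3) Q₂
          (∤-* prime-3 (x * x * y * (x + y)) T.Q₃/3
          (∤-* prime-3 (x * x * y) (x + y) (∤-* prime-3 (x * x) y (∤-* prime-3 x x 3∤x 3∤x) 3∤y)
              3∤x+y) 3∤Q₃/3) 3∤Q₂)

  -- Prime factors of the conductor

  prime-factor : ∀ n → 1 ℕ.< n → ∃ λ p → Prime p × p ℕ.∣ n
  prime-factor n 1<n = from-factors (factorise n {{ℕ.>-nonZero (ℕₚ.<-trans (s≤s z≤n) 1<n)}})
    where
    open PrimeFactorisation
    from-factors : PrimeFactorisation n → ∃ λ p → Prime p × p ℕ.∣ n
    from-factors f with factors f | isFactorisation f | factorsPrime f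
    ... | []     | n≡1 | []       = contradiction (sym n≡1) (ℕₚ.<⇒≢ 1<n)
    ... | p ∷ ps | n≡  | pp ∷ _   = p , pp , subst (p ℕ.∣_) (sym n≡) (ℕ.m∣m*n _)

  prime-∣-^ : ∀ {p} → Prime p → ∀ n k → p ℕ.∣ n ℕ.^ k → p ℕ.∣ n
  prime-∣-^ pp n zero    p∣1 = contradiction (subst Prime (ℕ.∣1⇒≡1 p∣1) pp) ¬prime[1]
  prime-∣-^ pp n (suc k) p∣n^1+k = [ id , prime-∣-^ pp n k ]′ (euclidsLemma n (n ℕ.^ k) pp p∣n^1+k)

  prime-∣-prime : ∀ {p q} → Prime p → Prime q → p ℕ.∣ q → p ≡ q
  prime-∣-prime pp pq p∣q = [ (λ p≡1 → contradiction (subst Prime p≡1 pp) ¬prime[1]) , id ]′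
      (prime⇒irreducible pq p∣q)

  prime-∣-^*^ : ∀ {ℓ p q} → Prime ℓ → Prime p → Prime q → ∀ α β →
                ℓ ℕ.∣ p ℕ.^ α ℕ.* q ℕ.^ β → ℓ ≡ p ⊎ ℓ ≡ q
  prime-∣-^*^ {ℓ} {p} {q} pℓ pp pq α β ℓ∣ =
    Sum.map (prime-∣-prime pℓ pp ∘ prime-∣-^ pℓ p α) (prime-∣-prime pℓ pq ∘ prime-∣-^ pℓ q β)
      (euclidsLemma (p ℕ.^ α) (q ℕ.^ β) pℓ ℓ∣)

  i*i≡ : ∀ i → i * i ≡ + (ℤ.∣ i ∣ ℕ.* ℤ.∣ i ∣)
  i*i≡ (+ n)      = sym (ℤₚ.pos-* n n)
  i*i≡ ℤ.-[1+ n ] = refl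

  ∣i∣≡∣j∣⇒i≡±j : ∀ i j → ℤ.∣ i ∣ ≡ ℤ.∣ j ∣ → i ≡ j ⊎ i ≡ - j
  ∣i∣≡∣j∣⇒i≡±j (+ m)      (+ n)      eq   = inj₁ (cong +_ eq)
  ∣i∣≡∣j∣⇒i≡±j (+ _)      ℤ.-[1+ n ] refl = inj₂ refl
  ∣i∣≡∣j∣⇒i≡±j ℤ.-[1+ m ] (+ _)      refl = inj₂ refl
  ∣i∣≡∣j∣⇒i≡±j ℤ.-[1+ m ] ℤ.-[1+ n ] eq   = inj₁ (cong ℤ.-[1+_] (ℕₚ.suc-injective eq))

  2<m²+n² : ∀ m n → m ≢ 0 → n ≢ 0 → m ≢ n → 2 < m ℕ.* m ℕ.+ n ℕ.* n
  2<m²+n² zero          n             m≢0 _   _   = contradiction refl m≢0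
  2<m²+n² (suc m)       zero          _   n≢0 _   = contradiction refl n≢0
  2<m²+n² 1             1             _   _   m≢n = contradiction refl m≢n
  2<m²+n² 1             (suc (suc n)) _   _   _   =
      s≤s (ℕₚ.≤-trans (s≤s (s≤s z≤n))
          (ℕₚ.*-mono-≤ {2} {suc (suc n)} {2} (s≤s (s≤s z≤n)) (s≤s (s≤s z≤n))))
  2<m²+n² (suc (suc m)) (suc n)       _   _   _   = ℕₚ.≤-trans (s≤s (s≤s (s≤s z≤n)))
    (ℕₚ.+-mono-≤ {4} {suc (suc m) ℕ.* suc (suc m)} {0}
        (ℕₚ.*-mono-≤ {2} {suc (suc m)} {2} (s≤s (s≤s z≤n)) (s≤s (s≤s z≤n))) z≤n)

  module _ (x y : ℤ) (coprime : ∀ {p} → Prime p → + p ∣ x → ¬ + p ∣ y) where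
    open Familyℤ x y

    -- If 3 divides neither x nor y, then x ≡ ± y modulo 3 and Q₂ is twice a unit square there.
    3∤Q₂ : ¬ + 3 ∣ Q₂
    3∤Q₂ 3∣Q₂ with + 3 ∣? x | + 3 ∣? y
    ... | yes 3∣x | _ = ∤-* prime-3 y y (coprime prime-3 3∣x) (coprime prime-3 3∣x)
        (∣m+n∣m⇒∣n 3∣Q₂ (∣m⇒∣m*n x 3∣x))
    ... | no 3∤x | yes 3∣y = ∤-* prime-3 x x 3∤x 3∤x (∣m+n∣n⇒∣m 3∣Q₂ (∣m⇒∣m*n y 3∣y))
    ... | no 3∤x | no 3∤y with plus-minus-mod-3 x y 3∤x 3∤y
    ...   | inj₁ 3∣x+y = ∤-cong Q₂≡ (∤-+ prime-3 (+ 2 * (x * x)) (x + y) _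
        (∤-* prime-3 (+ 2) (x * x) (3∤2 x y coprime) (∤-* prime-3 x x 3∤x 3∤x)) 3∣x+y) 3∣Q₂
      where
      Q₂≡ : Q₂ ≡ + 2 * (x * x) + (x + y) * (y + - x)
      Q₂≡ = let open Identitiesℤ in solve 2 (λ x y → x :* x :+ y :* y :=
          con (+ 2) :* (x :* x) :+ (x :+ y) :* (y :+ :- x)) refl x y
    ...   | inj₂ (w , refl) = ∤-cong (thirded-Q₂ y w) (∤-+ prime-3 (+ 2 * (y * y)) (+ 3) _
        (∤-* prime-3 (+ 2) (y * y) (3∤2 x y coprime) (∤-* prime-3 y y 3∤y 3∤y)) ∣-refl) 3∣Q₂

    odd-factor⇒prime : ∀ z → 1 < ℤ.∣ z ∣ → ¬ + 2 ∣ z → z ∣ Q₂ → ∃ λ p →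
        Prime p × p ≢ 2 × p ≢ 3 × + p ∣ Q₂
    odd-factor⇒prime z 1<z 2∤z z∣Q₂ with p , pp , p∣z ← prime-factor ℤ.∣ z ∣ 1<z =
      p , pp , (λ { refl → 2∤z (∣ᵤ⇒∣ p∣z) }) , (λ { refl → 3∤Q₂ p∣Q₂ }) , p∣Q₂
      where
      p∣Q₂ : + p ∣ Q₂
      p∣Q₂ = ∣-trans (∣ᵤ⇒∣ p∣z) z∣Q₂

    Q₂-prime : x ≢ +0 → y ≢ +0 → x ≢ y → x + y ≢ +0 → ∃ λ p → Prime p × p ≢ 2 × p ≢ 3 × + p ∣ Q₂
    Q₂-prime x≢0 y≢0 x≢y x+y≢0 = by-parity (+ 2 ∣? x) (+ 2 ∣? y)
      where
      ∣x∣≢∣y∣ : ℤ.∣ x ∣ ≢ ℤ.∣ y ∣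
      ∣x∣≢∣y∣ eq = [ x≢y , (λ x≡-y → x+y≢0 (trans (cong (_+ y) x≡-y) (ℤₚ.+-inverseˡ y))) ]′
          (∣i∣≡∣j∣⇒i≡±j x y eq)
      2<∣Q₂∣ : 2 < ℤ.∣ Q₂ ∣
      2<∣Q₂∣ = subst (λ z → 2 < ℤ.∣ z ∣) (sym (cong₂ _+_ (i*i≡ x) (i*i≡ y)))
        (2<m²+n² ℤ.∣ x ∣ ℤ.∣ y ∣ (x≢0 ∘ ℤₚ.∣i∣≡0⇒i≡0) (y≢0 ∘ ℤₚ.∣i∣≡0⇒i≡0) ∣x∣≢∣y∣)
      by-parity : Dec (+ 2 ∣ x) → Dec (+ 2 ∣ y) → ∃ λ p → Prime p × p ≢ 2 × p ≢ 3 × + p ∣ Q₂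
      by-parity (yes 2∣x) _ = odd-factor⇒prime Q₂ (ℕₚ.<-trans (s≤s (s≤s z≤n)) 2<∣Q₂∣)
        (λ 2∣Q₂ → ∤-* prime-2 y y (coprime prime-2 2∣x) (coprime prime-2 2∣x)
            (∣m+n∣m⇒∣n 2∣Q₂ (∣m⇒∣m*n x 2∣x))) ∣-refl
      by-parity (no 2∤x) (yes 2∣y) = odd-factor⇒prime Q₂ (ℕₚ.<-trans (s≤s (s≤s z≤n)) 2<∣Q₂∣)
        (λ 2∣Q₂ → ∤-* prime-2 x x 2∤x 2∤x (∣m+n∣n⇒∣m 2∣Q₂ (∣m⇒∣m*n y 2∣y))) ∣-refl
      by-parity (no 2∤x) (no 2∤y) with w , x≡ ← odd-odd x y 2∤x 2∤y =
        -- For odd x and y, Q₂ is 2 `h` with `h` odd, being y² plus an even number; 2 < Q₂ becomes 1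
        -- < `h`.
        odd-factor⇒prime (Halvedℤ.h y w) 1<∣h∣
            (∤-+ prime-2 (y * y) (+ 2) _ (∤-* prime-2 y y 2∤y 2∤y) ∣-refl)
          (divides (+ 2) Q₂≡)
        where
        Q₂≡ : Q₂ ≡ + 2 * Halvedℤ.h y w
        Q₂≡ = trans (cong (λ x → Familyℤ.Q₂ x y) x≡) (halved-Q₂ y w)
        1<∣h∣ : 1 < ℤ.∣ Halvedℤ.h y w ∣
        1<∣h∣ = ℕₚ.*-cancelˡ-< 2 1 ℤ.∣ Halvedℤ.h y w ∣
          (subst (2 <_) (trans (cong ℤ.∣_∣ Q₂≡) (ℤₚ.abs-* (+ 2) (Halvedℤ.h y w))) 2<∣Q₂∣)

  family⇒three-primes : ∀ E → FamilyMember (EllipticCurve.equation E) →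
    ∃ λ p → Prime p × p ≢ 2 × p ≢ 3 × 2 ℕ.∣ conductor E × 3 ℕ.∣ conductor E × p ℕ.∣ conductor E
  family⇒three-primes E family = conclude (Q₂-prime x y coprime′ x≢0 y≢0 x≢y x+y≢0)
    where
    open FamilyMember family
    W : Weierstrass _
    W = EllipticCurve.equation E
    M V : Weierstrass ℤ
    M = integralModel W
    V = Familyℤ.curve x y
    ΔM≢0 : Invariantsℤ.Δ M ≢ +0
    ΔM≢0 = let d , d≢0 , M≡ = integralModel-scaled W in Δ≢0-ι-scaled M d W M≡ d≢0
        (EllipticCurve.Δ≢0 E)
    same : SameJ M V
    same = let d , d≢0 , M≡ = integralModel-scaled W in sameJ-twist M W V d r s w v u M≡ curve≡
    coprime′ : ∀ {p} → Prime p → + p ∣ x → ¬ + p ∣ y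
    coprime′ pp p∣x p∣y = ¬prime[1] (subst Prime (coprime (∣⇒∣ᵤ p∣x) (∣⇒∣ᵤ (∣m∣n⇒∣m-n p∣x p∣y))) pp)
    B≡0 : ∀ i j → Familyℤ.B x y ≡ i * j → i ≢ +0
    B≡0 i j B≡ i≡0 = B≢0 (trans B≡ (trans (cong (_* j) i≡0) (ℤₚ.*-zeroˡ j)))
    x≢0 : x ≢ +0
    x≢0 = B≡0 x _ (B-div-x x y)
    y≢0 : y ≢ +0
    y≢0 = B≡0 y _ (B-div-y x y)
    x+y≢0 : x + y ≢ +0
    x+y≢0 = B≡0 (x + y) _ (B-div-x+y x y)
    bad : ∀ {p} → Prime p → ¬ PotentiallyGood p V → p ℕ.∣ conductor E
    bad pp notGood = bad⇒∣conductor E pp ΔM≢0 (notGood ∘ potentiallyGood-sameJ M V ΔM≢0 same)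
    conclude : (∃ λ p → Prime p × p ≢ 2 × p ≢ 3 × + p ∣ Familyℤ.Q₂ x y) →
               ∃ λ p → Prime p × p ≢ 2 × p ≢ 3 × 2 ℕ.∣ conductor E × 3 ℕ.∣ conductor E × p ℕ.∣
                   conductor E
    conclude (p , pp , p≢2 , p≢3 , p∣Q₂) = p , pp , p≢2 , p≢3 ,
      bad prime-2 (bad-at-2 x y coprime′) , bad prime-3 (bad-at-3 x y coprime′) ,
      bad pp (bad-Q₂ x y coprime′ pp (λ p∣2 → p≢2 (prime-∣-prime pp prime-2 (∣⇒∣ᵤ p∣2))) p∣Q₂)

-- Three primes against two

open import Data.Nat.Base using (_<_; _*_; _^_)

theorem3p10 : ¬ (Σ EllipticCurve λ E →
    (Σ (RationalPoint E) λ P → PointHasOrder E P 12)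
    × (∃ λ (p : ℕ) → ∃ λ (q : ℕ) → ∃ λ (α : ℕ) → ∃ λ (β : ℕ) →
    Prime p × Prime q × p ≢ q × 0 < α × 0 < β
    × conductor E ≡ p ^ α * q ^ β))
theorem3p10 (E , (P , ord) , p , q , α , β , pp , pq , _ , _ , _ , N≡) =
  let ℓ , pℓ , ℓ≢2 , ℓ≢3 , 2∣N , 3∣N , ℓ∣N =
        family⇒three-primes E (order12⇒family (EllipticCurve.equation E) P ord)
  in pigeonhole ℓ≢2 ℓ≢3 (p-or-q prime-2 2∣N) (p-or-q prime-3 3∣N) (p-or-q pℓ ℓ∣N)
  where
  p-or-q : ∀ {ℓ} → Prime ℓ → ℓ ℕ.∣ conductor E → ℓ ≡ p ⊎ ℓ ≡ q
  p-or-q {ℓ} pℓ ℓ∣N = prime-∣-^*^ pℓ pp pq α β (≡.subst (ℓ ℕ.∣_) N≡ ℓ∣N)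
  pigeonhole : ∀ {ℓ} → ℓ ≢ 2 → ℓ ≢ 3 → 2 ≡ p ⊎ 2 ≡ q → 3 ≡ p ⊎ 3 ≡ q → ℓ ≡ p ⊎ ℓ ≡ q → ⊥
  -- In the two absent cases 2 and 3 would be the same prime, which unification refutes.
  pigeonhole ℓ≢2 ℓ≢3 (inj₁ ≡.refl) (inj₂ ≡.refl) = [ ℓ≢2 , ℓ≢3 ]′
  pigeonhole ℓ≢2 ℓ≢3 (inj₂ ≡.refl) (inj₁ ≡.refl) = [ ℓ≢3 , ℓ≢2 ]′
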